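{- Let $n,b$ be integers with $b>3$ and $n\ge b+5$, and write $n=p(b+4)+q$ with integers $p\ge 0$ and $0\le q\le b+3$. Then \[ \mathrm{ex}(n, S_{3,b}) = \begin{cases} (p-1)\binom{b+4}{2} + \left\lfloor \dfrac{b(b+4+q)}{2} \right\rfloor, & \text{if } b \geq 24 \text{ and } 4 \leq q \leq b-4,\ \text{or if } 16 \leq b \leq 23 \text{ and } 5 \leq q \leq b-4,\ \text{or if } 14 \leq b \leq 15 \text{ and } 6 \leq q \leq b-5;\\[6pt] (p-1)\binom{b+4}{2} + \left\lfloor \dfrac{b(2b+1)+3}{2} \right\rfloor, & \text{if } b\ge 22 \text{ and } q = b-3; \\[6pt] (p-1)\binom{b+4}{2} + \left\lfloor \dfrac{b(2b+2)+2 + \lfloor b/2 \rfloor}{2} \right\rfloor, & \text{if } b\ge 34 \text{ and } q = b-2; \\[6pt] p\binom{b+4}{2} + \binom{q}{2}, & \text{otherwise}. \end{cases} \]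
   Context: All graphs are finite, simple and undirected. For integers $a,b\ge 0$, the double star $S_{a,b}$ is the tree consisting of a central edge $uv$ together with $a$ further leaves adjacent to $u$ and $b$ further leaves adjacent to $v$. A graph $G$ is $F$-free if it contains no subgraph isomorphic to $F$. The Turán number $\mathrm{ex}(n,F)$ is the maximum number of edges in an $F$-free graph on $n$ vertices. -}

module Defs where

open import Data.Nat using (ℕ; zero; suc; _+_; _*_; _∸_; _≤_; _<_; _≤ᵇ_; _<ᵇ_; _≡ᵇ_)
open import Data.Nat.DivMod using (_/_)
open import Data.Nat.Combinatorics using (_C_)
open import Data.Bool using (Bool; true; false; _∧_; _∨_; if_then_else_)
open import Data.Fin using (Fin; toℕ)
open import Data.List using (map)
open import Data.Nat.ListAction using (sum)
open import Data.List using (List)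
open import Data.Fin.Base using ()
open import Data.Vec.Functional using ()
open import Data.Product using (Σ; _×_; ∃)
open import Relation.Binary.PropositionalEquality using (_≡_; refl; trans; cong)
open import Data.Bool.Properties using (∨-comm)
open import Relation.Nullary using (¬_)
open import Function.Definitions using (Injective)
open import Data.List using (allFin)

record Graph (n : ℕ) : Set where
  field
    adj   : Fin n → Fin n → Bool
    sym   : ∀ i j → adj i j ≡ adj j i
    irrefl : ∀ i → adj i i ≡ false
open Graph public

edgeCount : ∀ {n} → Graph n → ℕ
edgeCount {n} G =
  sum (map (λ i → sum (map (λ j → if (toℕ i <ᵇ toℕ j) ∧ adj G i j then 1 else 0)
                           (allFin n)))
           (allFin n))

_⊆ᵍ_ : ∀ {k n} → Graph k → Graph n → Set
_⊆ᵍ_ {k} {n} F G =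
  Σ (Fin k → Fin n) λ f →
    Injective _≡_ _≡_ f × (∀ i j → adj F i j ≡ true → adj G (f i) (f j) ≡ true)

_-free : ∀ {k n} → Graph n → Graph k → Set
(G -free) F = ¬ (F ⊆ᵍ G)

IsEx : ∀ {k} → ℕ → Graph k → ℕ → Set
IsEx n F m =
  (Σ (Graph n) λ G → (G -free) F × edgeCount G ≡ m)
  × (∀ (G : Graph n) → (G -free) F → edgeCount G ≤ m)

-- Double star S_{a,b} on vertices Fin (2 + a + b):
-- vertex 0 = u, vertex 1 = v, vertices 2 .. a+1 are leaves at u,
-- vertices a+2 .. a+b+1 are leaves at v.
dsAdjℕ : ℕ → ℕ → ℕ → ℕ → Bool
dsAdjℕ a b x y =
     ((x ≡ᵇ 0) ∧ (y ≡ᵇ 1))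
  ∨ ((x ≡ᵇ 0) ∧ (2 ≤ᵇ y) ∧ (y <ᵇ 2 + a))
  ∨ ((x ≡ᵇ 1) ∧ (2 + a ≤ᵇ y) ∧ (y <ᵇ 2 + a + b))

dsAdj : ∀ a b → Fin (2 + a + b) → Fin (2 + a + b) → Bool
dsAdj a b x y = dsAdjℕ a b (toℕ x) (toℕ y) ∨ dsAdjℕ a b (toℕ y) (toℕ x)

private
  dsIrr : ∀ a b x → dsAdjℕ a b x x ≡ false
  dsIrr a b zero = refl
  dsIrr a b (suc zero) with 2 + a ≤ᵇ 1
  ... | false = refl
  ... | true = refl
  dsIrr a b (suc (suc x)) = refl

doubleStar : (a b : ℕ) → Graph (2 + a + b)
doubleStar a b = record
  { adj = dsAdj a b
  ; sym = λ x y → ∨-comm (dsAdjℕ a b (toℕ x) (toℕ y)) (dsAdjℕ a b (toℕ y) (toℕ x))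
  ; irrefl = λ x → trans (cong (λ z → z ∨ z) (dsIrr a b (toℕ x))) refl
  }

case1 : ℕ → ℕ → Bool
case1 b q =
     ((24 ≤ᵇ b) ∧ (4 ≤ᵇ q) ∧ (q ≤ᵇ b ∸ 4))
  ∨ ((16 ≤ᵇ b) ∧ (b ≤ᵇ 23) ∧ (5 ≤ᵇ q) ∧ (q ≤ᵇ b ∸ 4))
  ∨ ((14 ≤ᵇ b) ∧ (b ≤ᵇ 15) ∧ (6 ≤ᵇ q) ∧ (q ≤ᵇ b ∸ 5))

case2 : ℕ → ℕ → Bool
case2 b q = (22 ≤ᵇ b) ∧ (q ≡ᵇ b ∸ 3)

case3 : ℕ → ℕ → Bool
case3 b q = (34 ≤ᵇ b) ∧ (q ≡ᵇ b ∸ 2)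

exS3b : (b p q : ℕ) → ℕ
exS3b b p q =
  if case1 b q then (p ∸ 1) * ((b + 4) C 2) + (b * (b + 4 + q)) / 2
  else if case2 b q then (p ∸ 1) * ((b + 4) C 2) + (b * (2 * b + 1) + 3) / 2
  else if case3 b q then (p ∸ 1) * ((b + 4) C 2) + (b * (2 * b + 2) + 2 + b / 2) / 2
  else p * ((b + 4) C 2) + q C 2

{-# OPTIONS --safe #-}
module Submission where

-- Upper bound. Fix W ⊆ V(G), count degrees inside W, and let |W| = p (b + 4) + q. The deficiency
-- Σ_W (b + 3 − deg) is shown, by induction on |W|, to be at least min (q (b + 4 − q), gap b q).
-- Being S_{3,b}-free says: if deg v > b, then every neighbour of v of degree at least 4 has at most
-- b + 3 − deg v neighbours outside N[v]. Deleting M from W lowers the deficiency by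
-- Σ_M (b + 3 − deg − out_M), where out_M counts neighbours in W ∖ M, so one may delete any M of size
-- b + 4 (q is unchanged) or b + 3 (q increases by one) whose vertices are cheap enough. If the maximum
-- degree is at least b + 4, then b + 4 neighbours of such a vertex will do, as they have degree at most
-- 3; if it is b + 2 or b + 3, a closed neighbourhood of such a vertex or the union of two of them will
-- do. If it equals b + 1, then p = 1 may be assumed, and two vertices of
-- degree b + 1 with different closed neighbourhoods A, B again give such a set when |B ∖ A| ≤ 2,
-- and a large deficiency by counting edges when |B ∖ A| ≥ 3. If all these neighbourhoods coincide
-- with one set A, two counts, one crediting the vertices of degree b + 1 and one debiting them, are
-- added.
--
-- Lower bound. Disjoint copies of K_{b+4}, together with K_q, with a near b-regular circulant, or with
-- a hybrid: a clique on b + 2 vertices from part of which a near 3-regular graph is removed, each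
-- vertex of that part being joined to two vertices of a further clique.

open import Defs hiding (sym; irrefl)
open import Data.Bool using (Bool; true; false; _∧_; _∨_; not; if_then_else_; T)
import Data.Bool as Bool
open import Data.Bool.Properties using (∧-comm; ¬-not)
open import Data.Empty using (⊥; ⊥-elim)
open import Data.Fin using (Fin; zero; suc; _≟_; toℕ; fromℕ<; splitAt; _↑ˡ_; _↑ʳ_; inject₁; fromℕ; inject≤)
open import Data.Fin.Properties
  using (all?; any?; toℕ-fromℕ<; splitAt-↑ˡ; splitAt-↑ʳ; ↑ˡ-injective; ↑ʳ-injective; toℕ<n; toℕ-↑ˡ; toℕ-↑ʳ;
         fromℕ≢inject₁; inject₁-injective; inject≤-injective)
  renaming (suc-injective to fsuc-injective; 0≢1+n to zero≢fsuc)
open import Data.List using (allFin; map; tabulate)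
open import Data.List.Properties using (map-tabulate)
open import Data.Nat
  using (ℕ; zero; suc; _+_; _*_; _∸_; _≤_; _<_; _≥_; z≤n; s≤s; s≤s⁻¹; _≤?_; _≤ᵇ_; _<ᵇ_; _≡ᵇ_; ∣_-_∣)
import Data.Nat as ℕ
open import Data.Nat.Combinatorics using (nC1≡n; nCk+nC[k+1]≡[n+1]C[k+1]) renaming (_C_ to _choose_)
open import Data.Nat.DivMod using (_/_; m≡m%n+[m/n]*n; m%n<n; m/n≤m; m/n*n≤m)
import Data.Nat.ListAction as List
open import Data.Nat.Properties hiding (_≟_)
open import Data.Nat.Tactic.RingSolver using (solve-∀)
open import Algebra.Properties.Semiring.Sum +-*-semiring
  using (sum; sum-cong-≗; ∑-distrib-+; ∑-comm; *-distribˡ-sum; sum-replicate-zero)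
open import Data.Product using (Σ; ∃; _×_; _,_; proj₁; proj₂)
open import Data.Sum using (_⊎_; inj₁; inj₂)
open import Data.Unit using (tt)
open import Data.Vec.Functional using (_∷_)
open import Function using (_∘_)
open import Function.Definitions using (Injective)
open import Relation.Binary.PropositionalEquality
open import Relation.Nullary using (¬_; Dec; yes; no; contradiction)
open import Relation.Nullary.Decidable using (⌊_⌋; from-yes; _×-dec_)

-- Finite sets and sums

-- Each term of the minimum exceeds its value at `q + 1` by at most `b + 3`, so `b + 3` deleted
-- vertices that each gain one pay for raising `q`; `b + 4` deleted vertices need only break even.
-- Deletion stalls at maximum degree `b + 1`, where a closed neighbourhood has just `b + 2`
-- vertices. With two full blocks a deficiency of 2 per vertex already reaches the gap; with one it
-- does not. When all neighbourhoods of that size coincide with `A`, the number of vertices of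
-- degree `b + 1` is unknown. Each adds one to the count `deg ≤ b` and, having no neighbour outside
-- `A`, saves one in the count over `A`; adding the counts cancels it. The sum gives `6 * b` at
-- `q = b - 3`, and the other exceptional value of `gap` at `q = b - 2` after rounding. Its equality
-- case shapes the hybrids: vertices of degree `b + 1` seeing nothing outside `A`, the others in `A`
-- of degree `b` with two neighbours outside, and a clique outside. Everything is stated for degree
-- sums. These are even, so an error of one is harmless; it absorbs the floors and the defect of
-- regular graphs of odd order and odd degree.

-- A certificate for linear arithmetic: `A≤B` is the sum of the hypotheses with their multipliers,
-- `k` the remaining slack, and the equation an identity left to the ring solver.
linear : ∀ {x y} A B k → A ≤ B → x + B + k ≡ y + A → x ≤ y
linear {x} {y} A B k A≤B eq = +-cancelʳ-≤ B x y
  (≤-trans (m≤m+n (x + B) k) (≤-trans (≤-reflexive eq) (+-monoʳ-≤ y A≤B)))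

∧-true : ∀ {x y} → x ∧ y ≡ true → x ≡ true × y ≡ true
∧-true {true} y≡ = refl , y≡

∧-intro : ∀ {x y} → x ≡ true → y ≡ true → x ∧ y ≡ true
∧-intro refl refl = refl

∨-true : ∀ {x y} → x ∨ y ≡ true → x ≡ true ⊎ y ≡ true
∨-true {true}  _  = inj₁ refl
∨-true {false} y≡ = inj₂ y≡

∨-introˡ : ∀ {x y} → x ≡ true → x ∨ y ≡ true
∨-introˡ refl = refl

∨-introʳ : ∀ {x y} → y ≡ true → x ∨ y ≡ true
∨-introʳ {true}  _ = refl
∨-introʳ {false} p = p

not-true : ∀ {x} → ¬ (x ≡ true) → not x ≡ true
not-true {true}  h = contradiction refl h
not-true {false} _ = refl

not-true⁻ : ∀ {x} → not x ≡ true → ¬ (x ≡ true)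
not-true⁻ {true} () refl

true? : ∀ x → x ≡ true ⊎ ¬ (x ≡ true)
true? true  = inj₁ refl
true? false = inj₂ λ ()

≡ᵇ-true : ∀ {m n} → m ≡ n → (m ≡ᵇ n) ≡ true
≡ᵇ-true {zero}  refl = refl
≡ᵇ-true {suc m} refl = ≡ᵇ-true {m} refl

≡ᵇ-true⁻ : ∀ {m n} → (m ≡ᵇ n) ≡ true → m ≡ n
≡ᵇ-true⁻ {m} {n} h = ≡ᵇ⇒≡ m n (subst T (sym h) tt)

≤ᵇ-true : ∀ {m n} → m ≤ n → (m ≤ᵇ n) ≡ true
≤ᵇ-true {m} {n} h with m ≤ᵇ n | ≤⇒≤ᵇ h
... | true | _ = refl

≤ᵇ-true⁻ : ∀ {m n} → (m ≤ᵇ n) ≡ true → m ≤ n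
≤ᵇ-true⁻ {m} {n} h = ≤ᵇ⇒≤ m n (subst T (sym h) tt)

≡ᵇ-false : ∀ {m n} → m ≢ n → (m ≡ᵇ n) ≡ false
≡ᵇ-false {m} {n} h with m ≡ᵇ n in e
... | true  = contradiction (≡ᵇ-true⁻ e) h
... | false = refl

ι : Bool → ℕ
ι true  = 1
ι false = 0

sum-mono : ∀ {n} {f g : Fin n → ℕ} → (∀ i → f i ≤ g i) → sum f ≤ sum g
sum-mono {zero}  h = z≤n
sum-mono {suc n} h = +-mono-≤ (h zero) (sum-mono (h ∘ suc))

VSet : ℕ → Set
VSet n = Fin n → Bool

module _ {n : ℕ} where

  infix 4 _∋_ _⊆_
  infixl 7 _∩_
  infixl 6 _∪_ _∖_

  _∋_ : VSet n → Fin n → Set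
  A ∋ v = A v ≡ true

  _⊆_ : VSet n → VSet n → Set
  A ⊆ B = ∀ v → A ∋ v → B ∋ v

  _∩_ _∪_ _∖_ : VSet n → VSet n → VSet n
  (A ∩ B) v = A v ∧ B v
  (A ∪ B) v = A v ∨ B v
  (A ∖ B) v = A v ∧ not (B v)

  ⁅_⁆ : Fin n → VSet n
  ⁅ v ⁆ w = ⌊ w ≟ v ⌋

  ⁅⁆-elim : ∀ {v w} → ⁅ v ⁆ ∋ w → w ≡ v
  ⁅⁆-elim {v} {w} h with w ≟ v
  ... | yes w≡v = w≡v
  ⁅⁆-elim {v} {w} () | no _

  ⁅⁆-intro : ∀ v → ⁅ v ⁆ ∋ v
  ⁅⁆-intro v with v ≟ v
  ... | yes _ = refl
  ... | no  h = contradiction refl h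

  ∖-intro : ∀ {A B : VSet n} {v} → A ∋ v → ¬ (B ∋ v) → (A ∖ B) ∋ v
  ∖-intro a b = ∧-intro a (not-true b)

  ∖-elim : ∀ {A B : VSet n} {v} → (A ∖ B) ∋ v → A ∋ v × ¬ (B ∋ v)
  ∖-elim h = proj₁ (∧-true h) , not-true⁻ (proj₂ (∧-true h))

sumOver : ∀ {n} → VSet n → (Fin n → ℕ) → ℕ
sumOver A f = sum (λ v → ι (A v) * f v)

# : ∀ {n} → VSet n → ℕ
# A = sum (λ v → ι (A v))

ι-mono : ∀ {x y} → (x ≡ true → y ≡ true) → ι x ≤ ι y
ι-mono {true}  h rewrite h refl = ≤-refl
ι-mono {false} h = z≤n

ι-cover : ∀ {x y z} → (x ≡ true → y ≡ true ⊎ z ≡ true) → ι x ≤ ι y + ι z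
ι-cover {false} h = z≤n
ι-cover {true} {y} {z} h with h refl
... | inj₁ refl = s≤s z≤n
... | inj₂ refl = m≤n+m 1 (ι y)

ι-pack : ∀ {x y z} → (x ≡ true → z ≡ true) → (y ≡ true → z ≡ true) →
  (x ≡ true → y ≡ true → ⊥) → ι x + ι y ≤ ι z
ι-pack {true}  {true}  hx hy d = ⊥-elim (d refl refl)
ι-pack {true}  {false} hx hy d rewrite hx refl = ≤-refl
ι-pack {false} {y}     hx hy d = ι-mono hy

ι-part : ∀ {x y} → (y ≡ true → x ≡ true) → ι x ≡ ι y + ι (x ∧ not y)
ι-part {x} {true} h rewrite h refl = refl
ι-part {true}  {false} h = refl
ι-part {false} {false} h = refl

module _ {n : ℕ} where

  #-mono : {A B : VSet n} → A ⊆ B → # A ≤ # B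
  #-mono h = sum-mono λ v → ι-mono (h v)

  #-cover : {A B C : VSet n} → (∀ v → A ∋ v → B ∋ v ⊎ C ∋ v) → # A ≤ # B + # C
  #-cover {A} {B} {C} h = ≤-trans (sum-mono λ v → ι-cover (h v))
    (≤-reflexive (∑-distrib-+ (ι ∘ B) (ι ∘ C)))

  #-pack : {A B C : VSet n} → A ⊆ C → B ⊆ C → (∀ v → A ∋ v → B ∋ v → ⊥) → # A + # B ≤ # C
  #-pack {A} {B} a b d = ≤-trans (≤-reflexive (sym (∑-distrib-+ (ι ∘ A) (ι ∘ B))))
    (sum-mono λ v → ι-pack (a v) (b v) (d v))

  #-part : {A B : VSet n} → B ⊆ A → # A ≡ # B + # (A ∖ B)
  #-part {A} {B} h = trans (sum-cong-≗ λ v → ι-part (h v)) (∑-distrib-+ (ι ∘ B) (ι ∘ (A ∖ B)))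

  sumOver-part : {A B : VSet n} (f : Fin n → ℕ) → B ⊆ A →
    sumOver A f ≡ sumOver B f + sumOver (A ∖ B) f
  sumOver-part {A} {B} f h = trans
    (sum-cong-≗ λ v → trans (cong (_* f v) (ι-part (h v)))
                            (*-distribʳ-+ (f v) (ι (B v)) (ι ((A ∖ B) v))))
    (∑-distrib-+ (λ v → ι (B v) * f v) (λ v → ι ((A ∖ B) v) * f v))

  sumOver-+ : (A : VSet n) (f g : Fin n → ℕ) →
    sumOver A (λ v → f v + g v) ≡ sumOver A f + sumOver A g
  sumOver-+ A f g = trans (sum-cong-≗ λ v → *-distribˡ-+ (ι (A v)) (f v) (g v))
    (∑-distrib-+ (λ v → ι (A v) * f v) (λ v → ι (A v) * g v))

  sumOver-mono : {A : VSet n} {f g : Fin n → ℕ} →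
    (∀ v → A ∋ v → f v ≤ g v) → sumOver A f ≤ sumOver A g
  sumOver-mono {A} {f} {g} h = sum-mono λ v → pointwise v (A v) refl
    where
    pointwise : ∀ v x → A v ≡ x → ι x * f v ≤ ι x * g v
    pointwise v true  e = +-monoˡ-≤ 0 (h v e)
    pointwise v false e = z≤n

  sumOver-⊆ : {A B : VSet n} {f : Fin n → ℕ} → A ⊆ B → sumOver A f ≤ sumOver B f
  sumOver-⊆ {f = f} h = sum-mono λ v → *-monoˡ-≤ (f v) (ι-mono (h v))

  sumOver-const : (A : VSet n) (c : ℕ) → sumOver A (λ _ → c) ≡ c * # A
  sumOver-const A c = trans (sum-cong-≗ λ v → *-comm (ι (A v)) c)
    (sym (*-distribˡ-sum c (λ v → ι (A v))))

  sumOver-≤ : {A : VSet n} {f : Fin n → ℕ} (c : ℕ) → (∀ v → A ∋ v → f v ≤ c) → sumOver A f ≤ c * # A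
  sumOver-≤ {A} c h = ≤-trans (sumOver-mono h) (≤-reflexive (sumOver-const A c))

  sumOver-ι : (A B : VSet n) → sumOver A (ι ∘ B) ≡ # (A ∩ B)
  sumOver-ι A B = sum-cong-≗ λ v → pointwise (A v) (B v)
    where
    pointwise : ∀ x y → ι x * ι y ≡ ι (x ∧ y)
    pointwise true  y = +-identityʳ (ι y)
    pointwise false y = refl

  #-empty : {A : VSet n} → (∀ v → ¬ (A ∋ v)) → # A ≡ 0
  #-empty {A} h = trans (sum-cong-≗ λ v → pointwise (A v) (h v)) (sum-replicate-zero n)
    where
    pointwise : ∀ x → ¬ (x ≡ true) → ι x ≡ 0
    pointwise true  k = contradiction refl k
    pointwise false k = refl

#-singleton : ∀ {n} (v : Fin n) → # ⁅ v ⁆ ≡ 1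
#-singleton {suc n} zero    = cong suc (#-empty {n} {λ w → ⌊ suc w ≟ zero ⌋} λ w ())
#-singleton {suc n} (suc v) = trans (sum-cong-≗ λ w → pointwise w) (#-singleton v)
  where
  pointwise : ∀ w → ι ⌊ suc w ≟ suc v ⌋ ≡ ι ⌊ w ≟ v ⌋
  pointwise w with w ≟ v
  ... | yes _ = refl
  ... | no  _ = refl

#-full : ∀ n → # {n} (λ _ → true) ≡ n
#-full zero    = refl
#-full (suc n) = cong suc (#-full n)

∷-injective : ∀ {n k} {a : Fin n} {f : Fin k → Fin n} →
  (∀ i → a ≢ f i) → Injective _≡_ _≡_ f → Injective _≡_ _≡_ (a ∷ f)
∷-injective a∉ inj {zero}  {zero}  _  = refl
∷-injective a∉ inj {zero}  {suc j} eq = contradiction eq (a∉ j)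
∷-injective a∉ inj {suc i} {zero}  eq = contradiction (sym eq) (a∉ i)
∷-injective a∉ inj {suc i} {suc j} eq = cong suc (inj eq)

∷-∉ : ∀ {n k} {a c : Fin n} {f : Fin k → Fin n} → a ≢ c → (∀ i → a ≢ f i) → ∀ i → a ≢ (c ∷ f) i
∷-∉ h t zero    = h
∷-∉ h t (suc i) = t i

enumerate : ∀ {n} (A : VSet n) k → k ≤ # A →
  Σ (Fin k → Fin n) λ f → Injective _≡_ _≡_ f × (∀ i → A ∋ f i)
enumerate A zero _ = (λ ()) , (λ {}) , λ ()
enumerate {suc n} A (suc k) h with A zero in eq
... | false = let f , inj , mem = enumerate (A ∘ suc) (suc k) h in
  suc ∘ f , (λ p → inj (fsuc-injective p)) , mem
... | true = let f , inj , mem = enumerate (A ∘ suc) k (s≤s⁻¹ h) in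
  zero ∷ (suc ∘ f) , ∷-injective (λ i → zero≢fsuc) (λ p → inj (fsuc-injective p)) ,
  λ { zero → eq ; (suc i) → mem i }

subsetOfSize : ∀ {n} (A : VSet n) k → k ≤ # A → Σ (VSet n) λ B → B ⊆ A × # B ≡ k
subsetOfSize {n} A zero _ = (λ _ → false) , (λ v ()) , sum-replicate-zero n
subsetOfSize {suc n} A (suc k) h with A zero in eq
... | false = let B , sub , size = subsetOfSize (A ∘ suc) (suc k) h in
  false ∷ B , (λ { (suc v) → sub v }) , size
... | true = let B , sub , size = subsetOfSize (A ∘ suc) k (s≤s⁻¹ h) in
  true ∷ B , (λ { zero _ → eq ; (suc v) → sub v }) , cong suc size

injection-size : ∀ {n k} (A : VSet n) (f : Fin k → Fin n) →
  Injective _≡_ _≡_ f → (∀ i → A ∋ f i) → k ≤ # A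
injection-size {k = zero}  A f inj mem = z≤n
injection-size {k = suc k} A f inj mem = ≤-trans
  (+-mono-≤ (≤-reflexive (sym (#-singleton (f zero))))
            (injection-size (A ∖ ⁅ f zero ⁆) (f ∘ suc) (λ p → fsuc-injective (inj p))
              (λ i → ∖-intro {A = A} {⁅ f zero ⁆} (mem (suc i)) (λ q → zero≢fsuc (inj (sym (⁅⁆-elim q)))))))
  (≤-reflexive (sym (#-part {A = A} λ v q → subst (A ∋_) (sym (⁅⁆-elim q)) (mem zero))))

exceeds? : ∀ {n} (A : VSet n) (f : Fin n → ℕ) c →
  (∃ λ v → A ∋ v × c ≤ f v) ⊎ (∀ v → A ∋ v → f v < c)
exceeds? A f c with any? (λ v → (A v Bool.≟ true) ×-dec (c ≤? f v))
... | yes p = inj₁ p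
... | no ¬p = inj₂ λ v a → ≰⇒> λ q → ¬p (v , a , q)

module _ {n : ℕ} where
  sumOver-cover : {A B C : VSet n} {f : Fin n → ℕ} → (∀ v → A ∋ v → B ∋ v ⊎ C ∋ v) →
    sumOver A f ≤ sumOver B f + sumOver C f
  sumOver-cover {A} {B} {C} {f} h = ≤-trans
    (sum-mono λ v → ≤-trans (*-monoˡ-≤ (f v) (ι-cover (h v))) (≤-reflexive (*-distribʳ-+ (f v) (ι (B v)) (ι (C v)))))
    (≤-reflexive (∑-distrib-+ (λ v → ι (B v) * f v) (λ v → ι (C v) * f v)))

  #-pos : {A : VSet n} {v : Fin n} → A ∋ v → 1 ≤ # A
  #-pos {A} {v} h = ≤-trans (≤-reflexive (sym (#-singleton v)))
    (#-mono {A = ⁅ v ⁆} λ w p → subst (A ∋_) (sym (⁅⁆-elim p)) h)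

  #-zero⁻ : {A : VSet n} {v : Fin n} → # A < 1 → ¬ (A ∋ v)
  #-zero⁻ h p = <⇒≱ h (#-pos p)

  ∪-size : (A B : VSet n) → # (A ∪ B) ≡ # B + # (A ∖ B)
  ∪-size A B = trans (#-part {A = A ∪ B} {B} λ v → ∨-introʳ {A v})
      (cong (# B +_) (sum-cong-≗ λ v → cong ι (lem (A v) (B v))))
    where
    lem : ∀ x y → (x ∨ y) ∧ not y ≡ x ∧ not y
    lem true  y     = refl
    lem false true  = refl
    lem false false = refl

  ∩∖-size : (A B : VSet n) → # A ≡ # (A ∩ B) + # (A ∖ B)
  ∩∖-size A B = trans (sum-cong-≗ λ v → lem (A v) (B v)) (∑-distrib-+ (ι ∘ (A ∩ B)) (ι ∘ (A ∖ B)))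
    where
    lem : ∀ x y → ι x ≡ ι (x ∧ y) + ι (x ∧ not y)
    lem true  true  = refl
    lem true  false = refl
    lem false y     = refl

  sumOver-point : {A : VSet n} {v : Fin n} (f : Fin n → ℕ) → A ∋ v → f v ≤ sumOver A f
  sumOver-point {A} {v} f h = begin
    f v                         ≡⟨ *-identityʳ (f v) ⟨
    f v * 1                     ≡⟨ cong (f v *_) (#-singleton v) ⟨
    f v * # ⁅ v ⁆               ≡⟨ sumOver-const ⁅ v ⁆ (f v) ⟨
    sumOver ⁅ v ⁆ (λ _ → f v)   ≤⟨ sumOver-mono {A = ⁅ v ⁆} (λ w p → ≤-reflexive (cong f (sym (⁅⁆-elim p)))) ⟩
    sumOver ⁅ v ⁆ f             ≤⟨ sumOver-⊆ {A = ⁅ v ⁆} {A} (λ w p → subst (A ∋_) (sym (⁅⁆-elim p)) h) ⟩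
    sumOver A f                 ∎
    where open ≤-Reasoning

-- Neighbourhoods in a set of vertices

module Neighbourhoods {n : ℕ} (G : Graph n) where

  adj-sym : ∀ {u v} → adj G u v ≡ true → adj G v u ≡ true
  adj-sym {u} {v} h = trans (Graph.sym G v u) h

  adj-irrefl : ∀ {v} → ¬ (adj G v v ≡ true)
  adj-irrefl {v} h with trans (sym h) (Graph.irrefl G v)
  ... | ()

  adj⇒≢ : ∀ {u v} → adj G u v ≡ true → u ≢ v
  adj⇒≢ h refl = adj-irrefl h

  deg : VSet n → Fin n → ℕ
  deg A v = # (A ∩ adj G v)

  degSum : VSet n → ℕ
  degSum A = sumOver A (deg A)

  N[_] : Fin n → VSet n → VSet n
  N[ v ] W w = W w ∧ (adj G v w ∨ ⁅ v ⁆ w)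

  deg-mono : ∀ {A B : VSet n} {v} → A ⊆ B → deg A v ≤ deg B v
  deg-mono h = #-mono λ w p → ∧-intro (h w (proj₁ (∧-true p))) (proj₂ (∧-true p))

  deg-cover : ∀ {A B C : VSet n} {v} → (∀ w → A ∋ w → B ∋ w ⊎ C ∋ w) → deg A v ≤ deg B v + deg C v
  deg-cover {A} {B} {C} {v} h = #-cover {B = B ∩ adj G v} {C ∩ adj G v} λ w p → lift w (h w (proj₁ (∧-true p)))
      (proj₂ (∧-true p))
    where
    lift : ∀ w → B ∋ w ⊎ C ∋ w → adj G v w ≡ true → (B ∩ adj G v) ∋ w ⊎ (C ∩ adj G v) ∋ w
    lift w (inj₁ p) a = inj₁ (∧-intro p a)
    lift w (inj₂ p) a = inj₂ (∧-intro p a)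

  deg-pack : ∀ {A B C : VSet n} {v} → A ⊆ C → B ⊆ C → (∀ w → A ∋ w → B ∋ w → ⊥) →
    deg A v + deg B v ≤ deg C v
  deg-pack {A} {B} {C} {v} a b d = #-pack {A = A ∩ adj G v} {B ∩ adj G v} {C ∩ adj G v}
    (λ w p → ∧-intro (a w (proj₁ (∧-true p))) (proj₂ (∧-true p)))
    (λ w p → ∧-intro (b w (proj₁ (∧-true p))) (proj₂ (∧-true p)))
    λ w p q → d w (proj₁ (∧-true p)) (proj₁ (∧-true q))

  deg-part : ∀ {A B : VSet n} {v} → B ⊆ A → deg A v ≡ deg B v + deg (A ∖ B) v
  deg-part {A} {B} {v} h = ≤-antisym (deg-cover split)
    (deg-pack {C = A} h (λ w p → proj₁ (∖-elim {A = A} {B} p)) λ w p q → proj₂ (∖-elim {A = A} {B} q) p)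
    where
    split : ∀ w → A ∋ w → B ∋ w ⊎ (A ∖ B) ∋ w
    split w p with true? (B w)
    ... | inj₁ q = inj₁ q
    ... | inj₂ q = inj₂ (∖-intro {A = A} {B} p q)

  deg<# : ∀ {A : VSet n} {v} → A ∋ v → suc (deg A v) ≤ # A
  deg<# {A} {v} h = ≤-trans (≤-reflexive (cong (_+ deg A v) (sym (#-singleton v))))
    (#-pack {A = ⁅ v ⁆} (λ w p → subst (A ∋_) (sym (⁅⁆-elim p)) h) (λ w p → proj₁ (∧-true p))
      λ w p q → adj⇒≢ (proj₂ (∧-true q)) (sym (⁅⁆-elim p)))

  -- Double counting of the adjacent pairs between `A` and `B`.
  sumOver-deg-swap : ∀ (A B : VSet n) → sumOver A (deg B) ≡ sumOver B (deg A)
  sumOver-deg-swap A B = begin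
    sum (λ v → ι (A v) * sum (λ w → ι (B w ∧ adj G v w)))
      ≡⟨ sum-cong-≗ (λ v → *-distribˡ-sum (ι (A v)) (λ w → ι (B w ∧ adj G v w))) ⟩
    sum (λ v → sum (λ w → ι (A v) * ι (B w ∧ adj G v w)))
      ≡⟨ ∑-comm (λ v w → ι (A v) * ι (B w ∧ adj G v w)) ⟩
    sum (λ w → sum (λ v → ι (A v) * ι (B w ∧ adj G v w)))
      ≡⟨ sum-cong-≗ (λ w → sum-cong-≗ λ v →
           trans (swap (A v) (B w) (adj G v w)) (cong (λ z → ι (B w) * ι (A v ∧ z)) (Graph.sym G v w))) ⟩
    sum (λ w → sum (λ v → ι (B w) * ι (A v ∧ adj G w v)))
      ≡⟨ sum-cong-≗ (λ w → *-distribˡ-sum (ι (B w)) (λ v → ι (A v ∧ adj G w v))) ⟨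
    sum (λ w → ι (B w) * sum (λ v → ι (A v ∧ adj G w v))) ∎
    where
    open ≡-Reasoning
    swap : ∀ x y z → ι x * ι (y ∧ z) ≡ ι y * ι (x ∧ z)
    swap true  true  z = refl
    swap true  false z = refl
    swap false true  z = refl
    swap false false z = refl

  -- An edge leaving `M` disappears from the degrees at both of its ends, hence the additional
  -- `deg (W ∖ M) v`. The summand `deg W v + deg (W ∖ M) v` is the weight by which every deletion
  -- below is judged.
  degSum-peel : ∀ {W M : VSet n} → M ⊆ W →
    degSum W ≡ sumOver M (λ v → deg W v + deg (W ∖ M) v) + degSum (W ∖ M)
  degSum-peel {W} {M} M⊆W = begin
    sumOver W (deg W)
      ≡⟨ sumOver-part {A = W} {M} (deg W) M⊆W ⟩
    sumOver M (deg W) + sumOver R (deg W)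
      ≡⟨ cong (sumOver M (deg W) +_) (trans (sum-cong-≗ λ v → cong (ι (R v) *_) (deg-part M⊆W))
          (sumOver-+ R (deg M) (deg R))) ⟩
    sumOver M (deg W) + (sumOver R (deg M) + degSum R)
      ≡⟨ cong (λ z → sumOver M (deg W) + (z + degSum R)) (sumOver-deg-swap R M) ⟩
    sumOver M (deg W) + (sumOver M (deg R) + degSum R)
      ≡⟨ +-assoc (sumOver M (deg W)) _ _ ⟨
    sumOver M (deg W) + sumOver M (deg R) + degSum R
      ≡⟨ cong (_+ degSum R) (sumOver-+ M (deg W) (deg R)) ⟨
    sumOver M (λ v → deg W v + deg R v) + degSum R ∎
    where
    open ≡-Reasoning
    R = W ∖ M

  N-elim : ∀ {W v w} → N[ v ] W ∋ w → W ∋ w × (adj G v w ≡ true ⊎ w ≡ v)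
  N-elim {W} {v} {w} h with ∨-true (proj₂ (∧-true {W w} h))
  ... | inj₁ a = proj₁ (∧-true h) , inj₁ a
  ... | inj₂ e = proj₁ (∧-true h) , inj₂ (⁅⁆-elim e)

  N⊆ : ∀ {W v} → N[ v ] W ⊆ W
  N⊆ w h = proj₁ (∧-true h)

  N-adj : ∀ {W v w} → W ∋ w → adj G v w ≡ true → N[ v ] W ∋ w
  N-adj p a = ∧-intro p (∨-introˡ a)

  N-self : ∀ {W v} → W ∋ v → N[ v ] W ∋ v
  N-self {v = v} p = ∧-intro p (∨-introʳ (⁅⁆-intro v))

  #N : ∀ {W v} → W ∋ v → # (N[ v ] W) ≡ suc (deg W v)
  #N {W} {v} h = ≤-antisym
    (≤-trans (#-cover {B = ⁅ v ⁆} {W ∩ adj G v} split) (≤-reflexive (cong (_+ deg W v) (#-singleton v))))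
    (≤-trans (≤-reflexive (cong (_+ deg W v) (sym (#-singleton v))))
      (#-pack {A = ⁅ v ⁆} {W ∩ adj G v} (λ w p → subst (N[ v ] W ∋_) (sym (⁅⁆-elim p)) (N-self {W} h))
        (λ w p → N-adj {W} (proj₁ (∧-true p)) (proj₂ (∧-true p)))
        λ w p q → adj⇒≢ (proj₂ (∧-true q)) (sym (⁅⁆-elim p))))
    where
    split : ∀ w → N[ v ] W ∋ w → ⁅ v ⁆ ∋ w ⊎ (W ∩ adj G v) ∋ w
    split w p with N-elim {W} p
    ... | q , inj₁ a = inj₂ (∧-intro q a)
    ... | q , inj₂ refl = inj₁ (⁅⁆-intro w)

  doubleStar-embeds : ∀ b (u v : Fin n) (X Y : VSet n) → adj G u v ≡ true →
    (∀ w → X ∋ w → adj G u w ≡ true × w ≢ v) →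
    (∀ w → Y ∋ w → adj G v w ≡ true × w ≢ u) →
    (∀ w → X ∋ w → ¬ (Y ∋ w)) → 3 ≤ # X → b ≤ # Y → doubleStar 3 b ⊆ᵍ G
  doubleStar-embeds b u v X Y uv hX hY disj 3≤X b≤Y = f , injective , edges
    where
    x = proj₁ (enumerate X 3 3≤X)
    x-inj = proj₁ (proj₂ (enumerate X 3 3≤X))
    x∈ = proj₂ (proj₂ (enumerate X 3 3≤X))
    y = proj₁ (enumerate Y b b≤Y)
    y-inj = proj₁ (proj₂ (enumerate Y b b≤Y))
    y∈ = proj₂ (proj₂ (enumerate Y b b≤Y))
    i₀ i₁ i₂ : Fin 3
    i₀ = zero
    i₁ = suc zero
    i₂ = suc (suc zero)
    f : Fin (5 + b) → Fin n
    f = u ∷ (v ∷ (x i₀ ∷ (x i₁ ∷ (x i₂ ∷ y))))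
    u≢x : ∀ i → u ≢ x i
    u≢x i = adj⇒≢ (proj₁ (hX _ (x∈ i)))
    v≢x : ∀ i → v ≢ x i
    v≢x i e = proj₂ (hX _ (x∈ i)) (sym e)
    u≢y : ∀ j → u ≢ y j
    u≢y j e = proj₂ (hY _ (y∈ j)) (sym e)
    v≢y : ∀ j → v ≢ y j
    v≢y j = adj⇒≢ (proj₁ (hY _ (y∈ j)))
    x≢y : ∀ i j → x i ≢ y j
    x≢y i j e = disj _ (x∈ i) (subst (Y ∋_) (sym e) (y∈ j))
    x≢x : ∀ {i j} → i ≢ j → x i ≢ x j
    x≢x h e = h (x-inj e)
    injective : Injective _≡_ _≡_ f
    injective =
      ∷-injective (∷-∉ (adj⇒≢ uv) (∷-∉ (u≢x i₀) (∷-∉ (u≢x i₁) (∷-∉ (u≢x i₂) u≢y))))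
      (∷-injective (∷-∉ (v≢x i₀) (∷-∉ (v≢x i₁) (∷-∉ (v≢x i₂) v≢y)))
      (∷-injective (∷-∉ (x≢x λ ()) (∷-∉ (x≢x λ ()) (x≢y i₀)))
      (∷-injective (∷-∉ (x≢x λ ()) (x≢y i₁))
      (∷-injective (x≢y i₂) y-inj))))
    half : ∀ i j → dsAdjℕ 3 b (toℕ i) (toℕ j) ≡ true → adj G (f i) (f j) ≡ true
    half zero zero ()
    half zero (suc zero) _ = uv
    half zero (suc (suc zero)) _ = proj₁ (hX _ (x∈ i₀))
    half zero (suc (suc (suc zero))) _ = proj₁ (hX _ (x∈ i₁))
    half zero (suc (suc (suc (suc zero)))) _ = proj₁ (hX _ (x∈ i₂))
    half zero (suc (suc (suc (suc (suc j))))) ()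
    half (suc zero) zero ()
    half (suc zero) (suc zero) ()
    half (suc zero) (suc (suc zero)) ()
    half (suc zero) (suc (suc (suc zero))) ()
    half (suc zero) (suc (suc (suc (suc zero)))) ()
    half (suc zero) (suc (suc (suc (suc (suc j))))) _ = proj₁ (hY _ (y∈ j))
    half (suc (suc i)) j ()
    edges : ∀ i j → dsAdj 3 b i j ≡ true → adj G (f i) (f j) ≡ true
    edges i j h with ∨-true h
    ... | inj₁ p = half i j p
    ... | inj₂ p = adj-sym (half j i p)

  -- Otherwise a double star is built greedily. The leaves of `u` are taken outside `N[ v ] W` as
  -- far as possible, because those cost `v` nothing; each common neighbour used instead removes one
  -- candidate leaf of `v`.
  free⇒small-union : ∀ b → (G -free) (doubleStar 3 b) → ∀ (W : VSet n) {u v} → adj G u v ≡ true →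
    W ∋ v → 4 ≤ deg W u → suc b ≤ deg W v → deg W v + deg (W ∖ N[ v ] W) u ≤ b + 3
  free⇒small-union b free W {u} {v} uv v∈W 4≤u b<v with deg W v + deg (W ∖ N[ v ] W) u ≤? b + 3
  ... | yes h = h
  ... | no ¬h = contradiction embeds free
    where
    O I Y₀ : VSet n
    O = (W ∖ N[ v ] W) ∩ adj G u
    I = (W ∩ adj G v) ∩ adj G u
    Y₀ = (W ∩ adj G v) ∖ ⁅ u ⁆
    large : b + 4 ≤ deg W v + # O
    large = ≤-trans (≤-reflexive (+-suc b 3)) (≰⇒> ¬h)
    O-elim : ∀ w → O ∋ w → adj G u w ≡ true × w ≢ v × ¬ (adj G v w ≡ true)
    O-elim w p with ∖-elim {A = W} {N[ v ] W} (proj₁ (∧-true p))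
    ... | w∈W , ∉N = proj₂ (∧-true p) , (λ { refl → ∉N (N-self {W} w∈W) }) , λ a → ∉N (N-adj {W} w∈W a)
    I-elim : ∀ w → I ∋ w → adj G u w ≡ true × adj G v w ≡ true
    I-elim w p = proj₂ (∧-true p) , proj₂ (∧-true {W w} (proj₁ (∧-true p)))
    u-cover : ∀ w → (W ∩ adj G u) ∋ w → ⁅ v ⁆ ∋ w ⊎ (O ∪ I) ∋ w
    u-cover w p with true? (N[ v ] W w)
    ... | inj₂ ∉N = inj₂ (∨-introˡ (∧-intro (∖-intro {A = W} {N[ v ] W} (proj₁ (∧-true p)) ∉N) (proj₂ (∧-true p))))
    ... | inj₁ ∈N with N-elim {W} ∈N
    ... | q , inj₁ a = inj₂ (∨-introʳ {O w} (∧-intro (∧-intro q a) (proj₂ (∧-true p))))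
    ... | q , inj₂ refl = inj₁ (⁅⁆-intro w)
    3≤OI : 3 ≤ # (O ∪ I)
    3≤OI = s≤s⁻¹ (≤-trans 4≤u (≤-trans (#-cover {B = ⁅ v ⁆} {O ∪ I} u-cover)
      (≤-reflexive (cong (_+ # (O ∪ I)) (#-singleton v)))))
    Y₀-cover : ∀ w → (W ∩ adj G v) ∋ w → ⁅ u ⁆ ∋ w ⊎ Y₀ ∋ w
    Y₀-cover w p with true? (⁅ u ⁆ w)
    ... | inj₁ q = inj₁ q
    ... | inj₂ q = inj₂ (∖-intro {A = W ∩ adj G v} {⁅ u ⁆} p q)
    v≤ : deg W v ≤ 1 + # Y₀
    v≤ = ≤-trans (#-cover {B = ⁅ u ⁆} {Y₀} Y₀-cover) (≤-reflexive (cong (_+ # Y₀) (#-singleton u)))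
    OI-good : ∀ w → (O ∪ I) ∋ w → adj G u w ≡ true × w ≢ v
    OI-good w p with ∨-true p
    ... | inj₁ q = proj₁ (O-elim w q) , proj₁ (proj₂ (O-elim w q))
    ... | inj₂ q = proj₁ (I-elim w q) , λ e → adj⇒≢ (proj₂ (I-elim w q)) (sym e)
    Y₀-good : ∀ w → Y₀ ∋ w → adj G v w ≡ true × w ≢ u
    Y₀-good w p with ∖-elim {A = W ∩ adj G v} {⁅ u ⁆} p
    ... | q , r = proj₂ (∧-true q) , λ { refl → r (⁅⁆-intro w) }
    embeds : doubleStar 3 b ⊆ᵍ G
    embeds with 3 ≤? # O
    ... | yes 3≤O = doubleStar-embeds b u v O Y₀ uv (λ w p → OI-good w (∨-introˡ p)) Y₀-good
          (λ w p q → proj₂ (proj₂ (O-elim w p)) (proj₁ (Y₀-good w q)))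
          3≤O (s≤s⁻¹ (≤-trans b<v v≤))
    -- Only the missing `3 ∸ # O` leaves come from the common neighbours. By `large`, `v` then still
    -- keeps `b` of its own.
    ... | no 3≰O with subsetOfSize I (3 ∸ # O) (m≤n+o⇒m∸n≤o 3 (# O)
        (≤-trans 3≤OI (#-cover {A = O ∪ I} {O} {I} λ w → ∨-true)))
    ... | J , J⊆I , #J = doubleStar-embeds b u v (O ∪ J) (Y₀ ∖ J) uv good
          (λ w p → Y₀-good w (proj₁ (∖-elim {A = Y₀} {J} p))) disjoint 3≤ b≤
      where
      #O+#J : # O + # J ≡ 3
      #O+#J = trans (cong (# O +_) #J) (m+[n∸m]≡n (<⇒≤ (≰⇒> 3≰O)))
      good : ∀ w → (O ∪ J) ∋ w → adj G u w ≡ true × w ≢ v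
      good w p with ∨-true p
      ... | inj₁ q = OI-good w (∨-introˡ q)
      ... | inj₂ q = OI-good w (∨-introʳ {O w} (J⊆I w q))
      disjoint : ∀ w → (O ∪ J) ∋ w → ¬ ((Y₀ ∖ J) ∋ w)
      disjoint w p y with ∨-true p
      ... | inj₁ q = proj₂ (proj₂ (O-elim w q)) (proj₁ (Y₀-good w (proj₁ (∖-elim {A = Y₀} {J} y))))
      ... | inj₂ q = proj₂ (∖-elim {A = Y₀} {J} y) q
      3≤ : 3 ≤ # (O ∪ J)
      3≤ = ≤-trans (≤-reflexive (sym #O+#J)) (#-pack {A = O} {J} (λ w → ∨-introˡ) (λ w → ∨-introʳ {O w})
        λ w p q → proj₂ (proj₂ (O-elim w p)) (proj₂ (I-elim w (J⊆I w q))))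
      Y-cover : ∀ w → Y₀ ∋ w → J ∋ w ⊎ (Y₀ ∖ J) ∋ w
      Y-cover w p with true? (J w)
      ... | inj₁ q = inj₁ q
      ... | inj₂ q = inj₂ (∖-intro {A = Y₀} {J} p q)
      b≤ : b ≤ # (Y₀ ∖ J)
      b≤ = +-cancelˡ-≤ 4 b (# (Y₀ ∖ J)) (≤-trans (≤-reflexive (+-comm 4 b)) (≤-trans large
        (≤-trans (+-monoˡ-≤ (# O) (≤-trans v≤ (+-monoʳ-≤ 1 (#-cover {B = J} Y-cover))))
          (≤-reflexive (trans (rearrange (# J) (# (Y₀ ∖ J)) (# O)) (cong (λ z → suc z + # (Y₀ ∖ J)) #O+#J))))))
        where
        rearrange : ∀ j y o → 1 + (j + y) + o ≡ suc (o + j) + y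
        rearrange = solve-∀

-- Arithmetic of the upper bound

-- The parity argument: between doubled quantities an error of one is lost.
half-≤ : ∀ {x y} → 2 * x ≤ 2 * y + 1 → x ≤ y
half-≤ {x} {y} h with x ≤? y
... | yes p = p
... | no ¬p = contradiction (≤-trans (*-monoʳ-≤ 2 (≰⇒> ¬p)) h) (<⇒≱ (≤-reflexive (eq y)))
  where
  eq : ∀ y → suc (2 * y + 1) ≡ 2 * suc y
  eq = solve-∀

≤-half+ : ∀ b → b ≤ 2 * (b / 2) + 1
≤-half+ b = ≤-trans (≤-reflexive (m≡m%n+[m/n]*n b 2))
  (≤-trans (+-monoˡ-≤ ((b / 2) * 2) (s≤s⁻¹ (m%n<n b 2))) (≤-reflexive (eq (b / 2))))
  where
  eq : ∀ h → 1 + h * 2 ≡ 2 * h + 1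
  eq = solve-∀

-- Deficiency, up to parity, of a b-regular graph on b + 4 + q vertices, or of a hybrid for q = b − 3, b − 2.
gap : ℕ → ℕ → ℕ
gap b q = if q + 3 ≡ᵇ b then 6 * b
          else if q + 2 ≡ᵇ b then 6 * b + 4 ∸ b / 2
          else 3 * (b + 4 + q)

gap-3 : ∀ {b q} → q + 3 ≡ b → gap b q ≡ 6 * b
gap-3 e rewrite ≡ᵇ-true e = refl

gap-2 : ∀ {b q} → q + 2 ≡ b → gap b q ≡ 6 * b + 4 ∸ b / 2
gap-2 {b} {q} e
  rewrite ≡ᵇ-false {q + 3} {b} (λ h → 1+n≢n (trans (sym (+-suc q 2)) (trans h (sym e)))) | ≡ᵇ-true e = refl

-- The exceptional values lie below the regular one, by 3 at `q = b - 3` and by `2 + b / 2` at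
-- `q = b - 2`.
gap-≤ : ∀ b q → gap b q ≤ 3 * (b + 4 + q)
gap-≤ b q with q + 3 ≡ᵇ b in e₃
... | true = ≤-trans (m≤m+n (6 * b) 3) (≤-reflexive
    (trans (eq b) (trans (cong (λ z → 3 * b + 3 * (z + 1)) (sym (≡ᵇ-true⁻ {q + 3} e₃))) (eq' b q))))
  where
  eq : ∀ b → 6 * b + 3 ≡ 3 * b + 3 * (b + 1)
  eq = solve-∀
  eq' : ∀ b q → 3 * b + 3 * (q + 3 + 1) ≡ 3 * (b + 4 + q)
  eq' = solve-∀
... | false with q + 2 ≡ᵇ b in e₂
... | true = ≤-trans (m∸n≤m (6 * b + 4) (b / 2)) (≤-trans (m≤m+n (6 * b + 4) 2)
   (≤-reflexive (trans (eq b) (trans (cong (λ z → 3 * b + 3 * (z + 2)) (sym (≡ᵇ-true⁻ {q + 2} e₂))) (eq' b q)))))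
  where
  eq : ∀ b → 6 * b + 4 + 2 ≡ 3 * b + 3 * (b + 2)
  eq = solve-∀
  eq' : ∀ b q → 3 * b + 3 * (q + 2 + 2) ≡ 3 * (b + 4 + q)
  eq' = solve-∀
... | false = ≤-refl

-- By `gap-≤` the left side may be replaced by the regular value. That value increases with `q`, so
-- only an exceptional value at `suc q` can fall short, and by less than `b + 3`.
gap-step : ∀ b q → gap b q ≤ gap b (suc q) + (b + 3)
gap-step b q = ≤-trans (gap-≤ b q) bound
  where
  bound : 3 * (b + 4 + q) ≤ gap b (suc q) + (b + 3)
  bound with suc q + 3 ≡ᵇ b in e₃
  ... | true = ≤-trans (≤-reflexive (trans (eq b q)
      (trans (cong (λ z → 3 * b + 3 * z) (≡ᵇ-true⁻ {suc q + 3} {b} e₃)) (eq' b)))) (m≤m+n _ (b + 3))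
    where
    eq : ∀ b q → 3 * (b + 4 + q) ≡ 3 * b + 3 * (suc q + 3)
    eq = solve-∀
    eq' : ∀ b → 3 * b + 3 * b ≡ 6 * b
    eq' = solve-∀
  ... | false with suc q + 2 ≡ᵇ b in e₂
  ... | true = ≤-trans (≤-reflexive (trans (eq b q)
      (trans (cong (λ z → 3 * b + 3 * (z + 1)) (≡ᵇ-true⁻ {suc q + 2} {b} e₂)) (eq' b))))
       (≤-trans (m≤m+n (6 * b + 3) 4) (≤-trans (≤-reflexive (eq'' b)) (≤-trans
         (+-monoˡ-≤ 3 (m≤n+m∸n (6 * b + 4) (b / 2)))
             (≤-trans (+-monoˡ-≤ 3 (+-monoˡ-≤ (6 * b + 4 ∸ b / 2) (m/n≤m b 2)))
           (≤-reflexive (eq''' b (6 * b + 4 ∸ b / 2)))))))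
    where
    eq : ∀ b q → 3 * (b + 4 + q) ≡ 3 * b + 3 * (suc q + 2 + 1)
    eq = solve-∀
    eq' : ∀ b → 3 * b + 3 * (b + 1) ≡ 6 * b + 3
    eq' = solve-∀
    eq'' : ∀ b → 6 * b + 3 + 4 ≡ 6 * b + 4 + 3
    eq'' = solve-∀
    eq''' : ∀ b c → b + c + 3 ≡ c + (b + 3)
    eq''' = solve-∀
  ... | false = ≤-trans (m≤m+n _ (3 + (b + 3))) (≤-reflexive (eq b q))
    where
    eq : ∀ b q → 3 * (b + 4 + q) + (3 + (b + 3)) ≡ 3 * (b + 4 + suc q) + (b + 3)
    eq = solve-∀

-- Lower bounds on the deficiency and their behaviour under deletion

-- The deficiency `(b + 3) * n - S` is at least the smaller of two terms; a disjunction with `S`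
-- moved to the left avoids both the minimum and a truncated subtraction. The first term is the
-- deficiency of disjoint copies of K_{b+4} together with K_q, where only the `q` vertices of the
-- last clique lack anything.
data Bound (b S n q : ℕ) : Set where
  by-clique : S + q * (b + 4 ∸ q) ≤ (b + 3) * n → Bound b S n q
  by-gap    : S + gap b q ≤ (b + 3) * n → Bound b S n q

complement : ∀ {b q} → q ≤ b + 3 → q + (b + 4 ∸ q) ≡ b + 4
complement {b} h = m+[n∸m]≡n (≤-trans h (+-monoʳ-≤ b (n≤1+n 3)))

bound-clique : ∀ {b S q} → q ≤ b + 3 → S + q ≤ q * q → Bound b S q q
bound-clique {b} {S} {q} q≤ h = by-clique (linear (S + q + q * (q + z)) (q * q + q * (b + 4)) 0
  (+-mono-≤ h (≤-reflexive (cong (q *_) (complement q≤)))) (eq b S q z))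
  where
  z = b + 4 ∸ q
  eq : ∀ b S q z → S + q * z + (q * q + q * (b + 4)) + 0 ≡ (b + 3) * q + (S + q + q * (q + z))
  eq = solve-∀

-- Degree at most `b + 1` leaves a deficiency of 2 per vertex. For exactly two full blocks this
-- exceeds `3 * (b + 4 + q)` by `b + 4 - q`, and further blocks only help.
bound-two-blocks : ∀ {b S n p q} → q ≤ b + 3 → n ≡ suc (suc p) * (b + 4) + q → S ≤ (b + 1) * n → Bound b S n q
bound-two-blocks {b} {S} {n} {p} {q} q≤ refl h = by-gap
    (≤-trans (+-mono-≤ h (≤-trans (gap-≤ b q) aux)) (≤-reflexive (eq b n)))
  where
  eq : ∀ b n → (b + 1) * n + 2 * n ≡ (b + 3) * n
  eq = solve-∀
  eq' : ∀ b p q → 3 * (b + 4 + q) + (b + 3) + (2 * p * (b + 4) + 1) ≡ 2 * (suc (suc p) * (b + 4) + q) + q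
  eq' = solve-∀
  aux : 3 * (b + 4 + q) ≤ 2 * (suc (suc p) * (b + 4) + q)
  aux = linear q (b + 3) (2 * p * (b + 4) + 1) q≤ (eq' b p q)

bound-regular : ∀ {b S n p q} → n ≡ suc p * (b + 4) + q → S ≤ b * n → Bound b S n q
bound-regular {b} {S} {n} {p} {q} refl h = by-gap (≤-trans (+-mono-≤ h (≤-trans (gap-≤ b q) aux))
    (≤-reflexive (eq b n)))
  where
  eq : ∀ b n → b * n + 3 * n ≡ (b + 3) * n
  eq = solve-∀
  eq' : ∀ b p q → 3 * (b + 4 + q) + 3 * p * (b + 4) ≡ 3 * (suc p * (b + 4) + q)
  eq' = solve-∀
  aux : 3 * (b + 4 + q) ≤ 3 * (suc p * (b + 4) + q)
  aux = ≤-trans (m≤m+n _ (3 * p * (b + 4))) (≤-reflexive (eq' b p q))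

-- The right side is larger by `2 * (b + 3 - q)`.
clique-step : ∀ {b q} → q < b + 3 → q * (b + 4 ∸ q) ≤ suc q * (b + 4 ∸ suc q) + (b + 3)
clique-step {b} {q} q< = subst (λ z → q * z ≤ suc q * z' + (b + 3)) (sym z≡)
  (linear (q + z') (b + 3) (2 * z') (≤-reflexive (suc-injective (trans e' (+-suc b 3)))) (eq b q z'))
  where
  z' = b + 4 ∸ suc q
  e' : suc q + z' ≡ b + 4
  e' = m+[n∸m]≡n (≤-trans q< (+-monoʳ-≤ b (n≤1+n 3)))
  z≡ : b + 4 ∸ q ≡ suc z'
  z≡ = +-cancelˡ-≡ q _ _ (trans (complement (<⇒≤ q<)) (trans (sym e') (sym (+-suc q z'))))
  eq : ∀ b q z' → q * suc z' + (b + 3) + 2 * z' ≡ suc q * z' + (b + 3) + (q + z')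
  eq = solve-∀

-- The second hypothesis on `M` says that the `b + 3` deleted vertices have average weight at most
-- `b + 2`. The deficiency then falls by at least `b + 3`, which is what passing from `suc q` back
-- to `q` consumes in either term.
bound-step : ∀ {b S S' M n n' q} → q < b + 3 → Bound b S' n' (suc q) →
  S ≤ M + S' → M + (b + 3) ≤ (b + 3) * (b + 3) → n ≡ b + 3 + n' → Bound b S n q
bound-step {b} {S} {S'} {M} {n} {n'} {q} q< bound hS hM refl with bound
... | by-clique h = by-clique (linear (S + (M + (b + 3)) + (S' + f') + f)
    (M + S' + (b + 3) * (b + 3) + (b + 3) * n' + (f' + (b + 3))) 0
   (+-mono-≤ (+-mono-≤ (+-mono-≤ hS hM) h) (clique-step q<)) (eq b S S' M n' f f'))
   where
   f = q * (b + 4 ∸ q)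
   f' = suc q * (b + 4 ∸ suc q)
   eq : ∀ b S S' M n' f f' → S + f + (M + S' + (b + 3) * (b + 3) + (b + 3) * n' + (f' + (b + 3))) + 0
     ≡ (b + 3) * (b + 3 + n') + (S + (M + (b + 3)) + (S' + f') + f)
   eq = solve-∀
... | by-gap h = by-gap (linear (S + (M + (b + 3)) + (S' + f') + f)
    (M + S' + (b + 3) * (b + 3) + (b + 3) * n' + (f' + (b + 3))) 0
   (+-mono-≤ (+-mono-≤ (+-mono-≤ hS hM) h) (gap-step b q)) (eq b S S' M n' f f'))
   where
   f = gap b q
   f' = gap b (suc q)
   eq : ∀ b S S' M n' f f' → S + f + (M + S' + (b + 3) * (b + 3) + (b + 3) * n' + (f' + (b + 3))) + 0
     ≡ (b + 3) * (b + 3 + n') + (S + (M + (b + 3)) + (S' + f') + f)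
   eq = solve-∀

-- Here deleting `b + 3` vertices uses up the whole remainder, so the remainder becomes 0 and the
-- number of full blocks stays. The clique term for `q = b + 3` is just `b + 3`, and the deletion
-- alone supplies it.
bound-step-wrap : ∀ {b S S' M n n'} → Bound b S' n' 0 →
  S ≤ M + S' → M + (b + 3) ≤ (b + 3) * (b + 3) → n ≡ b + 3 + n' → Bound b S n (b + 3)
bound-step-wrap {b} {S} {S'} {M} {n} {n'} bound hS hM refl = by-clique
  (subst (λ z → S + (b + 3) * z ≤ (b + 3) * (b + 3 + n')) (sym z≡)
    (linear (S + (M + (b + 3)) + S') (M + S' + (b + 3) * (b + 3) + (b + 3) * n') 0
      (+-mono-≤ (+-mono-≤ hS hM) h) (eq b S S' M n')))
  where
  z≡ : b + 4 ∸ (b + 3) ≡ 1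
  z≡ = [m+n]∸[m+o]≡n∸o b 4 3
  h : S' ≤ (b + 3) * n'
  drop : Bound b S' n' 0 → S' ≤ (b + 3) * n'
  drop (by-clique k) = m+n≤o⇒m≤o S' k
  drop (by-gap k) = m+n≤o⇒m≤o S' k
  h = drop bound
  eq : ∀ b S S' M n' → S + (b + 3) * 1 + (M + S' + (b + 3) * (b + 3) + (b + 3) * n') + 0
     ≡ (b + 3) * (b + 3 + n') + (S + (M + (b + 3)) + S')
  eq = solve-∀

bound-same : ∀ {b S S' M n n' q} → Bound b S' n' q →
  S ≤ M + S' → M ≤ (b + 3) * (b + 4) → n ≡ b + 4 + n' → Bound b S n q
bound-same {b} {S} {S'} {M} {n} {n'} {q} bound hS hM refl with bound
... | by-clique h = by-clique (linear (S + M + (S' + f)) (M + S' + (b + 3) * (b + 4) + (b + 3) * n') 0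
   (+-mono-≤ (+-mono-≤ hS hM) h) (eq b S S' M n' f))
   where
   f = q * (b + 4 ∸ q)
   eq : ∀ b S S' M n' f → S + f + (M + S' + (b + 3) * (b + 4) + (b + 3) * n') + 0
     ≡ (b + 3) * (b + 4 + n') + (S + M + (S' + f))
   eq = solve-∀
... | by-gap h = by-gap (linear (S + M + (S' + f)) (M + S' + (b + 3) * (b + 4) + (b + 3) * n') 0
   (+-mono-≤ (+-mono-≤ hS hM) h) (eq b S S' M n' f))
   where
   f = gap b q
   eq : ∀ b S S' M n' f → S + f + (M + S' + (b + 3) * (b + 4) + (b + 3) * n') + 0
     ≡ (b + 3) * (b + 4 + n') + (S + M + (S' + f))
   eq = solve-∀

-- Inequalities for maximum degree b + 1

-- The 8 is the slack of the first count of `bound-far` at `k = 0`.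
k[s+2]≤8 : ∀ s k → s + k ≤ 3 → k * (s + 2) ≤ 8
k[s+2]≤8 s zero h = z≤n
k[s+2]≤8 s (suc zero) h = ≤-trans (*-monoʳ-≤ 1 (+-monoˡ-≤ 2 (m+n≤o⇒m≤o s h))) (m≤m+n 5 3)
k[s+2]≤8 s (suc (suc zero)) h = ≤-trans (*-monoʳ-≤ 2 (+-monoˡ-≤ 2 (+-cancelʳ-≤ 2 s 1 h))) (m≤m+n 6 2)
k[s+2]≤8 s (suc (suc (suc zero))) h = ≤-trans (*-monoʳ-≤ 3 (+-monoˡ-≤ 2 (+-cancelʳ-≤ 3 s 0 h))) (m≤m+n 6 2)
k[s+2]≤8 s (suc (suc (suc (suc k)))) h = contradiction (≤-trans (m≤n+m (4 + k) s) h) λ { (s≤s (s≤s (s≤s ()))) }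

-- Two closed neighbourhoods of size `b + 2` share `s` vertices, each has `3 + a` of its own, and
-- `k` vertices lie outside both. Against the clique term the first count has slack
-- `8 - k * (s + 2) + (1 + a) * k + k * k` and the second `2 * (1 + a) * (s + k - 4)`, so the first
-- settles `s + k ≤ 3` and the second the rest.
bound-far : ∀ {b S q} s a k → b ≡ s + 1 + a → q ≡ 1 + a + k → q ≤ b + 3 →
  S ≤ (s + 3) * s + (b + 1) * (2 * (3 + a) + k) →
  S + 8 + k ≤ (s + 3) * s + 2 * ((3 + a + 3) * (3 + a) + 2 * s) + k * k →
  Bound b S (b + 4 + q) q
bound-far {S = S} s a k refl refl q≤ hA hB with s + k ≤? 3
... | yes p = by-clique (linear (S + (1 + a + k) * (z + k) + k * (s + 2))
    ((s + 3) * s + (s + 1 + a + 1) * (2 * (3 + a) + k) + (1 + a + k) * (s + 4) + 8) ((1 + a) * k + k * k)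
    (+-mono-≤ (+-mono-≤ hA (≤-reflexive (cong ((1 + a + k) *_) z+k))) (k[s+2]≤8 s k p)) (eq s a k z S))
  where
  z = s + 1 + a + 4 ∸ (1 + a + k)
  z+k : z + k ≡ s + 4
  z+k = +-cancelˡ-≡ (1 + a) _ _ (trans (lem a z k) (trans (complement {s + 1 + a} q≤) (lem' s a)))
    where
    lem : ∀ a z k → 1 + a + (z + k) ≡ 1 + a + k + z
    lem = solve-∀
    lem' : ∀ s a → s + 1 + a + 4 ≡ 1 + a + (s + 4)
    lem' = solve-∀
  eq : ∀ s a k z S → S + (1 + a + k) * z + ((s + 3) * s + (s + 1 + a + 1) * (2 * (3 + a) + k) + (1 + a + k) *
      (s + 4) + 8) + ((1 + a) * k + k * k)
    ≡ (s + 1 + a + 3) * (s + 1 + a + 4 + (1 + a + k)) + (S + (1 + a + k) * (z + k) + k * (s + 2))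
  eq = solve-∀
... | no ¬p = by-clique (linear (S + 8 + k + (1 + a + k) * (z + k) + 2 * (1 + a) * 4)
    ((s + 3) * s + 2 * ((3 + a + 3) * (3 + a) + 2 * s) + k * k + (1 + a + k) * (s + 4) + 2 * (1 + a) * (s + k)) 0
    (+-mono-≤ (+-mono-≤ hB (≤-reflexive (cong ((1 + a + k) *_) z+k))) (*-monoʳ-≤ (2 * (1 + a)) (≰⇒> ¬p)))
        (eq s a k z S))
  where
  z = s + 1 + a + 4 ∸ (1 + a + k)
  z+k : z + k ≡ s + 4
  z+k = +-cancelˡ-≡ (1 + a) _ _ (trans (lem a z k) (trans (complement {s + 1 + a} q≤) (lem' s a)))
    where
    lem : ∀ a z k → 1 + a + (z + k) ≡ 1 + a + k + z
    lem = solve-∀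
    lem' : ∀ s a → s + 1 + a + 4 ≡ 1 + a + (s + 4)
    lem' = solve-∀
  eq : ∀ s a k z S → S + (1 + a + k) * z + ((s + 3) * s + 2 * ((3 + a + 3) * (3 + a) + 2 * s) + k * k +
      (1 + a + k) * (s + 4) + 2 * (1 + a) * (s + k)) + 0
    ≡ (s + 1 + a + 3) * (s + 1 + a + 4 + (1 + a + k)) + (S + 8 + k + (1 + a + k) * (z + k) + 2 * (1 + a) * 4)
  eq = solve-∀

bound-common-top : ∀ {b S} i {q} → i ≤ 4 → suc q ≡ b + i →
  2 * S + (q + 2) ≤ b * (b + 4 + q) + (b + 2) * (b + 2) + (q + 2) * (q + 2) →
  S + q * (b + 4 ∸ q) ≤ (b + 3) * (b + 4 + q)
bound-common-top {b} {S} zero {q} _ e h with trans (sym (+-identityʳ b)) (sym e)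
... | refl = subst (λ z → S + q * z ≤ (suc q + 3) * (suc q + 4 + q)) (sym z≡)
  (*-cancelˡ-≤ 2 (linear _ _ 24 h (eq S q)))
  where
  z≡ : suc q + 4 ∸ q ≡ 5
  z≡ = trans (cong (_∸ q) (sym (+-suc q 4))) (m+n∸m≡n q 5)
  eq : ∀ S q → 2 * (S + q * 5) + (suc q * (suc q + 4 + q) + (suc q + 2) * (suc q + 2) + (q + 2) * (q + 2)) + 24
    ≡ 2 * ((suc q + 3) * (suc q + 4 + q)) + (2 * S + (q + 2))
  eq = solve-∀
bound-common-top {b} {S} (suc i) {q} i≤ e h with suc-injective (trans e (+-suc b i))
... | refl = subst (λ z → S + (b + i) * z ≤ (b + 3) * (b + 4 + (b + i))) (sym ([m+n]∸[m+o]≡n∸o b 4 i))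
    (cases i (s≤s⁻¹ i≤) h)
  where
  cases : ∀ i → i ≤ 3 → 2 * S + (b + i + 2) ≤ b * (b + 4 + (b + i)) + (b + 2) * (b + 2) + (b + i + 2) * (b + i + 2) →
    S + (b + i) * (4 ∸ i) ≤ (b + 3) * (b + 4 + (b + i))
  cases 0 _ h = *-cancelˡ-≤ 2 (linear _ _ (b + 18) h (eq b S))
    where
    eq : ∀ b S → 2 * (S + (b + 0) * 4) + (b * (b + 4 + (b + 0)) + (b + 2) * (b + 2) + (b + 0 + 2) * (b + 0 + 2))
        + (b + 18)
      ≡ 2 * ((b + 3) * (b + 4 + (b + 0))) + (2 * S + (b + 0 + 2))
    eq = solve-∀
  cases 1 _ h = *-cancelˡ-≤ 2 (linear _ _ (2 * b + 14) h (eq b S))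
    where
    eq : ∀ b S → 2 * (S + (b + 1) * 3) + (b * (b + 4 + (b + 1)) + (b + 2) * (b + 2) + (b + 1 + 2) * (b + 1 + 2))
        + (2 * b + 14)
      ≡ 2 * ((b + 3) * (b + 4 + (b + 1))) + (2 * S + (b + 1 + 2))
    eq = solve-∀
  cases 2 _ h = *-cancelˡ-≤ 2 (linear _ _ (3 * b + 12) h (eq b S))
    where
    eq : ∀ b S → 2 * (S + (b + 2) * 2) + (b * (b + 4 + (b + 2)) + (b + 2) * (b + 2) + (b + 2 + 2) * (b + 2 + 2))
        + (3 * b + 12)
      ≡ 2 * ((b + 3) * (b + 4 + (b + 2))) + (2 * S + (b + 2 + 2))
    eq = solve-∀
  cases 3 _ h = *-cancelˡ-≤ 2 (linear _ _ (4 * b + 12) h (eq b S))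
    where
    eq : ∀ b S → 2 * (S + (b + 3) * 1) + (b * (b + 4 + (b + 3)) + (b + 2) * (b + 2) + (b + 3 + 2) * (b + 3 + 2))
        + (4 * b + 12)
      ≡ 2 * ((b + 3) * (b + 4 + (b + 3))) + (2 * S + (b + 3 + 2))
    eq = solve-∀
  cases (suc (suc (suc (suc i)))) (s≤s (s≤s (s≤s ()))) h

bound-common-low : ∀ {S} q t →
  let b = q + 4 + t in
  2 * S + (q + 2) ≤ b * (b + 4 + q) + (b + 2) * (b + 2) + (q + 2) * (q + 2) →
  S + (q + 2) ≤ (b + 2) * (b + 2) + (q + 2) * (q + 2) →
  Bound b S (b + 4 + q) q
bound-common-low {S} q t h₁ h₂ with 4 * q ≤? 3 * (q + 4 + t) + 6
... | no ¬p = by-gap (≤-trans (+-monoʳ-≤ S (gap-≤ b q))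
    (linear (S + (q + 2) + (6 + 0)) ((b + 2) * (b + 2) + (q + 2) * (q + 2) + (q + q * t)) 0
    (+-mono-≤ h₂ (+-mono-≤ q≥6 (z≤n {q * t}))) (eq S q t)))
  where
  b = q + 4 + t
  q≥6 : 6 ≤ q
  q≥6 = +-cancelʳ-≤ (3 * q) 6 q (linear (3 * (q + 4 + t) + 6) (4 * q) (12 + 3 * t) (<⇒≤ (≰⇒> ¬p)) (eq₀ q t))
    where
    eq₀ : ∀ q t → 6 + 3 * q + 4 * q + (12 + 3 * t) ≡ q + 3 * q + (3 * (q + 4 + t) + 6)
    eq₀ = solve-∀
  eq : ∀ S q t → S + 3 * (q + 4 + t + 4 + q) + ((q + 4 + t + 2) * (q + 4 + t + 2) + (q + 2) * (q + 2) +
      (q + q * t)) + 0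
    ≡ (q + 4 + t + 3) * (q + 4 + t + 4 + q) + (S + (q + 2) + (6 + 0))
  eq = solve-∀
... | yes p with ≤-total (q * (q + 4 + t + 4 ∸ q)) (3 * (q + 4 + t + 4 + q))
... | inj₁ f≤g = by-clique (*-cancelˡ-≤ 2 (linear (2 * S + (q + 2) + f + 4 * q) (R + 3 * (b + 4 + q) + (3 * b + 6)) 0
    (+-mono-≤ (+-mono-≤ h₁ f≤g) p) (trans (cong (λ z → 2 * (S + z) + (R + 3 * (b + 4 + q) + (3 * b + 6)) + 0) f≡)
      (trans (eq S q t) (cong (λ z → 2 * ((b + 3) * (b + 4 + q)) + (2 * S + (q + 2) + z + 4 * q)) (sym f≡))))))
  where
  b = q + 4 + t
  f = q * (b + 4 ∸ q)
  R = b * (b + 4 + q) + (b + 2) * (b + 2) + (q + 2) * (q + 2)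
  f≡ : f ≡ q * (t + 8)
  f≡ = cong (q *_) (trans (cong (_∸ q) (lem q t)) (m+n∸m≡n q (t + 8)))
    where
    lem : ∀ q t → q + 4 + t + 4 ≡ q + (t + 8)
    lem = solve-∀
  eq : ∀ S q t → 2 * (S + q * (t + 8)) + ((q + 4 + t) * (q + 4 + t + 4 + q) + (q + 4 + t + 2) * (q + 4 + t + 2)
      + (q + 2) * (q + 2) + 3 * (q + 4 + t + 4 + q) + (3 * (q + 4 + t) + 6)) + 0
    ≡ 2 * ((q + 4 + t + 3) * (q + 4 + t + 4 + q)) + (2 * S + (q + 2) + q * (t + 8) + 4 * q)
  eq = solve-∀
... | inj₂ g≤f = by-gap (≤-trans (+-monoʳ-≤ S (gap-≤ b q))
    (*-cancelˡ-≤ 2 (linear (2 * S + (q + 2) + 3 * (b + 4 + q) + 4 * q) (R + f + (3 * b + 6)) 0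
    (+-mono-≤ (+-mono-≤ h₁ g≤f) p) (trans (cong (λ z → 2 * (S + 3 * (b + 4 + q)) + (R + z + (3 * b + 6))
        + 0) f≡) (eq S q t)))))
  where
  b = q + 4 + t
  f = q * (b + 4 ∸ q)
  R = b * (b + 4 + q) + (b + 2) * (b + 2) + (q + 2) * (q + 2)
  f≡ : f ≡ q * (t + 8)
  f≡ = cong (q *_) (trans (cong (_∸ q) (lem q t)) (m+n∸m≡n q (t + 8)))
    where
    lem : ∀ q t → q + 4 + t + 4 ≡ q + (t + 8)
    lem = solve-∀
  eq : ∀ S q t → 2 * (S + 3 * (q + 4 + t + 4 + q)) + ((q + 4 + t) * (q + 4 + t + 4 + q) + (q + 4 + t + 2) *
      (q + 4 + t + 2) + (q + 2) * (q + 2) + q * (t + 8) + (3 * (q + 4 + t) + 6)) + 0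
    ≡ 2 * ((q + 4 + t + 3) * (q + 4 + t + 4 + q)) + (2 * S + (q + 2) + 3 * (q + 4 + t + 4 + q) + 4 * q)
  eq = solve-∀

data Position (b q : ℕ) : Set where
  at-top : ∀ i → i ≤ 4 → suc q ≡ b + i → Position b q
  at-b∸2 : q + 2 ≡ b → Position b q
  at-b∸3 : q + 3 ≡ b → Position b q
  at-low : ∀ t → b ≡ q + 4 + t → Position b q

position : ∀ b q → q ≤ b + 3 → Position b q
position b q q≤ with b ≤? suc q
... | yes p = at-top (suc q ∸ b) (m≤n+o⇒m∸n≤o (suc q) b (≤-trans (s≤s q≤) (≤-reflexive (sym (+-suc b 3)))))
    (sym (m+[n∸m]≡n p))
... | no ¬p with m≤n⇒∃[o]m+o≡n (≰⇒> ¬p)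
... | zero , e = at-b∸2 (trans (lem q) e)
  where
  lem : ∀ q → q + 2 ≡ suc (suc q) + 0
  lem = solve-∀
... | suc zero , e = at-b∸3 (trans (lem q) e)
  where
  lem : ∀ q → q + 3 ≡ suc (suc q) + 1
  lem = solve-∀
... | suc (suc t) , e = at-low t (sym (trans (lem q t) e))
  where
  lem : ∀ q t → q + 4 + t ≡ suc (suc q) + suc (suc t)
  lem = solve-∀

bound-common : ∀ {b S q} → q ≤ b + 3 →
  2 * S + (q + 2) ≤ b * (b + 4 + q) + (b + 2) * (b + 2) + (q + 2) * (q + 2) →
  S + (q + 2) ≤ (b + 2) * (b + 2) + (q + 2) * (q + 2) →
  Bound b S (b + 4 + q) q
bound-common {b} {S} {q} q≤ h₁ h₂ with position b q q≤
... | at-top i i≤ e = by-clique (bound-common-top i i≤ e h₁)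
... | at-low t refl = bound-common-low q t h₁ h₂
-- No slack is left here: the doubled count is the origin of the value `6 * b`.
... | at-b∸3 refl = by-gap (subst (λ z → S + z ≤ (q + 3 + 3) * (q + 3 + 4 + q)) (sym (gap-3 {q + 3} {q} refl))
    (*-cancelˡ-≤ 2 (linear _ _ 0 h₁ (eq S q))))
  where
  eq : ∀ S q → 2 * (S + 6 * (q + 3)) + ((q + 3) * (q + 3 + 4 + q) + (q + 3 + 2) * (q + 3 + 2) + (q + 2) * (q + 2)) + 0
    ≡ 2 * ((q + 3 + 3) * (q + 3 + 4 + q)) + (2 * S + (q + 2))
  eq = solve-∀
-- The doubled count gives twice the deficiency at least `11 * b + 8`; halving and rounding up
-- yields `6 * b + 4 ∸ b / 2`.
... | at-b∸2 refl = by-gap (subst (λ z → S + z ≤ Y) (sym (gap-2 {q + 2} {q} refl)) (begin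
    S + (c ∸ h) ≡⟨ +-∸-assoc S (≤-trans (m/n≤m (q + 2) 2)
        (≤-trans (m≤m+n (q + 2) (5 * (q + 2) + 4)) (≤-reflexive (eq₁ q)))) ⟨
    S + c ∸ h ≤⟨ ∸-monoˡ-≤ h (half-≤ (linear (2 * S + (q + 2) + (q + 2)) _ 0 (+-mono-≤ h₁ (≤-half+ (q + 2)))
        (eq S q h))) ⟩
    Y + h ∸ h ≡⟨ m+n∸n≡m Y h ⟩
    Y ∎))
  where
  open ≤-Reasoning
  h = (q + 2) / 2
  c = 6 * (q + 2) + 4
  Y = (q + 2 + 3) * (q + 2 + 4 + q)
  eq₁ : ∀ q → q + 2 + (5 * (q + 2) + 4) ≡ 6 * (q + 2) + 4
  eq₁ = solve-∀
  eq : ∀ S q h → 2 * (S + (6 * (q + 2) + 4)) + ((q + 2) * (q + 2 + 4 + q) + (q + 2 + 2) * (q + 2 + 2) +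
      (q + 2) * (q + 2) + (2 * h + 1)) + 0
    ≡ 2 * ((q + 2 + 3) * (q + 2 + 4 + q) + h) + 1 + (2 * S + (q + 2) + (q + 2))
  eq = solve-∀

-- Deficiency of a graph without S_{3,b}

module UpperBound {n : ℕ} (G : Graph n) (b : ℕ) (3<b : 3 < b) (free : (G -free) (doubleStar 3 b)) where
  open Neighbourhoods G

  degSum-trivial : ∀ A → degSum A + # A ≤ # A * # A
  degSum-trivial A = ≤-trans (≤-reflexive (trans (cong (degSum A +_)
      (trans (sym (+-identityʳ (# A))) (sym (sumOver-const A 1))))
      (sym (sumOver-+ A (deg A) (λ _ → 1)))))
    (sumOver-≤ {A = A} (# A) λ v p → ≤-trans (≤-reflexive (+-comm (deg A v) 1)) (deg<# {A} p))

  suc-b≤b+3 : suc b ≤ b + 3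
  suc-b≤b+3 = ≤-trans (m≤m+n (suc b) 2) (≤-reflexive (sym (+-suc b 2)))

  Bounded : VSet n → ℕ → Set
  Bounded W q = Bound b (degSum W) (# W) q

  Smaller : VSet n → Set
  Smaller W = ∀ W' → # W' < # W → ∀ p q → # W' ≡ p * (b + 4) + q → q ≤ b + 3 → Bounded W' q

  6≤b+2 : 6 ≤ b + 2
  6≤b+2 = +-monoˡ-≤ 2 3<b

  module _ (W : VSet n) where
    out : VSet n → Fin n → ℕ
    out M = deg (W ∖ M)

    out≤deg : ∀ M w → out M w ≤ deg W w
    out≤deg M w = deg-mono {W ∖ M} {W} λ v p → proj₁ (∖-elim {A = W} {M} p)

    out-mono : ∀ {M M'} w → M ⊆ M' → out M' w ≤ out M w
    out-mono {M} {M'} w h = deg-mono {W ∖ M'} {W ∖ M} λ v p →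
      ∖-intro {A = W} {M} (proj₁ (∖-elim {A = W} {M'} p)) λ q → proj₂ (∖-elim {A = W} {M'} p) (h v q)

    out-self : ∀ v → out (N[ v ] W) v ≡ 0
    out-self v = #-empty {A = (W ∖ N[ v ] W) ∩ adj G v} λ w p →
      proj₂ (∖-elim {A = W} {N[ v ] W} (proj₁ (∧-true p)))
        (N-adj {W} (proj₁ (∖-elim {A = W} {N[ v ] W} (proj₁ (∧-true p)))) (proj₂ (∧-true p)))

    near : ∀ {Δ v w} → W ∋ v → deg W v ≡ Δ → b < Δ → Δ ≤ b + 3 → N[ v ] W ∋ w →
      deg W w ≤ 3 ⊎ Δ + out (N[ v ] W) w ≤ b + 3
    near {Δ} {v} {w} v∈W dv b<Δ Δ≤ w∈N with N-elim {W} w∈N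
    ... | _ , inj₂ refl = inj₂ (subst (λ z → Δ + z ≤ b + 3) (sym (out-self w))
        (≤-trans (≤-reflexive (+-identityʳ Δ)) Δ≤))
    ... | _ , inj₁ a with 4 ≤? deg W w
    ... | no ¬p = inj₁ (s≤s⁻¹ (≰⇒> ¬p))
    ... | yes p = inj₂ (subst (λ z → z + out (N[ v ] W) w ≤ b + 3) dv
          (free⇒small-union b free W (adj-sym a) v∈W p (subst (suc b ≤_) (sym dv) b<Δ)))

    -- The weight is at most 6, so thanks to `3 < b` a vertex of degree at most 3 is cheap enough
    -- even for a block of `b + 3` vertices.
    low-weight : ∀ {M w} → deg W w ≤ 3 → deg W w + out M w ≤ b + 2
    low-weight {M} {w} h = ≤-trans (+-mono-≤ h (≤-trans (out≤deg M w) h)) 6≤b+2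

    -- Enlarging `M` beyond `N[ v ] W` can only lower `out`, so the bound for one closed
    -- neighbourhood carries over to a union of two.
    near-weight : ∀ {Δ v w M} → W ∋ v → deg W v ≡ Δ → b < Δ → Δ ≤ b + 3 → N[ v ] W ∋ w →
      deg W w ≤ Δ → N[ v ] W ⊆ M → deg W w + out M w ≤ b + 3
    near-weight {Δ} {v} {w} {M} v∈W dv b<Δ Δ≤ w∈N dw N⊆M with near v∈W dv b<Δ Δ≤ w∈N
    ... | inj₁ h = ≤-trans (low-weight h) (+-monoʳ-≤ b (n≤1+n 2))
    ... | inj₂ h = ≤-trans (+-mono-≤ dw (out-mono w N⊆M)) h

    #-peel : ∀ {M} → M ⊆ W → # W ≡ # M + # (W ∖ M)
    #-peel {M} h = #-part {A = W} {M} h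

    module _ (ih : Smaller W) (p q : ℕ) (#W : # W ≡ suc p * (b + 4) + q) (q≤ : q ≤ b + 3) where
      peel-block : ∀ {M} → M ⊆ W → # M ≡ b + 4 →
        (∀ v → M ∋ v → deg W v + out M v ≤ b + 3) → Bounded W q
      peel-block {M} M⊆W #M weight = bound-same
        (ih (W ∖ M) smaller p q #rest q≤)
        (≤-reflexive (degSum-peel {W} {M} M⊆W))
        (≤-trans (sumOver-≤ {A = M} (b + 3) weight) (≤-reflexive (cong ((b + 3) *_) #M)))
        #W'
        where
        #W' : # W ≡ b + 4 + # (W ∖ M)
        #W' = trans (#-peel M⊆W) (cong (_+ # (W ∖ M)) #M)
        #rest : # (W ∖ M) ≡ p * (b + 4) + q
        #rest = +-cancelˡ-≡ (b + 4) _ _ (trans (sym #W') (trans #W (+-assoc (b + 4) (p * (b + 4)) q)))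
        smaller : # (W ∖ M) < # W
        smaller = ≤-trans (+-monoˡ-≤ (# (W ∖ M)) (≤-trans (s≤s z≤n) (≤-reflexive (+-comm 4 b))))
            (≤-reflexive (sym #W'))

      peel-short-block : ∀ {M} → M ⊆ W → # M ≡ b + 3 →
        (∀ v → M ∋ v → deg W v + out M v < b + 3) → Bounded W q
      peel-short-block {M} M⊆W #M weight = cases (q ℕ.≟ b + 3)
        where
        #W' : # W ≡ b + 3 + # (W ∖ M)
        #W' = trans (#-peel M⊆W) (cong (_+ # (W ∖ M)) #M)
        smaller : # (W ∖ M) < # W
        smaller = ≤-trans (+-monoˡ-≤ (# (W ∖ M)) (≤-trans (s≤s z≤n) (≤-reflexive (+-comm 3 b))))
            (≤-reflexive (sym #W'))
        total : sumOver M (λ v → deg W v + out M v) + (b + 3) ≤ (b + 3) * (b + 3)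
        total = ≤-trans
          (+-monoˡ-≤ (b + 3) (≤-trans
            (sumOver-≤ {A = M} (b + 2) λ v p → s≤s⁻¹ (≤-trans (weight v p) (≤-reflexive (+-suc b 2))))
            (≤-reflexive (cong ((b + 2) *_) #M))))
          (≤-reflexive (eq b))
          where
          eq : ∀ b → (b + 2) * (b + 3) + (b + 3) ≡ (b + 3) * (b + 3)
          eq = solve-∀
        cases : Dec (q ≡ b + 3) → Bounded W q
        cases (yes q≡) = subst (Bounded W) (sym q≡)
          (bound-step-wrap (ih (W ∖ M) smaller (suc p) 0 #rest z≤n) (≤-reflexive (degSum-peel {W} {M} M⊆W)) total #W')
          where
          #rest : # (W ∖ M) ≡ suc p * (b + 4) + 0
          #rest = +-cancelˡ-≡ (b + 3) _ _ (trans (sym #W') (trans #W (trans (cong (suc p * (b + 4) +_) q≡) (eq b p))))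
            where
            eq : ∀ b p → suc p * (b + 4) + (b + 3) ≡ b + 3 + (suc p * (b + 4) + 0)
            eq = solve-∀
        cases (no q≢) = bound-step (≤∧≢⇒< q≤ q≢) (ih (W ∖ M) smaller p (suc q) #rest (≤∧≢⇒< q≤ q≢))
          (≤-reflexive (degSum-peel {W} {M} M⊆W)) total #W'
          where
          #rest : # (W ∖ M) ≡ p * (b + 4) + suc q
          #rest = +-cancelˡ-≡ (b + 3) _ _ (trans (sym #W') (trans #W (eq b p q)))
            where
            eq : ∀ b p q → suc p * (b + 4) + q ≡ b + 3 + (p * (b + 4) + suc q)
            eq = solve-∀

      #N∖N : ∀ {u v} → W ∋ u → N[ v ] W ∋ u → # (N[ u ] W ∖ N[ v ] W) ≡ out (N[ v ] W) u
      #N∖N {u} {v} u∈W u∈N = ≤-antisym (#-mono {A = N[ u ] W ∖ N[ v ] W} {(W ∖ N[ v ] W) ∩ adj G u} to)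
                                (#-mono {A = (W ∖ N[ v ] W) ∩ adj G u} {N[ u ] W ∖ N[ v ] W} from)
        where
        to : (N[ u ] W ∖ N[ v ] W) ⊆ ((W ∖ N[ v ] W) ∩ adj G u)
        to w p with ∖-elim {A = N[ u ] W} {N[ v ] W} p
        ... | q , r with N-elim {W} q
        ... | w∈W , inj₁ a = ∧-intro (∖-intro {A = W} {N[ v ] W} w∈W r) a
        ... | w∈W , inj₂ refl = contradiction u∈N r
        from : ((W ∖ N[ v ] W) ∩ adj G u) ⊆ (N[ u ] W ∖ N[ v ] W)
        from w p with ∖-elim {A = W} {N[ v ] W} (proj₁ (∧-true p))
        ... | w∈W , r = ∖-intro {A = N[ u ] W} {N[ v ] W} (N-adj {W} w∈W (proj₂ (∧-true p))) r

      ∪N⊆ : ∀ {u v} → (N[ u ] W ∪ N[ v ] W) ⊆ W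
      ∪N⊆ {u} {v} w p with ∨-true p
      ... | inj₁ q = N⊆ {W} {u} w q
      ... | inj₂ q = N⊆ {W} {v} w q

      peel-pair : ∀ {Δ u v } → b < Δ → Δ ≤ b + 3 → (∀ w → W ∋ w → deg W w ≤ Δ) →
        W ∋ u → W ∋ v → deg W u ≡ Δ → deg W v ≡ Δ → # (N[ u ] W ∪ N[ v ] W) ≡ b + 4 → Bounded W q
      peel-pair {Δ} {u} {v} b<Δ Δ≤ max u∈W v∈W du dv #M =
        peel-block {M} (∪N⊆ {u} {v}) #M weight
        where
        M = N[ u ] W ∪ N[ v ] W
        weight : ∀ w → M ∋ w → deg W w + out M w ≤ b + 3
        weight w p with ∨-true p
        ... | inj₁ q = near-weight u∈W du b<Δ Δ≤ q (max w (N⊆ {W} {u} w q)) (λ _ → ∨-introˡ)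
        ... | inj₂ q = near-weight v∈W dv b<Δ Δ≤ q (max w (N⊆ {W} {v} w q)) (λ x → ∨-introʳ {N[ u ] W x})

      hub : ∀ {v} → W ∋ v → b + 4 ≤ deg W v → Bounded W q
      hub {v} v∈W dv with subsetOfSize (W ∩ adj G v) (b + 4) dv
      ... | M , M⊆ , #M = peel-block {M} (λ w p → proj₁ (∧-true (M⊆ w p))) #M weight
        where
        low : ∀ w → M ∋ w → deg W w ≤ 3
        low w p with 4 ≤? deg W w
        ... | no ¬q = s≤s⁻¹ (≰⇒> ¬q)
        ... | yes q = contradiction
          (≤-trans (m≤m+n (deg W v) _) (free⇒small-union b free W (adj-sym (proj₂ (∧-true {W w} (M⊆ w p)))) v∈W q
            (≤-trans (≤-trans (m≤n+m (suc b) 3) (≤-reflexive (+-comm 4 b))) dv)))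
          (<⇒≱ (≤-trans (≤-reflexive (sym (+-suc b 3))) dv))
        weight : ∀ w → M ∋ w → deg W w + out M w ≤ b + 3
        weight w p = ≤-trans (low-weight (low w p)) (+-monoʳ-≤ b (n≤1+n 2))

      max-b+3 : ∀ {v} → (∀ w → W ∋ w → deg W w ≤ b + 3) → W ∋ v → deg W v ≡ b + 3 → Bounded W q
      max-b+3 {v} max v∈W dv = peel-block {N[ v ] W} (N⊆ {W} {v})
        (trans (#N v∈W) (trans (cong suc dv) (sym (+-suc b 3))))
        (λ w p → near-weight v∈W dv (≤-trans (m≤m+n (suc b) 2) (≤-reflexive (sym (+-suc b 2)))) ≤-refl p
            (max w (N⊆ {W} {v} w p)) (λ _ q → q))

      -- `N[ v ] W` has `b + 3` vertices, one too few for a full block. It fails as a short block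
      -- only through some `u` of weight at least `b + 3`; as `out` is at most 1, such a `u` has
      -- degree `b + 2` and exactly one neighbour outside, so its closed neighbourhood supplies the
      -- missing vertex.
      max-b+2 : ∀ {v} → (∀ w → W ∋ w → deg W w ≤ b + 2) → W ∋ v → deg W v ≡ b + 2 → Bounded W q
      max-b+2 {v} max v∈W dv with exceeds? (N[ v ] W) (λ w → deg W w + out (N[ v ] W) w) (b + 3)
      ... | inj₂ small = peel-short-block {N[ v ] W} (N⊆ {W} {v}) #Nv small
        where
        #Nv = trans (#N v∈W) (trans (cong suc dv) (sym (+-suc b 2)))
      ... | inj₁ (u , u∈N , large) with near v∈W dv (≤-trans (m≤m+n (suc b) 1) (≤-reflexive (sym (+-suc b 1))))
          (+-monoʳ-≤ b (n≤1+n 2)) u∈N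
      ... | inj₁ low = contradiction (≤-trans large (low-weight low)) (<⇒≱ (≤-reflexive (sym (+-suc b 2))))
      ... | inj₂ h = peel-pair {b + 2} {u} {v} (≤-trans (m≤m+n (suc b) 1) (≤-reflexive (sym (+-suc b 1))))
          (+-monoʳ-≤ b (n≤1+n 2))
          max u∈W v∈W du dv
          (trans (∪-size (N[ u ] W) (N[ v ] W)) (trans
              (cong₂ _+_ (trans (#N v∈W) (cong suc dv)) (trans (#N∖N u∈W u∈N) out≡1)) (eq b)))
       
        where
        u∈W = N⊆ {W} {v} u u∈N
        out≤1 : out (N[ v ] W) u ≤ 1
        out≤1 = +-cancelˡ-≤ (b + 2) _ 1 (≤-trans h (≤-reflexive (sym (+-assoc b 2 1))))
        out≡1 : out (N[ v ] W) u ≡ 1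
        out≡1 = ≤-antisym out≤1 (+-cancelˡ-≤ (b + 2) 1 _
            (≤-trans (≤-reflexive (+-assoc b 2 1)) (≤-trans large (+-monoˡ-≤ _ (max u u∈W)))))
        du : deg W u ≡ b + 2
        du = ≤-antisym (max u u∈W) (+-cancelʳ-≤ 1 (b + 2) _
            (≤-trans (≤-reflexive (+-assoc b 2 1)) (≤-trans large (+-monoʳ-≤ (deg W u) out≤1))))
        eq : ∀ b → suc (b + 2) + 1 ≡ b + 4
        eq = solve-∀

      module _ (max : ∀ w → W ∋ w → deg W w ≤ suc b) where
        out≤2 : ∀ {v w} → W ∋ v → deg W v ≡ suc b → N[ v ] W ∋ w → out (N[ v ] W) w ≤ 2
        out≤2 {v} {w} v∈W dv w∈N with near v∈W dv ≤-refl
            (≤-trans (m≤m+n (suc b) 2) (≤-reflexive (sym (+-suc b 2)))) w∈N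
        ... | inj₂ h = +-cancelˡ-≤ (suc b) _ 2 (≤-trans h (≤-reflexive (+-suc b 2)))
        ... | inj₁ low with N-elim {W} w∈N
        ... | _ , inj₂ refl = ≤-trans (≤-reflexive (out-self w)) z≤n
        -- A vertex of degree at most 3 spends one of its neighbours on `v`, which lies inside.
        ... | _ , inj₁ a = s≤s⁻¹ (≤-trans (≤-trans (≤-reflexive (cong (_+ out (N[ v ] W) w) (sym (#-singleton v))))
            (#-pack {A = ⁅ v ⁆} {(W ∖ N[ v ] W) ∩ adj G w} {W ∩ adj G w}
              (λ x p → subst ((W ∩ adj G w) ∋_) (sym (⁅⁆-elim p)) (∧-intro v∈W (adj-sym a)))
              (λ x p → ∧-intro (proj₁ (∖-elim {A = W} {N[ v ] W} (proj₁ (∧-true p)))) (proj₂ (∧-true p)))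
              λ x p q → proj₂ (∖-elim {A = W} {N[ v ] W} (proj₁ (∧-true q)))
                  (subst (N[ v ] W ∋_) (sym (⁅⁆-elim p)) (N-self {W} v∈W)))) low)

        peel-two : ∀ {u v} → W ∋ u → W ∋ v → deg W u ≡ suc b → deg W v ≡ suc b →
          # (N[ u ] W ∖ N[ v ] W) ≡ 2 → Bounded W q
        peel-two {u} {v} u∈W v∈W du dv r≡2 = peel-pair ≤-refl suc-b≤b+3 max u∈W v∈W du dv
          (trans (∪-size (N[ u ] W) (N[ v ] W)) (trans (cong₂ _+_ (trans (#N v∈W) (cong suc dv)) r≡2) (eq b)))
          where
          eq : ∀ b → suc (suc b) + 2 ≡ b + 4
          eq = solve-∀

        -- The union has `b + 3` vertices. If some `w` in it is too heavy for a short block, then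
        -- `w` has degree `b + 1` and exactly two neighbours outside the closed neighbourhood
        -- containing it; together with the centre of that neighbourhood it satisfies `peel-two`.
        peel-one : ∀ {u v} → W ∋ u → W ∋ v → deg W u ≡ suc b → deg W v ≡ suc b →
          # (N[ u ] W ∖ N[ v ] W) ≡ 1 → Bounded W q
        peel-one {u} {v} u∈W v∈W du dv r≡1 with exceeds? M (λ w → deg W w + out M w) (b + 3)
          where M = N[ u ] W ∪ N[ v ] W
        ... | inj₂ small = peel-short-block {N[ u ] W ∪ N[ v ] W} (∪N⊆ {u} {v})
            (trans (∪-size (N[ u ] W) (N[ v ] W)) (trans (cong₂ _+_ (trans (#N v∈W) (cong suc dv)) r≡1) (eq b))) small
          where
          eq : ∀ b → suc (suc b) + 1 ≡ b + 3
          eq = solve-∀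
        ... | inj₁ (w , w∈M , large) with ∨-true w∈M
        ... | inj₁ w∈N = peel-two (N⊆ {W} {u} w w∈N) u∈W dw du (trans (#N∖N (N⊆ {W} {u} w w∈N) w∈N) out≡2)
          where
          M = N[ u ] W ∪ N[ v ] W
          dw≤ = max w (N⊆ {W} {u} w w∈N)
          out≤ : out M w ≤ out (N[ u ] W) w
          out≤ = out-mono {N[ u ] W} {M} w (λ _ → ∨-introˡ)
          out≡2 : out (N[ u ] W) w ≡ 2
          out≡2 = ≤-antisym (out≤2 u∈W du w∈N) (+-cancelˡ-≤ (suc b) 2 _
              (≤-trans (≤-reflexive (sym (+-suc b 2))) (≤-trans large (+-mono-≤ dw≤ out≤))))
          dw : deg W w ≡ suc b
          dw = ≤-antisym dw≤ (+-cancelʳ-≤ 2 (suc b) _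
              (≤-trans (≤-reflexive (sym (+-suc b 2)))
                (≤-trans large (+-monoʳ-≤ (deg W w) (≤-trans out≤ (out≤2 u∈W du w∈N))))))
        ... | inj₂ w∈N = peel-two (N⊆ {W} {v} w w∈N) v∈W dw dv (trans (#N∖N (N⊆ {W} {v} w w∈N) w∈N) out≡2)
          where
          M = N[ u ] W ∪ N[ v ] W
          dw≤ = max w (N⊆ {W} {v} w w∈N)
          out≤ : out M w ≤ out (N[ v ] W) w
          out≤ = out-mono {N[ v ] W} {M} w (λ x → ∨-introʳ {N[ u ] W x})
          out≡2 : out (N[ v ] W) w ≡ 2
          out≡2 = ≤-antisym (out≤2 v∈W dv w∈N) (+-cancelˡ-≤ (suc b) 2 _
              (≤-trans (≤-reflexive (sym (+-suc b 2))) (≤-trans large (+-mono-≤ dw≤ out≤))))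
          dw : deg W w ≡ suc b
          dw = ≤-antisym dw≤ (+-cancelʳ-≤ 2 (suc b) _
              (≤-trans (≤-reflexive (sym (+-suc b 2)))
                (≤-trans large (+-monoʳ-≤ (deg W w) (≤-trans out≤ (out≤2 v∈W dv w∈N))))))

        -- The 4 on the left is gained at v, which has no neighbour outside N[ v ] W.
        side : ∀ {u v} (C O : VSet n) → W ∋ v → deg W v ≡ suc b → ¬ (N[ u ] W ∋ v) →
          (∀ w → C ∋ w → deg (N[ v ] W ∖ N[ u ] W) w ≤ 2) →
          (∀ w → W ∋ w → N[ v ] W ∋ w → C ∋ w ⊎ (N[ v ] W ∖ N[ u ] W) ∋ w) →
          (∀ w → O ∋ w → W ∋ w × ¬ (N[ v ] W ∋ w)) →
          sumOver (N[ v ] W ∖ N[ u ] W) (λ w → deg W w + deg O w) + 4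
            ≤ (# (N[ v ] W ∖ N[ u ] W) + 3) * # (N[ v ] W ∖ N[ u ] W) + 2 * # C
        side {u} {v} C O v∈W dv v∉ C-deg A-cover O-out = begin
          sumOver X f + 4
            ≤⟨ +-monoʳ-≤ (sumOver X f) (≤-trans (≤-reflexive (cong (λ z → 4 * ι z) (sym (⁅⁆-intro v))))
                (sumOver-point {A = X} (λ w → 4 * ι (⁅ v ⁆ w)) v∈X)) ⟩
          sumOver X f + sumOver X (λ w → 4 * ι (⁅ v ⁆ w))
            ≡⟨ sumOver-+ X f (λ w → 4 * ι (⁅ v ⁆ w)) ⟨
          sumOver X (λ w → f w + 4 * ι (⁅ v ⁆ w))
            ≤⟨ sumOver-mono {A = X} pointwise ⟩
          sumOver X (λ w → (# X + 3) + deg C w)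
            ≡⟨ sumOver-+ X (λ _ → # X + 3) (deg C) ⟩
          sumOver X (λ _ → # X + 3) + sumOver X (deg C)
            -- The edges between `X` and `C` are recounted from `C`, where each vertex sends at most
            -- two.
            ≡⟨ cong₂ _+_ (sumOver-const X (# X + 3)) (sumOver-deg-swap X C) ⟩
          (# X + 3) * # X + sumOver C (deg X)
            ≤⟨ +-monoʳ-≤ ((# X + 3) * # X) (sumOver-≤ {A = C} 2 C-deg) ⟩
          (# X + 3) * # X + 2 * # C ∎
          where
          open ≤-Reasoning
          A = N[ v ] W
          X = A ∖ N[ u ] W
          f : Fin n → ℕ
          f w = deg W w + deg O w
          v∈X : X ∋ v
          v∈X = ∖-intro {A = A} {N[ u ] W} (N-self {W} v∈W) v∉
          degW : ∀ w → deg W w ≤ deg C w + deg X w + out A w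
          degW w = ≤-trans (≤-reflexive (deg-part {W} {A} {w} (N⊆ {W} {v})))
            (+-monoˡ-≤ (out A w) (deg-cover {A} {C} {X} {w} λ x p → A-cover x (N⊆ {W} {v} x p) p))
          degO : ∀ w → deg O w ≤ out A w
          degO w = deg-mono {O} {W ∖ A} λ x p → ∖-intro {A = W} {A} (proj₁ (O-out x p)) (proj₂ (O-out x p))
          f≤ : ∀ w → f w ≤ deg C w + deg X w + (out A w + out A w)
          f≤ w = ≤-trans (+-mono-≤ (degW w) (degO w)) (≤-reflexive (+-assoc (deg C w + deg X w) (out A w) (out A w)))
          outs : ∀ w → X ∋ w → out A w + out A w + 4 * ι (⁅ v ⁆ w) ≤ 4
          outs w p = cases (⁅ v ⁆ w) refl
            where
            o≤ = out≤2 v∈W dv (proj₁ (∖-elim {A = A} {N[ u ] W} p))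
            cases : ∀ x → ⁅ v ⁆ w ≡ x → out A w + out A w + 4 * ι x ≤ 4
            cases true  e = ≤-reflexive (cong (λ z → z + z + 4) (trans (cong (out A) (⁅⁆-elim e)) (out-self v)))
            cases false _ = ≤-trans (≤-reflexive (+-identityʳ _)) (+-mono-≤ o≤ o≤)
          pointwise : ∀ w → X ∋ w → f w + 4 * ι (⁅ v ⁆ w) ≤ # X + 3 + deg C w
          pointwise w p = linear
            (f w + (out A w + out A w + 4 * ι (⁅ v ⁆ w)) + suc (deg X w))
            (deg C w + deg X w + (out A w + out A w) + 4 + # X) 0
            (+-mono-≤ (+-mono-≤ (f≤ w) (outs w p)) (deg<# p))
            (eq (f w) (4 * ι (⁅ v ⁆ w)) (deg C w) (deg X w) (out A w) (# X))
            where
            eq : ∀ f i c x o r → f + i + (c + x + (o + o) + 4 + r) + 0 ≡ r + 3 + c + (f + (o + o + i) + suc x)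
            eq = solve-∀

        -- By `out≤2`, centres this far apart are not adjacent. So each lies in its own difference
        -- set, which `side` requires, while a common vertex has at most two neighbours outside
        -- either neighbourhood.
        far : p ≡ 0 → ∀ {u v} → W ∋ u → W ∋ v → deg W u ≡ suc b → deg W v ≡ suc b →
          3 ≤ # (N[ u ] W ∖ N[ v ] W) → Bounded W q
        far p≡0 {u} {v} u∈W v∈W du dv 3≤r with m≤n⇒∃[o]m+o≡n 3≤r
        ... | a , #Y = subst (λ z → Bound b (degSum W) z q) (sym #W₁)
            (bound-far {b} {degSum W} {q} s a k b≡ q≡ q≤ hA hB)
          where
          A = N[ v ] W
          B = N[ u ] W
          X = A ∖ B
          Y = B ∖ A
          C = A ∩ B
          M = B ∪ A
          O = W ∖ M
          s = # C
          k = # O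
          f : Fin n → ℕ
          f w = deg W w + out M w
          #W₁ : # W ≡ b + 4 + q
          #W₁ = trans #W (trans (cong (λ z → suc z * (b + 4) + q) p≡0) (cong (_+ q) (+-identityʳ (b + 4))))
          #A : # A ≡ suc (suc b)
          #A = trans (#N v∈W) (cong suc dv)
          #B : # B ≡ suc (suc b)
          #B = trans (#N u∈W) (cong suc du)
          A-split : # A ≡ s + # X
          A-split = ∩∖-size A B
          B-split : # B ≡ s + # Y
          B-split = trans (∩∖-size B A) (cong (_+ # Y) (sum-cong-≗ λ w → cong ι (∧-comm (B w) (A w))))
          #X : 3 + a ≡ # X
          #X = trans #Y (+-cancelˡ-≡ s _ _ (trans (sym B-split) (trans #B (trans (sym #A) A-split))))
          b≡ : b ≡ s + 1 + a
          b≡ = suc-injective (suc-injective (trans (sym #A) (trans A-split (trans (cong (s +_) (sym #X)) (eq s a)))))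
            where
            eq : ∀ s a → s + (3 + a) ≡ suc (suc (s + 1 + a))
            eq = solve-∀
          M⊆W : M ⊆ W
          M⊆W = ∪N⊆ {u} {v}
          #M : # M ≡ suc (suc b) + (3 + a)
          #M = trans (∪-size B A) (cong₂ _+_ #A (sym #Y))
          W-split : # W ≡ suc (suc b) + (3 + a) + k
          W-split = trans (#-peel M⊆W) (cong (_+ k) #M)
          q≡ : q ≡ 1 + a + k
          q≡ = +-cancelˡ-≡ (b + 4) _ _ (trans (sym #W₁) (trans W-split (eq b a k)))
            where
            eq : ∀ b a k → suc (suc b) + (3 + a) + k ≡ b + 4 + (1 + a + k)
            eq = solve-∀
          v∉B : ¬ (B ∋ v)
          v∉B h with N-elim {W} h
          ... | _ , inj₂ refl = contradiction (≤-trans 3≤r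
              (≤-reflexive (#-empty {A = Y} λ w p → proj₂ (∖-elim {A = B} {A} p)
                (proj₁ (∖-elim {A = B} {A} p))))) λ ()
          ... | _ , inj₁ a = contradiction (≤-trans 3≤r
              (≤-trans (≤-reflexive (#N∖N u∈W u∈A)) (out≤2 v∈W dv u∈A))) λ { (s≤s (s≤s ())) }
            where u∈A = N-adj {W} u∈W (adj-sym a)
          u∉A : ¬ (A ∋ u)
          u∉A u∈A = contradiction (≤-trans 3≤r (≤-trans (≤-reflexive (#N∖N u∈W u∈A)) (out≤2 v∈W dv u∈A))) λ {
              (s≤s (s≤s ())) }
          O-elim : ∀ w → O ∋ w → W ∋ w × ¬ (A ∋ w) × ¬ (B ∋ w)
          O-elim w p with ∖-elim {A = W} {M} p
          ... | w∈W , w∉M = w∈W , (λ h → w∉M (∨-introʳ {B w} h)) , λ h → w∉M (∨-introˡ h)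
          A-cover : ∀ w → A ∋ w → C ∋ w ⊎ X ∋ w
          A-cover w p with true? (B w)
          ... | inj₁ h = inj₁ (∧-intro p h)
          ... | inj₂ h = inj₂ (∖-intro {A = A} {B} p h)
          B-cover : ∀ w → B ∋ w → C ∋ w ⊎ Y ∋ w
          B-cover w p with true? (A w)
          ... | inj₁ h = inj₁ (∧-intro h p)
          ... | inj₂ h = inj₂ (∖-intro {A = B} {A} p h)
          M-cover : ∀ x → M ∋ x → A ∋ x ⊎ Y ∋ x
          M-cover x h with true? (A x)
          ... | inj₁ i = inj₁ i
          ... | inj₂ i with ∨-true h
          ... | inj₁ j = inj₂ (∖-intro {A = B} {A} j i)
          ... | inj₂ j = inj₁ j
          C-elim : ∀ {w} → C ∋ w → A ∋ w × B ∋ w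
          C-elim p = ∧-true p
          Y+O≤2 : ∀ {w} → A ∋ w → deg Y w + deg O w ≤ 2
          Y+O≤2 {w} w∈A = ≤-trans (deg-pack {Y} {O} {W ∖ A} {w}
            (λ x p → ∖-intro {A = W} {A} (N⊆ {W} {u} x (proj₁ (∖-elim {A = B} {A} p))) (proj₂ (∖-elim {A = B} {A} p)))
            (λ x p → ∖-intro {A = W} {A} (proj₁ (O-elim x p)) (proj₁ (proj₂ (O-elim x p))))
            λ x p r → proj₂ (proj₂ (O-elim x r)) (proj₁ (∖-elim {A = B} {A} p))) (out≤2 v∈W dv w∈A)
          X+O≤2 : ∀ {w} → B ∋ w → deg X w + deg O w ≤ 2
          X+O≤2 {w} w∈B = ≤-trans (deg-pack {X} {O} {W ∖ B} {w}
            (λ x p → ∖-intro {A = W} {B} (N⊆ {W} {v} x (proj₁ (∖-elim {A = A} {B} p))) (proj₂ (∖-elim {A = A} {B} p)))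
            (λ x p → ∖-intro {A = W} {B} (proj₁ (O-elim x p)) (proj₂ (proj₂ (O-elim x p))))
            λ x p r → proj₁ (proj₂ (O-elim x r)) (proj₁ (∖-elim {A = A} {B} p))) (out≤2 u∈W du w∈B)
          -- `O` counts twice in the weight: once it is paired with `X` and once with `Y`, at most 2
          -- each time. The remaining neighbours of `w` lie in `C`, and there are at most `s - 1`.
          C-weight : ∀ w → C ∋ w → f w ≤ s + 3
          C-weight w p = linear
            (deg W w + deg M w + deg A w + (deg Y w + deg O w) + (deg X w + deg O w) + suc (deg C w))
            (deg M w + deg O w + (deg A w + deg Y w) + (deg C w + deg X w) + 2 + 2 + s) 0
            (+-mono-≤ (+-mono-≤ (+-mono-≤ (+-mono-≤ (+-mono-≤ (≤-reflexive (deg-part {W} {M} {w} M⊆W))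
              (deg-cover {M} {A} {Y} {w} M-cover)) (deg-cover {A} {C} {X} {w} A-cover))
              (Y+O≤2 (proj₁ (C-elim p)))) (X+O≤2 (proj₂ (C-elim p)))) (deg<# {C} {w} p))
            (eq (deg W w) (deg M w) (deg A w) (deg X w) (deg Y w) (deg C w) (deg O w) s)
            where
            eq : ∀ W M A X Y C O s → W + O + (M + O + (A + Y) + (C + X) + 2 + 2 + s) + 0
              ≡ s + 3 + (W + M + A + (Y + O) + (X + O) + suc C)
            eq = solve-∀
          hA : degSum W ≤ (s + 3) * s + (b + 1) * (2 * (3 + a) + k)
          hA = begin
            degSum W ≡⟨ sumOver-part {A = W} {C} (deg W) C⊆W ⟩
            sumOver C (deg W) + sumOver (W ∖ C) (deg W)
              ≤⟨ +-mono-≤ (sumOver-≤ {A = C} (s + 3) λ w p → ≤-trans (m≤m+n (deg W w) (out M w)) (C-weight w p))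
                   (sumOver-≤ {A = W ∖ C} (b + 1) λ w p → ≤-trans (max w (proj₁ (∖-elim {A = W} {C} p)))
                       (≤-reflexive (+-comm 1 b))) ⟩
            (s + 3) * s + (b + 1) * # (W ∖ C) ≡⟨ cong (λ z → (s + 3) * s + (b + 1) * z) rest ⟩
            (s + 3) * s + (b + 1) * (2 * (3 + a) + k) ∎
            where
            open ≤-Reasoning
            C⊆W : C ⊆ W
            C⊆W w p = N⊆ {W} {v} w (proj₁ (C-elim p))
            rest : # (W ∖ C) ≡ 2 * (3 + a) + k
            rest = +-cancelˡ-≡ s _ _ (trans (sym (#-part {A = W} {C} C⊆W))
                (trans W-split (trans (cong (λ z → suc (suc z) + (3 + a) + k) b≡) (eq s a k))))
              where
              eq : ∀ s a k → suc (suc (s + 1 + a)) + (3 + a) + k ≡ s + (2 * (3 + a) + k)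
              eq = solve-∀
          sideX : sumOver X f + 4 ≤ (3 + a + 3) * (3 + a) + 2 * s
          sideX = subst (λ z → sumOver X f + 4 ≤ (z + 3) * z + 2 * s) (sym #X)
            (side {u} {v} C O v∈W dv v∉B (λ w p → ≤-trans (m≤m+n (deg X w) (deg O w)) (X+O≤2 (proj₂ (C-elim p))))
              (λ w _ → A-cover w) λ w p → proj₁ (O-elim w p) , proj₁ (proj₂ (O-elim w p)))
          sideY : sumOver Y f + 4 ≤ (3 + a + 3) * (3 + a) + 2 * s
          sideY = subst (λ z → sumOver Y f + 4 ≤ (z + 3) * z + 2 * s) (sym #Y)
            (side {v} {u} C O u∈W du u∉A (λ w p → ≤-trans (m≤m+n (deg Y w) (deg O w)) (Y+O≤2 (proj₁ (C-elim p))))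
              (λ w _ → B-cover w) λ w p → proj₁ (O-elim w p) , proj₂ (proj₂ (O-elim w p)))
          hM : sumOver M f ≤ sumOver C f + sumOver X f + sumOver Y f
          hM = ≤-trans (sumOver-cover {A = M} {A} {Y} {f} M-cover)
              (+-monoˡ-≤ (sumOver Y f) (sumOver-cover {A = A} {C} {X} {f} A-cover))
          -- The union `M` is peeled off and weighed over `C`, `X` and `Y`; what remains, `O`, is
          -- treated as if it were a clique. The 8 collects the 4 gained at each centre.
          hB : degSum W + 8 + k ≤ (s + 3) * s + 2 * ((3 + a + 3) * (3 + a) + 2 * s) + k * k
          hB = linear
            (degSum W + sumOver M f + sumOver C f + (sumOver X f + 4) + (sumOver Y f + 4) + (degSum O + k))
            (sumOver M f + degSum O + (sumOver C f + sumOver X f + sumOver Y f) + (s + 3) * s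
              + ((3 + a + 3) * (3 + a) + 2 * s) + ((3 + a + 3) * (3 + a) + 2 * s) + k * k) 0
            (+-mono-≤ (+-mono-≤ (+-mono-≤ (+-mono-≤ (+-mono-≤ (≤-reflexive (degSum-peel {W} {M} M⊆W)) hM)
              (sumOver-≤ {A = C} (s + 3) C-weight)) sideX) sideY) (degSum-trivial O))
            (eq (degSum W) (sumOver M f) (sumOver C f) (sumOver X f) (sumOver Y f) (degSum O) s a k)
            where
            eq : ∀ W M C X Y O s a k → W + 8 + k + (M + O + (C + X + Y) + (s + 3) * s
              + ((3 + a + 3) * (3 + a) + 2 * s) + ((3 + a + 3) * (3 + a) + 2 * s) + k * k) + 0
              ≡ (s + 3) * s + 2 * ((3 + a + 3) * (3 + a) + 2 * s) + k * k + (W + M + C + (X + 4) + (Y + 4) + (O + k))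
            eq = solve-∀

        heavy : VSet n
        heavy w = W w ∧ (suc b ≤ᵇ deg W w)

        heavy-elim : ∀ {w} → heavy ∋ w → W ∋ w × deg W w ≡ suc b
        heavy-elim {w} h = proj₁ (∧-true h) , ≤-antisym (max w (proj₁ (∧-true h))) (≤ᵇ-true⁻ (proj₂ (∧-true {W w} h)))

        heavy-cases : ∀ w → W ∋ w → heavy ∋ w ⊎ (heavy w ≡ false × deg W w ≤ b)
        heavy-cases w w∈W with suc b ≤? deg W w
        ... | yes h = inj₁ (∧-intro w∈W (≤ᵇ-true h))
        ... | no ¬h with heavy w in e
        ... | true  = contradiction (≤ᵇ-true⁻ (proj₂ (∧-true {W w} e))) ¬h
        ... | false = inj₂ (refl , s≤s⁻¹ (≰⇒> ¬h))

        common : p ≡ 0 → ∀ {v} → W ∋ v → deg W v ≡ suc b →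
          (∀ u → heavy ∋ u → # (N[ u ] W ∖ N[ v ] W) < 1) → Bounded W q
        common p≡0 {v} v∈W dv shared = subst (λ z → Bound b (degSum W) z q) (sym #W₁)
          (bound-common {b} {degSum W} {q} q≤
            (linear (S + (S + # heavy + (q + 2))) (b * (b + 4 + q) + # heavy +
                ((b + 2) * (b + 2) + (q + 2) * (q + 2))) 0
              (+-mono-≤ hi hii) (eq S (# heavy) (b * (b + 4 + q)) q ((b + 2) * (b + 2)) ((q + 2) * (q + 2))))
            (≤-trans (+-monoˡ-≤ (q + 2) (m≤m+n S (# heavy))) hii))
          where
          eq : ∀ S h x q y z → 2 * S + (q + 2) + (x + h + (y + z)) + 0 ≡ x + y + z + (S + (S + h + (q + 2)))
          eq = solve-∀
          S = degSum W
          A = N[ v ] W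
          R = W ∖ A
          #W₁ : # W ≡ b + 4 + q
          #W₁ = trans #W (trans (cong (λ z → suc z * (b + 4) + q) p≡0) (cong (_+ q) (+-identityʳ (b + 4))))
          #A : # A ≡ b + 2
          #A = trans (#N v∈W) (trans (cong suc dv) (+-comm 2 b))
          #R : # R ≡ q + 2
          #R = +-cancelˡ-≡ (b + 2) _ _ (trans (cong (_+ # R) (sym #A))
              (trans (sym (#-peel (N⊆ {W} {v}))) (trans #W₁ (eq' b q))))
            where
            eq' : ∀ b q → b + 4 + q ≡ b + 2 + (q + 2)
            eq' = solve-∀
          N⊆A : ∀ {u} → heavy ∋ u → N[ u ] W ⊆ A
          N⊆A {u} h w p with true? (A w)
          ... | inj₁ r = r
          ... | inj₂ r = contradiction (∖-intro {A = N[ u ] W} {A} p r) (#-zero⁻ {A = N[ u ] W ∖ A} (shared u h))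
          heavy⊆A : heavy ⊆ A
          heavy⊆A u h = N⊆A h u (N-self {W} (proj₁ (heavy-elim h)))
          hi : S ≤ b * (b + 4 + q) + # heavy
          hi = begin
            sumOver W (deg W) ≤⟨ sumOver-mono {A = W} pointwise ⟩
            sumOver W (λ w → b + ι (heavy w)) ≡⟨ sumOver-+ W (λ _ → b) (ι ∘ heavy) ⟩
            sumOver W (λ _ → b) + sumOver W (ι ∘ heavy) ≡⟨ cong₂ _+_
                (trans (sumOver-const W b) (cong (b *_) #W₁)) (sumOver-ι W heavy) ⟩
            b * (b + 4 + q) + # (W ∩ heavy) ≤⟨ +-monoʳ-≤ (b * (b + 4 + q))
                (#-mono {A = W ∩ heavy} {heavy} λ w p → proj₂ (∧-true {W w} p)) ⟩
            b * (b + 4 + q) + # heavy ∎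
            where
            open ≤-Reasoning
            pointwise : ∀ w → W ∋ w → deg W w ≤ b + ι (heavy w)
            pointwise w p with heavy-cases w p
            ... | inj₁ h = subst (λ z → deg W w ≤ b + ι z) (sym h) (≤-trans (max w p) (≤-reflexive (+-comm 1 b)))
            ... | inj₂ (h , d) = ≤-trans d (m≤m+n b _)
          f : Fin n → ℕ
          f w = deg W w + out A w
          hA : sumOver A f + # heavy ≤ (b + 2) * (b + 2)
          hA = begin
            sumOver A f + # heavy ≤⟨ +-monoʳ-≤ (sumOver A f)
                (#-mono {A = heavy} {A ∩ heavy} λ w p → ∧-intro (heavy⊆A w p) p) ⟩
            sumOver A f + # (A ∩ heavy) ≡⟨ cong (sumOver A f +_) (sumOver-ι A heavy) ⟨
            sumOver A f + sumOver A (ι ∘ heavy) ≡⟨ sumOver-+ A f (ι ∘ heavy) ⟨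
            sumOver A (λ w → f w + ι (heavy w)) ≤⟨ sumOver-≤ {A = A} (b + 2) pointwise ⟩
            (b + 2) * # A ≡⟨ cong ((b + 2) *_) #A ⟩
            (b + 2) * (b + 2) ∎
            where
            open ≤-Reasoning
            -- A heavy vertex has weight `b + 1 + 0`, any other at most `b + 2`. So one unit is to
            -- spare at each heavy vertex, and it is this unit that cancels the excess in `hi`.
            pointwise : ∀ w → A ∋ w → f w + ι (heavy w) ≤ b + 2
            pointwise w p with heavy-cases w (N⊆ {W} {v} w p)
            ... | inj₂ (h , d) = subst (λ z → f w + ι z ≤ b + 2) (sym h)
                (≤-trans (≤-reflexive (+-identityʳ (f w))) (+-mono-≤ d (out≤2 v∈W dv p)))
            ... | inj₁ h = subst (λ z → f w + ι z ≤ b + 2) (sym h)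
                (≤-reflexive (trans (cong₂ (λ x y → x + y + 1) (proj₂ (heavy-elim h)) out≡0) (eq'' b)))
              where
              out≡0 : out A w ≡ 0
              out≡0 = #-empty {A = (W ∖ A) ∩ adj G w} λ x r → proj₂ (∖-elim {A = W} {A} (proj₁ (∧-true r)))
                (N⊆A h x (N-adj {W} (proj₁ (∖-elim {A = W} {A} (proj₁ (∧-true r)))) (proj₂ (∧-true r))))
              eq'' : ∀ b → suc b + 0 + 1 ≡ b + 2
              eq'' = solve-∀
          hii : S + # heavy + (q + 2) ≤ (b + 2) * (b + 2) + (q + 2) * (q + 2)
          hii = linear (S + (sumOver A f + # heavy) + (degSum R + (q + 2)))
            (sumOver A f + degSum R + (b + 2) * (b + 2) + (q + 2) * (q + 2)) 0
            (+-mono-≤ (+-mono-≤ (≤-reflexive (degSum-peel {W} {A} (N⊆ {W} {v}))) hA)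
              (subst (λ z → degSum R + z ≤ z * z) #R (degSum-trivial R)))
            (eq'' S (# heavy) q (sumOver A f) (degSum R) ((b + 2) * (b + 2)) ((q + 2) * (q + 2)))
            where
            eq'' : ∀ S h q f r x y → S + h + (q + 2) + (f + r + x + y) + 0 ≡ x + y + (S + (f + h) + (r + (q + 2)))
            eq'' = solve-∀

        max-b+1-single : p ≡ 0 → ∀ {v} → W ∋ v → deg W v ≡ suc b → Bounded W q
        max-b+1-single p≡0 {v} v∈W dv with exceeds? heavy (λ u → # (N[ u ] W ∖ N[ v ] W)) 1
        ... | inj₂ shared = common p≡0 v∈W dv shared
        ... | inj₁ (u , hu , r≥1) = cases _ refl r≥1
          where
          u∈W = proj₁ (heavy-elim hu)
          du = proj₂ (heavy-elim hu)
          cases : ∀ r → # (N[ u ] W ∖ N[ v ] W) ≡ r → 1 ≤ r → Bounded W q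
          cases (suc zero) e _ = peel-one u∈W v∈W du dv e
          cases (suc (suc zero)) e _ = peel-two u∈W v∈W du dv e
          cases (suc (suc (suc r))) e _ = far p≡0 u∈W v∈W du dv (≤-trans (s≤s (s≤s (s≤s z≤n))) (≤-reflexive (sym e)))

        max-b+1 : Bounded W q
        max-b+1 with exceeds? W (deg W) (suc b)
        ... | inj₂ none = bound-regular {b} {degSum W} {_} {p} #W (sumOver-≤ {A = W} b λ w p → s≤s⁻¹ (none w p))
        ... | inj₁ (v , v∈W , dv) = cases p refl
          where
          cases : ∀ p' → p ≡ p' → Bounded W q
          cases zero     e = max-b+1-single e v∈W (≤-antisym (max v v∈W) dv)
          cases (suc p') e = bound-two-blocks {b} {degSum W} {_} {p'} q≤
              (trans #W (cong (λ z → suc z * (b + 4) + q) e))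
            (≤-trans (sumOver-≤ {A = W} (suc b) max) (≤-reflexive (cong (_* # W) (+-comm 1 b))))

      inductive-step : Bounded W q
      inductive-step with exceeds? W (deg W) (b + 4)
      ... | inj₁ (v , v∈W , h) = hub v∈W h
      ... | inj₂ <b+4 with exceeds? W (deg W) (b + 3)
      ... | inj₁ (v , v∈W , h) = max-b+3 ≤b+3 v∈W (≤-antisym (≤b+3 v v∈W) h)
        where
        ≤b+3 : ∀ w → W ∋ w → deg W w ≤ b + 3
        ≤b+3 w p = s≤s⁻¹ (≤-trans (<b+4 w p) (≤-reflexive (+-suc b 3)))
      ... | inj₂ <b+3 with exceeds? W (deg W) (b + 2)
      ... | inj₁ (v , v∈W , h) = max-b+2 ≤b+2 v∈W (≤-antisym (≤b+2 v v∈W) h)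
        where
        ≤b+2 : ∀ w → W ∋ w → deg W w ≤ b + 2
        ≤b+2 w p = s≤s⁻¹ (≤-trans (<b+3 w p) (≤-reflexive (+-suc b 2)))
      ... | inj₂ <b+2 = max-b+1 λ w p → s≤s⁻¹ (≤-trans (<b+2 w p) (≤-reflexive (+-comm b 2)))

  bounded : ∀ fuel W → # W < fuel → ∀ p q → # W ≡ p * (b + 4) + q → q ≤ b + 3 → Bounded W q
  -- Without a full block the trivial bound `deg < # W` is already the clique term.
  bounded (suc fuel) W <fuel zero q #W q≤ = subst (λ z → Bound b (degSum W) z q) (sym #W)
    (bound-clique q≤ (subst (λ z → degSum W + z ≤ z * z) #W (degSum-trivial W)))
  bounded (suc fuel) W <fuel (suc p) q #W q≤ = inductive-step W
    (λ W' smaller → bounded fuel W' (≤-trans smaller (s≤s⁻¹ <fuel))) p q #W q≤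

upper-bound : ∀ {n} (G : Graph n) (b p q : ℕ) → 3 < b → n ≡ p * (b + 4) + q → q ≤ b + 3 →
  (G -free) (doubleStar 3 b) → Bound b (Neighbourhoods.degSum G (λ _ → true)) n q
upper-bound {n} G b p q 3<b n≡ q≤ free = subst (λ z → Bound b (Neighbourhoods.degSum G (λ _ → true)) z q) (#-full n)
  (UpperBound.bounded G b 3<b free (suc n) (λ _ → true) (s≤s (≤-reflexive (#-full n))) p q (trans (#-full n) n≡) q≤)

-- Constructions

degree : ∀ {n} → Graph n → Fin n → ℕ
degree G v = # (adj G v)

totalDegree : ∀ {n} → Graph n → ℕ
totalDegree G = sum (degree G)

listSum-allFin : ∀ {n} (f : Fin n → ℕ) → List.sum (map f (allFin n)) ≡ sum f
listSum-allFin f = trans (cong List.sum (map-tabulate (λ i → i) f)) (listSum-tabulate f)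
  where
  listSum-tabulate : ∀ {n} (f : Fin n → ℕ) → List.sum (tabulate f) ≡ sum f
  listSum-tabulate {zero}  f = refl
  listSum-tabulate {suc n} f = cong (f zero +_) (listSum-tabulate (f ∘ suc))

edgeCount-sum : ∀ {n} (G : Graph n) →
  edgeCount G ≡ sum (λ i → sum (λ j → ι ((toℕ i <ᵇ toℕ j) ∧ adj G i j)))
edgeCount-sum {n} G = trans (listSum-allFin (λ i → List.sum
    (map (λ j → if (toℕ i <ᵇ toℕ j) ∧ adj G i j then 1 else 0) (allFin n))))
  (sum-cong-≗ λ i → trans (listSum-allFin (λ j → if (toℕ i <ᵇ toℕ j) ∧ adj G i j then 1 else 0))
    (sum-cong-≗ λ j → if-ι ((toℕ i <ᵇ toℕ j) ∧ adj G i j)))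
  where
  if-ι : ∀ x → (if x then 1 else 0) ≡ ι x
  if-ι true  = refl
  if-ι false = refl

<ᵇ-trichotomy : ∀ {n} (i j : Fin n) x → (i ≡ j → x ≡ false) →
  ι x ≡ ι ((toℕ i <ᵇ toℕ j) ∧ x) + ι ((toℕ j <ᵇ toℕ i) ∧ x)
<ᵇ-trichotomy zero zero x h rewrite h refl = refl
<ᵇ-trichotomy zero (suc j) x h = sym (+-identityʳ (ι x))
<ᵇ-trichotomy (suc i) zero x h = refl
<ᵇ-trichotomy (suc i) (suc j) x h = <ᵇ-trichotomy i j x (λ e → h (cong suc e))

handshake : ∀ {n} (G : Graph n) → totalDegree G ≡ 2 * edgeCount G
handshake G = begin
  sum (λ i → sum (λ j → ι (adj G i j)))
    ≡⟨ sum-cong-≗ (λ i → trans (sum-cong-≗ λ j → <ᵇ-trichotomy i j (adj G i j) λ { refl → Graph.irrefl G i })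
                               (∑-distrib-+ (up i) (λ j → ι ((toℕ j <ᵇ toℕ i) ∧ adj G i j)))) ⟩
  sum (λ i → sum (up i) + sum (λ j → ι ((toℕ j <ᵇ toℕ i) ∧ adj G i j)))
    ≡⟨ ∑-distrib-+ (λ i → sum (up i)) _ ⟩
  sum (λ i → sum (up i)) + sum (λ i → sum (λ j → ι ((toℕ j <ᵇ toℕ i) ∧ adj G i j)))
    ≡⟨ cong (sum (λ i → sum (up i)) +_) (trans (∑-comm (λ i j → ι ((toℕ j <ᵇ toℕ i) ∧ adj G i j)))
         (sum-cong-≗ λ j → sum-cong-≗ λ i → cong (λ x → ι ((toℕ j <ᵇ toℕ i) ∧ x)) (Graph.sym G i j))) ⟩
  sum (λ i → sum (up i)) + sum (λ i → sum (up i))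
    ≡⟨ cong₂ _+_ (sym (edgeCount-sum G)) (trans (sym (edgeCount-sum G)) (sym (+-identityʳ (edgeCount G)))) ⟩
  2 * edgeCount G ∎
  where
  open ≡-Reasoning
  up = λ i j → ι ((toℕ i <ᵇ toℕ j) ∧ adj G i j)

-- A local criterion for freeness, and gluing of graphs

-- With three leaves at `u` and `b` at `v`, a double star needs `b + 1` neighbours of `v`, and
-- `b + 5` vertices in the union of the two neighbourhoods. One of these must fail for every ordered
-- edge. Unlike freeness itself, this passes to disjoint unions edge by edge.
Good : ∀ {n} → ℕ → Graph n → Set
Good {n} b G = ∀ u v → adj G u v ≡ true → degree G v ≤ b ⊎
  Σ (VSet n) λ Z → # Z ≤ b + 4 × adj G u ⊆ Z × adj G v ⊆ Z

<ᵇ-fin : ∀ {n} (j : Fin n) → (toℕ j <ᵇ n) ≡ true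
<ᵇ-fin zero    = refl
<ᵇ-fin (suc j) = <ᵇ-fin j

good⇒free : ∀ {n b} {G : Graph n} → Good b G → (G -free) (doubleStar 3 b)
good⇒free {n} {b} {G} good (f , inj , hom) with good (f zero) (f (suc zero)) (hom zero (suc zero) refl)
... | inj₁ small = contradiction (≤-trans (injection-size (adj G (f (suc zero))) (f ∘ index)
    (index-injective ∘ inj) member) small) (<⇒≱ ≤-refl)
  where
  -- The `b + 1` neighbours of the centre 1: the other centre 0 and the leaves from 5 on.
  index : Fin (suc b) → Fin (5 + b)
  index zero    = zero
  index (suc j) = suc (suc (suc (suc (suc j))))
  index-injective : Injective _≡_ _≡_ index
  index-injective {zero}  {zero}  _ = refl
  index-injective {suc i} {suc j} e = cong suc (fsuc-injective
      (fsuc-injective (fsuc-injective (fsuc-injective (fsuc-injective e)))))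
  member : ∀ i → adj G (f (suc zero)) ∋ f (index i)
  member zero    = hom (suc zero) zero refl
  member (suc j) = hom (suc zero) (suc (suc (suc (suc (suc j))))) (∨-introˡ (<ᵇ-fin j))
... | inj₂ (Z , #Z , u⊆ , v⊆) = contradiction (≤-trans (injection-size Z f inj member) #Z)
    (<⇒≱ (≤-reflexive (+-comm (suc b) 4)))
  where
  member : ∀ i → Z ∋ f i
  member zero = v⊆ _ (hom (suc zero) zero refl)
  member (suc zero) = u⊆ _ (hom zero (suc zero) refl)
  member (suc (suc zero)) = u⊆ _ (hom zero (suc (suc zero)) refl)
  member (suc (suc (suc zero))) = u⊆ _ (hom zero (suc (suc (suc zero))) refl)
  member (suc (suc (suc (suc zero)))) = u⊆ _ (hom zero (suc (suc (suc (suc zero)))) refl)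
  member (suc (suc (suc (suc (suc j))))) = v⊆ _ (hom (suc zero) (suc (suc (suc (suc (suc j))))) (∨-introˡ (<ᵇ-fin j)))

bounded⇒good : ∀ {n b} {G : Graph n} → (∀ v → degree G v ≤ b) → Good b G
bounded⇒good h u v _ = inj₁ (h v)

small⇒good : ∀ {n b} {G : Graph n} → n ≤ b + 4 → Good b G
small⇒good {n} h u v _ = inj₂ ((λ _ → true) , ≤-trans (≤-reflexive (#-full n)) h , (λ _ _ → refl) , λ _ _ → refl)

sum-↑ : ∀ m {n} (f : Fin (m + n) → ℕ) → sum f ≡ sum (λ i → f (i ↑ˡ n)) + sum (λ j → f (m ↑ʳ j))
sum-↑ zero    f = refl
sum-↑ (suc m) f = trans (cong (f zero +_) (sum-↑ m (f ∘ suc))) (sym (+-assoc (f zero) _ _))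

data Split m {n} : Fin (m + n) → Set where
  left  : ∀ i → Split m (i ↑ˡ n)
  right : ∀ j → Split m (m ↑ʳ j)

split : ∀ m {n} (v : Fin (m + n)) → Split m v
split zero    v       = right v
split (suc m) zero    = left zero
split (suc m) (suc v) with split m v
... | left i  = left (suc i)
... | right j = right j

-- `X` is an arbitrary bipartite graph between the two sides, so that disjoint unions, joins,
-- perfect matchings and the crossing edges of hybrids are all instances.
module Glue {m n : ℕ} (X : Fin m → Fin n → Bool) (G : Graph m) (H : Graph n) where
  private
    joined : Fin m ⊎ Fin n → Fin m ⊎ Fin n → Bool
    joined (inj₁ i) (inj₁ j) = adj G i j
    joined (inj₁ i) (inj₂ j) = X i j
    joined (inj₂ i) (inj₁ j) = X j i
    joined (inj₂ i) (inj₂ j) = adj H i j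

    joined-sym : ∀ x y → joined x y ≡ joined y x
    joined-sym (inj₁ i) (inj₁ j) = Graph.sym G i j
    joined-sym (inj₁ i) (inj₂ j) = refl
    joined-sym (inj₂ i) (inj₁ j) = refl
    joined-sym (inj₂ i) (inj₂ j) = Graph.sym H i j

    joined-irrefl : ∀ x → joined x x ≡ false
    joined-irrefl (inj₁ i) = Graph.irrefl G i
    joined-irrefl (inj₂ j) = Graph.irrefl H j

  glue : Graph (m + n)
  glue = record
    { adj    = λ u v → joined (splitAt m u) (splitAt m v)
    ; sym    = λ u v → joined-sym (splitAt m u) (splitAt m v)
    ; irrefl = λ u → joined-irrefl (splitAt m u)
    }

  adj-ll : ∀ i j → adj glue (i ↑ˡ n) (j ↑ˡ n) ≡ adj G i j
  adj-ll i j rewrite splitAt-↑ˡ m i n | splitAt-↑ˡ m j n = refl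

  adj-lr : ∀ i j → adj glue (i ↑ˡ n) (m ↑ʳ j) ≡ X i j
  adj-lr i j rewrite splitAt-↑ˡ m i n | splitAt-↑ʳ m n j = refl

  adj-rl : ∀ i j → adj glue (m ↑ʳ i) (j ↑ˡ n) ≡ X j i
  adj-rl i j rewrite splitAt-↑ʳ m n i | splitAt-↑ˡ m j n = refl

  adj-rr : ∀ i j → adj glue (m ↑ʳ i) (m ↑ʳ j) ≡ adj H i j
  adj-rr i j rewrite splitAt-↑ʳ m n i | splitAt-↑ʳ m n j = refl

  degree-left : ∀ i → degree glue (i ↑ˡ n) ≡ degree G i + # (X i)
  degree-left i = trans (sum-↑ m (λ v → ι (adj glue (i ↑ˡ n) v)))
    (cong₂ _+_ (sum-cong-≗ λ j → cong ι (adj-ll i j)) (sum-cong-≗ λ j → cong ι (adj-lr i j)))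

  degree-right : ∀ j → degree glue (m ↑ʳ j) ≡ # (λ i → X i j) + degree H j
  degree-right j = trans (sum-↑ m (λ v → ι (adj glue (m ↑ʳ j) v)))
    (cong₂ _+_ (sum-cong-≗ λ i → cong ι (adj-rl j i)) (sum-cong-≗ λ i → cong ι (adj-rr j i)))

  totalDegree-glue : totalDegree glue ≡ totalDegree G + totalDegree H + 2 * sum (λ i → # (X i))
  totalDegree-glue = begin
    sum (degree glue)
      ≡⟨ sum-↑ m (degree glue) ⟩
    sum (λ i → degree glue (i ↑ˡ n)) + sum (λ j → degree glue (m ↑ʳ j))
      ≡⟨ cong₂ _+_ (trans (sum-cong-≗ degree-left) (∑-distrib-+ (degree G) (λ i → # (X i))))
                   (trans (sum-cong-≗ degree-right) (∑-distrib-+ (λ j → # (λ i → X i j)) (degree H))) ⟩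
    totalDegree G + cross + (sum (λ j → # (λ i → X i j)) + totalDegree H)
      ≡⟨ cong (λ z → totalDegree G + cross + (z + totalDegree H)) (sym (∑-comm (λ i j → ι (X i j)))) ⟩
    totalDegree G + cross + (cross + totalDegree H)
      ≡⟨ eq (totalDegree G) cross (totalDegree H) ⟩
    totalDegree G + totalDegree H + 2 * cross ∎
    where
    open ≡-Reasoning
    cross = sum (λ i → # (X i))
    eq : ∀ g c h → g + c + (c + h) ≡ g + h + 2 * c
    eq = solve-∀

open Glue using (glue)

∅ₓ : ∀ {m n} → Fin m → Fin n → Bool
∅ₓ _ _ = false

_⊎ᵍ_ : ∀ {m n} → Graph m → Graph n → Graph (m + n)
G ⊎ᵍ H = glue ∅ₓ G H

totalDegree-⊎ : ∀ {m n} (G : Graph m) (H : Graph n) → totalDegree (G ⊎ᵍ H) ≡ totalDegree G + totalDegree H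
totalDegree-⊎ {m} {n} G H = trans (Glue.totalDegree-glue ∅ₓ G H)
  (trans (cong (λ z → totalDegree G + totalDegree H + 2 * z)
      (trans (sum-cong-≗ {m} λ i → sum-replicate-zero n) (sum-replicate-zero m)))
    (+-identityʳ _))

#-↑ : ∀ m {n} (A : VSet (m + n)) → # A ≡ # (λ i → A (i ↑ˡ n)) + # (λ j → A (m ↑ʳ j))
#-↑ m A = sum-↑ m (ι ∘ A)

good-⊎ : ∀ {m n b} {G : Graph m} {H : Graph n} → Good b G → Good b H → Good b (G ⊎ᵍ H)
good-⊎ {m} {n} {b} {G} {H} gG gH u v e with split m u | split m v
... | left i  | right j = contradiction (trans (sym (Glue.adj-lr ∅ₓ G H i j)) e) λ ()
... | right i | left j  = contradiction (trans (sym (Glue.adj-rl ∅ₓ G H i j)) e) λ ()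
... | left i  | left j  with gG i j (trans (sym (Glue.adj-ll ∅ₓ G H i j)) e)
... | inj₁ small = inj₁ (≤-trans (≤-reflexive (trans (Glue.degree-left ∅ₓ G H j)
        (trans (cong (degree G j +_) (sum-replicate-zero n)) (+-identityʳ _)))) small)
... | inj₂ (Z , #Z , i⊆ , j⊆) = inj₂ (Z' , ≤-trans (≤-reflexive size) #Z , lift i i⊆ , lift j j⊆)
  where
  in? : Fin m ⊎ Fin n → Bool
  in? (inj₁ i) = Z i
  in? (inj₂ j) = false
  Z' : VSet (m + n)
  Z' w = in? (splitAt m w)
  size : # Z' ≡ # Z
  size = trans (#-↑ m Z') (trans (cong₂ _+_ (sum-cong-≗ λ x → cong (ι ∘ in?) (splitAt-↑ˡ m x n))
    (trans (sum-cong-≗ λ x → cong (ι ∘ in?) (splitAt-↑ʳ m n x)) (sum-replicate-zero n))) (+-identityʳ (# Z)))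
  lift : ∀ x → adj G x ⊆ Z → adj (G ⊎ᵍ H) (x ↑ˡ n) ⊆ Z'
  lift x h w a with split m w
  ... | left y  = trans (cong in? (splitAt-↑ˡ m y n)) (h y (trans (sym (Glue.adj-ll ∅ₓ G H x y)) a))
  ... | right y = contradiction (trans (sym (Glue.adj-lr ∅ₓ G H x y)) a) λ ()
good-⊎ {m} {n} {b} {G} {H} gG gH u v e | right i | right j with gH i j (trans (sym (Glue.adj-rr ∅ₓ G H i j)) e)
... | inj₁ small = inj₁ (≤-trans (≤-reflexive (trans (Glue.degree-right ∅ₓ G H j)
        (cong (_+ degree H j) (sum-replicate-zero m)))) small)
... | inj₂ (Z , #Z , i⊆ , j⊆) = inj₂ (Z' , ≤-trans (≤-reflexive size) #Z , lift i i⊆ , lift j j⊆)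
  where
  in? : Fin m ⊎ Fin n → Bool
  in? (inj₁ i) = false
  in? (inj₂ j) = Z j
  Z' : VSet (m + n)
  Z' w = in? (splitAt m w)
  size : # Z' ≡ # Z
  size = trans (#-↑ m Z') (cong₂ _+_ (trans (sum-cong-≗ λ x → cong (ι ∘ in?) (splitAt-↑ˡ m x n))
      (sum-replicate-zero m))
    (sum-cong-≗ λ x → cong (ι ∘ in?) (splitAt-↑ʳ m n x)))
  lift : ∀ x → adj H x ⊆ Z → adj (G ⊎ᵍ H) (m ↑ʳ x) ⊆ Z'
  lift x h w a with split m w
  ... | right y = trans (cong in? (splitAt-↑ʳ m n y)) (h y (trans (sym (Glue.adj-rr ∅ₓ G H x y)) a))
  ... | left y  = contradiction (trans (sym (Glue.adj-rl ∅ₓ G H x y)) a) λ ()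

⁅⁆-sym : ∀ {n} (i j : Fin n) → ⁅ i ⁆ j ≡ ⁅ j ⁆ i
⁅⁆-sym i j with j ≟ i | i ≟ j
... | yes _ | yes _ = refl
... | no  _ | no  _ = refl
... | yes p | no  q = contradiction (sym p) q
... | no  p | yes q = contradiction (sym q) p

complete : ∀ n → Graph n
complete n = record
  { adj    = λ i j → not (⁅ i ⁆ j)
  ; sym    = λ i j → cong not (⁅⁆-sym i j)
  ; irrefl = λ i → cong not (⁅⁆-intro i)
  }

degree-complete : ∀ {n} (i : Fin n) → suc (degree (complete n) i) ≡ n
degree-complete {n} i = trans (cong (_+ degree (complete n) i) (sym (#-singleton i)))
  (trans (sym (#-part {A = λ _ → true} {⁅ i ⁆} λ _ _ → refl)) (#-full n))

sum-const : ∀ n c → sum {n} (λ _ → c) ≡ n * c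
sum-const zero    c = refl
sum-const (suc n) c = cong (c +_) (sum-const n c)

totalDegree-complete : ∀ n → totalDegree (complete n) + n ≡ n * n
totalDegree-complete n = begin
  totalDegree (complete n) + n
    ≡⟨ cong (totalDegree (complete n) +_) (#-full n) ⟨
  totalDegree (complete n) + # {n} (λ _ → true)
    ≡⟨ ∑-distrib-+ (degree (complete n)) (λ _ → 1) ⟨
  sum (λ i → degree (complete n) i + 1)
    ≡⟨ sum-cong-≗ (λ i → trans (+-comm (degree (complete n) i) 1) (degree-complete {n} i)) ⟩
  sum {n} (λ _ → n)
    ≡⟨ sum-const n n ⟩
  n * n ∎
  where open ≡-Reasoning

total≥ : ∀ {n} (G : Graph n) c → (∀ v → c ≤ degree G v) → n * c ≤ totalDegree G
total≥ {n} G c h = ≤-trans (≤-reflexive (sym (sum-const n c))) (sum-mono h)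

-- Circulants and near-regular graphs

rangeSum : (ℕ → ℕ) → ℕ → ℕ
rangeSum f n = sum {n} (λ i → f (toℕ i))

rangeSum-last : ∀ f n → rangeSum f (suc n) ≡ rangeSum f n + f n
rangeSum-last f zero    = +-comm (f 0) 0
rangeSum-last f (suc n) = trans (cong (f 0 +_) (rangeSum-last (f ∘ suc) n)) (sym (+-assoc (f 0) _ _))

rangeSum-+ : ∀ f m n → rangeSum f (m + n) ≡ rangeSum f m + rangeSum (λ j → f (m + j)) n
rangeSum-+ f zero    n = refl
rangeSum-+ f (suc m) n = trans (cong (f 0 +_) (rangeSum-+ (f ∘ suc) m n)) (sym (+-assoc (f 0) _ _))

rangeSum-const : ∀ f n c → (∀ j → j < n → f j ≡ c) → rangeSum f n ≡ n * c
rangeSum-const f n c h = trans (sum-cong-≗ λ i → h (toℕ i) (toℕ<n i)) (sum-const n c)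

-- Moving the centre from i to i + 1 trades the distance N - (i + 1) for i + 1.
rangeSum-rotate : ∀ F N → (∀ d e → suc d + suc e ≡ N → F (suc d) ≡ F (suc e)) →
  ∀ i → i < N → rangeSum (λ j → F ∣ i - j ∣) N ≡ rangeSum F N
rangeSum-rotate F (suc N) symm zero    _   = refl
rangeSum-rotate F (suc N) symm (suc i) i<N with m≤n⇒∃[o]m+o≡n (s≤s⁻¹ i<N)
... | e , refl = begin
  F (suc i) + rangeSum (λ j → F ∣ i - j ∣) N
    ≡⟨ cong (_+ rangeSum (λ j → F ∣ i - j ∣) N) (symm i e (cong suc (+-suc i e))) ⟩
  F (suc e) + rangeSum (λ j → F ∣ i - j ∣) N
    ≡⟨ +-comm (F (suc e)) _ ⟩
  rangeSum (λ j → F ∣ i - j ∣) N + F (suc e)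
    ≡⟨ cong (λ z → rangeSum (λ j → F ∣ i - j ∣) N + F z)
        (trans (sym (∣m-m+n∣≡n i (suc e))) (cong ∣ i -_∣ (+-suc i e))) ⟩
  rangeSum (λ j → F ∣ i - j ∣) N + F ∣ i - N ∣
    ≡⟨ rangeSum-last (λ j → F ∣ i - j ∣) N ⟨
  rangeSum (λ j → F ∣ i - j ∣) (suc N)
    ≡⟨ rangeSum-rotate F (suc N) symm i (<⇒≤ i<N) ⟩
  rangeSum F (suc N) ∎
  where open ≡-Reasoning

⇔⇒≡ : ∀ {x y} → (x ≡ true → y ≡ true) → (y ≡ true → x ≡ true) → x ≡ y
⇔⇒≡ {true}          f g = sym (f refl)
⇔⇒≡ {false} {true}  f g = g refl
⇔⇒≡ {false} {false} f g = refl

module Circulant (N h : ℕ) where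
  -- Applied to the difference `d` of two vertices, this says that their cyclic distance `d` or
  -- `N - d` is between 1 and `h`; the second alternative is written without subtraction.
  short : ℕ → Bool
  short d = (1 ≤ᵇ d) ∧ ((d ≤ᵇ h) ∨ (N ≤ᵇ d + h))

  short-sym : ∀ d e → suc d + suc e ≡ N → short (suc d) ≡ true → short (suc e) ≡ true
  short-sym d e refl p with ∨-true {suc d ≤ᵇ h} p
  ... | inj₁ q = ∨-introʳ {suc e ≤ᵇ h} (≤ᵇ-true (≤-trans (+-monoˡ-≤ (suc e) (≤ᵇ-true⁻ {suc d} {h} q))
      (≤-reflexive (+-comm h (suc e)))))
  ... | inj₂ q = ∨-introˡ (≤ᵇ-true (+-cancelˡ-≤ (suc d) (suc e) h (≤ᵇ-true⁻ {suc d + suc e} {suc d + h} q)))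

  circulant : Graph N
  circulant = record
    { adj    = λ i j → short ∣ toℕ i - toℕ j ∣
    ; sym    = λ i j → cong short (∣-∣-comm (toℕ i) (toℕ j))
    ; irrefl = λ i → cong short (∣n-n∣≡0 (toℕ i))
    }

  -- After rotation the count takes place at vertex 0. The differences are 0, then `h` short ones,
  -- `c` long ones and again `h` short ones.
  degree-circulant : ∀ {c} → N ≡ suc h + (c + h) → ∀ i → degree circulant i ≡ h + h
  degree-circulant {c} N≡ i = begin
    rangeSum (λ j → F ∣ toℕ i - j ∣) N
      ≡⟨ rangeSum-rotate F N (λ d e p → cong ι (⇔⇒≡ (short-sym d e p)
          (short-sym e d (trans (+-comm (suc e) (suc d)) p)))) (toℕ i) (toℕ<n i) ⟩
    rangeSum F N
      ≡⟨ cong (rangeSum F) N≡ ⟩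
    rangeSum F (suc h + (c + h))
      ≡⟨ trans (rangeSum-+ F (suc h) (c + h)) (cong (rangeSum F (suc h) +_) (rangeSum-+ (λ j → F (suc h + j)) c h)) ⟩
    rangeSum F (suc h) + (rangeSum (λ j → F (suc h + j)) c + rangeSum (λ j → F (suc h + (c + j))) h)
      ≡⟨ cong₂ _+_ (rangeSum-const (F ∘ suc) h 1 near)
           (cong₂ _+_ (rangeSum-const (λ j → F (suc h + j)) c 0 middle)
               (rangeSum-const (λ j → F (suc h + (c + j))) h 1 λ j _ → end j)) ⟩
    h * 1 + (c * 0 + h * 1)
      ≡⟨ eq h c ⟩
    h + h ∎
    where
    open ≡-Reasoning
    F : ℕ → ℕ
    F d = ι (short d)
    eq : ∀ h c → h * 1 + (c * 0 + h * 1) ≡ h + h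
    eq = solve-∀
    near : ∀ j → j < h → F (suc j) ≡ 1
    near j j<h = cong ι (∨-introˡ (≤ᵇ-true j<h))
    middle : ∀ j → j < c → F (suc h + j) ≡ 0
    middle j j<c with (suc h + j ≤ᵇ h) ∨ (N ≤ᵇ suc h + j + h) in e
    ... | false = refl
    ... | true with ∨-true {suc h + j ≤ᵇ h} e
    ... | inj₁ q = contradiction (≤-trans (s≤s (m≤m+n h j)) (≤ᵇ-true⁻ {suc h + j} {h} q)) (<⇒≱ ≤-refl)
    ... | inj₂ q = contradiction (+-cancelˡ-≤ (suc h) (c + h) (j + h)
        (≤-trans (≤-reflexive (sym N≡)) (≤-trans (≤ᵇ-true⁻ {N} {suc h + j + h} q)
          (≤-reflexive (+-assoc (suc h) j h)))))
          (<⇒≱ (+-monoˡ-< h j<c))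
    end : ∀ j → F (suc h + (c + j)) ≡ 1
    end j = cong ι (∨-introʳ {suc h + (c + j) ≤ᵇ h}
        (≤ᵇ-true (≤-trans (≤-trans (≤-reflexive N≡) (m≤m+n _ j)) (≤-reflexive (eq' h c j)))))
      where
      eq' : ∀ h c j → suc h + (c + h) + j ≡ suc h + (c + j) + h
      eq' = solve-∀

module _ {n : ℕ} (G H : Graph n) where
  overlay : Graph n
  overlay = record
    { adj    = λ i j → adj G i j ∨ adj H i j
    ; sym    = λ i j → cong₂ _∨_ (Graph.sym G i j) (Graph.sym H i j)
    ; irrefl = λ i → cong₂ _∨_ (Graph.irrefl G i) (Graph.irrefl H i)
    }

  degree-overlay-≤ : ∀ i → degree overlay i ≤ degree G i + degree H i
  degree-overlay-≤ i = #-cover {A = adj overlay i} {adj G i} {adj H i} λ j → ∨-true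

  degree-overlay-≥ : (∀ i j → adj G i j ≡ true → adj H i j ≡ true → ⊥) → ∀ i → degree G i + degree H i
      ≤ degree overlay i
  degree-overlay-≥ disj i = #-pack {A = adj G i} {adj H i} {adj overlay i} (λ j → ∨-introˡ)
      (λ j → ∨-introʳ {adj G i j}) (disj i)

empty : ∀ n → Graph n
empty n = record { adj = λ _ _ → false ; sym = λ _ _ → refl ; irrefl = λ _ → refl }

module _ (m : ℕ) where
  private module M = Glue (λ (i j : Fin m) → ⁅ i ⁆ j) (empty m) (empty m)

  matching : Graph (m + m)
  matching = M.glue

  degree-matching : ∀ v → degree matching v ≡ 1
  degree-matching v with split m v
  ... | left i  = trans (M.degree-left i) (cong₂ _+_ (sum-replicate-zero m) (#-singleton i))
  ... | right j = trans (M.degree-right j) (trans (cong₂ _+_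
      (trans (sum-cong-≗ λ i → cong ι (⁅⁆-sym i j)) (#-singleton j)) (sum-replicate-zero m)) refl)

  -- Matched vertices are opposite. A circulant with `h < m` does not use the difference `m`, so
  -- overlaying the matching raises every degree by one.
  distance-matching : ∀ u v → adj matching u v ≡ true → ∣ toℕ u - toℕ v ∣ ≡ m
  distance-matching u v e with split m u | split m v
  ... | left i  | left j  = contradiction (trans (sym (M.adj-ll i j)) e) λ ()
  ... | right i | right j = contradiction (trans (sym (M.adj-rr i j)) e) λ ()
  ... | left i  | right j with ⁅⁆-elim {v = i} {j} (trans (sym (M.adj-lr i j)) e)
  ... | refl = trans (cong₂ ∣_-_∣ (toℕ-↑ˡ i m) (trans (toℕ-↑ʳ m i) (+-comm m (toℕ i)))) (∣m-m+n∣≡n (toℕ i) m)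
  distance-matching u v e | right i | left j with ⁅⁆-elim {v = j} {i} (trans (sym (M.adj-rl i j)) e)
  ... | refl = trans (cong₂ ∣_-_∣ (trans (toℕ-↑ʳ m i) (+-comm m (toℕ i))) (toℕ-↑ˡ i m))
      (trans (∣-∣-comm (toℕ i + m) (toℕ i)) (∣m-m+n∣≡n (toℕ i) m))

halve : ∀ k → ∃ λ h → k ≡ h + h ⊎ k ≡ suc (h + h)
halve zero = 0 , inj₁ refl
halve (suc k) with halve k
... | h , inj₁ refl = h , inj₂ refl
... | h , inj₂ refl = suc h , inj₁ (cong suc (sym (+-suc h h)))

-- The `suc` allows for the unit that parity forbids when `n` and `k` are both odd.
NearRegular : ℕ → ℕ → Set
NearRegular n k = Σ (Graph n) λ G → (∀ v → degree G v ≤ k) × k * n ≤ suc (totalDegree G)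

module _ (h : ℕ) where
  short-middle : ∀ {N m} → h < m → N ≡ m + m ⊎ N ≡ m + m + 1 → ¬ (Circulant.short N h m ≡ true)
  short-middle {N} {m} h<m N≡ p with ∨-true {m ≤ᵇ h} (proj₂ (∧-true {1 ≤ᵇ m} p))
  ... | inj₁ q = <⇒≱ h<m (≤ᵇ-true⁻ {m} {h} q)
  ... | inj₂ q = <⇒≱ h<m (+-cancelˡ-≤ m m h (≤-trans (m+m≤ N≡) (≤ᵇ-true⁻ {N} {m + h} q)))
    where
    m+m≤ : N ≡ m + m ⊎ N ≡ m + m + 1 → m + m ≤ N
    m+m≤ (inj₁ refl) = ≤-refl
    m+m≤ (inj₂ refl) = m≤m+n (m + m) 1

  nearRegular-even : ∀ {N} → h + h < N → NearRegular N (h + h)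
  nearRegular-even {N} h< with m≤n⇒∃[o]m+o≡n h<
  ... | c , e = circulant , (λ v → ≤-reflexive (deg v)) ,
      ≤-trans (≤-reflexive (*-comm (h + h) N)) (≤-trans
          (total≥ circulant (h + h) (λ v → ≤-reflexive (sym (deg v)))) (n≤1+n _))
    where
    open Circulant N h
    eq : ∀ h c → suc (h + h) + c ≡ suc h + (c + h)
    eq = solve-∀
    deg = degree-circulant {c} (trans (sym e) (eq h c))

  nearRegular-odd-even : ∀ m → h < m → NearRegular (m + m) (suc (h + h))
  nearRegular-odd-even m h<m with m≤n⇒∃[o]m+o≡n h<m
  ... | c , e = overlay circulant (matching m) ,
      (λ v → ≤-trans (degree-overlay-≤ circulant (matching m) v) (≤-reflexive (deg v))) ,
      ≤-trans (≤-reflexive (*-comm (suc (h + h)) (m + m)))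
        (≤-trans (total≥ (overlay circulant (matching m)) (suc (h + h)) λ v → ≤-trans
            (≤-reflexive (sym (deg v))) (degree-overlay-≥ circulant (matching m) disj v)) (n≤1+n _))
    where
    open Circulant (m + m) h
    eq : ∀ h c → suc h + c + (suc h + c) ≡ suc h + (suc (c + c) + h)
    eq = solve-∀
    deg : ∀ v → degree circulant v + degree (matching m) v ≡ suc (h + h)
    deg v = trans (cong₂ _+_ (degree-circulant {suc (c + c)} (trans (cong₂ _+_ (sym e) (sym e)) (eq h c)) v)
        (degree-matching m v)) (+-comm (h + h) 1)
    disj : ∀ i j → adj circulant i j ≡ true → adj (matching m) i j ≡ true → ⊥
    disj i j p q = short-middle {m + m} h<m (inj₁ refl) (subst (λ z → short z ≡ true) (distance-matching m i j q) p)

  -- The matching leaves out the last vertex, whose degree stays `h + h`. The difference `m` is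
  -- still not short, since the other way round the cycle is even longer.
  nearRegular-odd-odd : ∀ m → h < m → NearRegular (m + m + 1) (suc (h + h))
  nearRegular-odd-odd m h<m with m≤n⇒∃[o]m+o≡n h<m
  ... | c , e = overlay circulant M ,
      (λ v → ≤-trans (degree-overlay-≤ circulant M v)
          (≤-trans (+-mono-≤ (≤-reflexive (deg v)) (degM v)) (≤-reflexive (+-comm (h + h) 1)))) ,
      (begin
        suc (h + h) * (m + m + 1) ≡⟨ eq₂ h m ⟩
        suc ((m + m + 1) * (h + h) + (m + m) * 1) ≤⟨ s≤s
            (+-mono-≤ (total≥ circulant (h + h) (λ v → ≤-reflexive (sym (deg v))))
            (≤-trans (total≥ (matching m) 1 λ v → ≤-reflexive (sym (degree-matching m v)))
                (≤-trans (m≤m+n _ _) (≤-reflexive (sym (totalDegree-⊎ (matching m) (empty 1))))))) ⟩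
        suc (totalDegree circulant + totalDegree M) ≡⟨ cong suc (∑-distrib-+ (degree circulant) (degree M)) ⟨
        suc (sum (λ v → degree circulant v + degree M v)) ≤⟨ s≤s (sum-mono (degree-overlay-≥ circulant M disj)) ⟩
        suc (totalDegree (overlay circulant M)) ∎)
    where
    open ≤-Reasoning
    open Circulant (m + m + 1) h
    M : Graph (m + m + 1)
    M = matching m ⊎ᵍ empty 1
    module D = Glue {m + m} {1} ∅ₓ (matching m) (empty 1)
    eq : ∀ h c → suc h + c + (suc h + c) + 1 ≡ suc h + (suc (suc (c + c)) + h)
    eq = solve-∀
    eq₂ : ∀ h m → suc (h + h) * (m + m + 1) ≡ suc ((m + m + 1) * (h + h) + (m + m) * 1)
    eq₂ = solve-∀
    deg : ∀ v → degree circulant v ≡ h + h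
    deg = degree-circulant {suc (suc (c + c))} (trans (cong₂ (λ x y → x + y + 1) (sym e) (sym e)) (eq h c))
    degM : ∀ v → degree M v ≤ 1
    degM v with split (m + m) v
    ... | left i = ≤-reflexive (trans (D.degree-left i) (trans (+-identityʳ _) (degree-matching m i)))
    ... | right j = ≤-trans (≤-reflexive (trans (D.degree-right j)
        (trans (+-identityʳ _) (sum-replicate-zero (m + m))))) z≤n
    distM : ∀ i j → adj M i j ≡ true → ∣ toℕ i - toℕ j ∣ ≡ m
    distM i j q with split (m + m) i | split (m + m) j
    ... | left x | left y = trans (cong₂ ∣_-_∣ (toℕ-↑ˡ x 1) (toℕ-↑ˡ y 1))
        (distance-matching m x y (trans (sym (D.adj-ll x y)) q))
    ... | left x | right y = contradiction (trans (sym (D.adj-lr x y)) q) λ ()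
    ... | right x | left y = contradiction (trans (sym (D.adj-rl x y)) q) λ ()
    ... | right x | right y = contradiction (trans (sym (D.adj-rr x y)) q) λ ()
    disj : ∀ i j → adj circulant i j ≡ true → adj M i j ≡ true → ⊥
    disj i j p q = short-middle {m + m + 1} h<m (inj₂ refl) (subst (λ z → short z ≡ true) (distM i j q) p)

half-< : ∀ {h m} → suc (h + h) ≤ m + m → h < m
half-< {h} {m} p with suc h ≤? m
... | yes q = q
... | no ¬q = contradiction p (<⇒≱ (s≤s (+-mono-≤ (s≤s⁻¹ (≰⇒> ¬q)) (s≤s⁻¹ (≰⇒> ¬q)))))

nearRegular : ∀ n k → k < n → NearRegular n k
nearRegular n k k<n with halve k | halve n
... | h , inj₁ refl | _ = nearRegular-even h k<n
... | h , inj₂ refl | m , inj₁ refl = nearRegular-odd-even h m (half-< (<⇒≤ k<n))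
... | h , inj₂ refl | m , inj₂ refl = subst (λ z → NearRegular z (suc (h + h))) (+-comm (m + m) 1)
    (nearRegular-odd-odd h m (half-< (s≤s⁻¹ k<n)))

-- Hybrid graphs

#-unique : ∀ {n} {A : VSet n} → (∀ v w → A ∋ v → A ∋ w → v ≡ w) → # A ≤ 1
#-unique {n} {A} unique with any? (λ v → A v Bool.≟ true)
... | yes (v , v∈A) = ≤-trans (#-mono {A = A} {⁅ v ⁆} λ w w∈A → subst (⁅ v ⁆ ∋_) (unique v w v∈A w∈A) (⁅⁆-intro v))
    (≤-reflexive (#-singleton v))
... | no ¬∃ = ≤-trans (≤-reflexive (#-empty {A = A} λ v v∈A → ¬∃ (v , v∈A))) z≤n

-- The core consists of `P` vertices adjacent to all of it and of the graph `R`; only vertices of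
-- `R` have neighbours, given by `X`, in the clique on `s` vertices. In use the core has `b + 2`
-- vertices, so the first kind has degree `b + 1`, and `R` is `k`-regular up to parity on `k + 4`
-- vertices: the complement of a near 3-regular graph.
module Hybrid (P t s : ℕ) (R : Graph t) (X : Fin t → Fin s → Bool) where
  private
    module Core = Glue (λ (_ : Fin P) (_ : Fin t) → true) (complete P) R

    lift : Fin P ⊎ Fin t → Fin s → Bool
    lift (inj₁ _) _ = false
    lift (inj₂ x) j = X x j

    cross : Fin (P + t) → Fin s → Bool
    cross i = lift (splitAt P i)

    module All = Glue cross Core.glue (complete s)

    cross-right : ∀ x j → cross (P ↑ʳ x) j ≡ X x j
    cross-right x j = cong (λ z → lift z j) (splitAt-↑ʳ P t x)

    cross-left : ∀ i j → cross (i ↑ˡ t) j ≡ false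
    cross-left i j = cong (λ z → lift z j) (splitAt-↑ˡ P i t)

    #cross-left : ∀ i → # (cross (i ↑ˡ t)) ≡ 0
    #cross-left i = trans (sum-cong-≗ λ j → cong ι (cross-left i j)) (sum-replicate-zero s)

    #cross-right : ∀ x → # (cross (P ↑ʳ x)) ≡ # (X x)
    #cross-right x = sum-cong-≗ λ j → cong ι (cross-right x j)

  hybrid : Graph (P + t + s)
  hybrid = All.glue

  totalDegree-hybrid : totalDegree hybrid ≡
    totalDegree (complete P) + totalDegree R + 2 * (P * t) + totalDegree (complete s) + 2 * sum (λ x → # (X x))
  totalDegree-hybrid = trans All.totalDegree-glue (cong₂ (λ x y → x + totalDegree (complete s) + 2 * y)
    (trans Core.totalDegree-glue (cong (λ z → totalDegree (complete P) + totalDegree R + 2 * z)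
      (trans (sum-cong-≗ {P} λ _ → #-full t) (sum-const P t))))
    (trans (sum-↑ P (λ i → # (cross i))) (cong₂ _+_ (trans (sum-cong-≗ #cross-left) (sum-replicate-zero P))
        (sum-cong-≗ #cross-right))))

  -- Only the `P` special vertices may exceed degree `b`. All neighbours of such a vertex lie in the
  -- core, and the core with the at most two outside neighbours of one core vertex `u` has at most
  -- `b + 4` vertices.
  hybrid-good : ∀ {b} → P + t ≡ b + 2 → (∀ x → degree R x + 2 + P ≤ b) → (∀ x → # (X x) ≤ 2) →
    (∀ j → # (λ x → X x j) + s ≤ suc b) → Good b hybrid
  hybrid-good {b} size R-deg row col u v e with split (P + t) v
  ... | right j = inj₁ (s≤s⁻¹ (begin
      suc (degree hybrid ((P + t) ↑ʳ j)) ≡⟨ cong suc (All.degree-right j) ⟩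
      suc (# (λ i → cross i j) + degree (complete s) j) ≡⟨ +-suc (# (λ i → cross i j)) _ ⟨
      # (λ i → cross i j) + suc (degree (complete s) j) ≡⟨ cong₂ _+_ columns (degree-complete j) ⟩
      # (λ x → X x j) + s ≤⟨ col j ⟩
      suc b ∎))
    where
    open ≤-Reasoning
    columns : # (λ i → cross i j) ≡ # (λ x → X x j)
    columns = trans (#-↑ P (λ i → cross i j)) (cong₂ _+_
      (trans (sum-cong-≗ λ i → cong ι (cross-left i j)) (sum-replicate-zero P))
          (sum-cong-≗ λ x → cong ι (cross-right x j)))
  ... | left v' with split P v'
  ... | right x = inj₁ (begin
      degree hybrid ((P ↑ʳ x) ↑ˡ s) ≡⟨ All.degree-left (P ↑ʳ x) ⟩
      degree Core.glue (P ↑ʳ x) + # (cross (P ↑ʳ x)) ≡⟨ cong₂ _+_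
          (trans (Core.degree-right x) (cong (_+ degree R x) (#-full P))) (#cross-right x) ⟩
      P + degree R x + # (X x) ≤⟨ +-monoʳ-≤ (P + degree R x) (row x) ⟩
      P + degree R x + 2 ≡⟨ eq P (degree R x) ⟩
      degree R x + 2 + P ≤⟨ R-deg x ⟩
      b ∎)
    where
    open ≤-Reasoning
    eq : ∀ p d → p + d + 2 ≡ d + 2 + p
    eq = solve-∀
  ... | left i with split (P + t) u
  ... | right j = contradiction (trans (sym (cross-left i j)) (trans (sym (All.adj-rl j (i ↑ˡ t))) e)) λ ()
  ... | left u' = inj₂ (Z , #Z , u⊆ , v⊆)
    where
    in? : Fin (P + t) ⊎ Fin s → Bool
    in? (inj₁ _) = true
    in? (inj₂ j) = cross u' j
    Z : VSet (P + t + s)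
    Z w = in? (splitAt (P + t) w)
    row≤2 : ∀ {u'} → Split P u' → # (cross u') ≤ 2
    row≤2 (left i)  = ≤-trans (≤-reflexive (#cross-left i)) z≤n
    row≤2 (right x) = ≤-trans (≤-reflexive (#cross-right x)) (row x)
    #Z : # Z ≤ b + 4
    #Z = begin
      # Z ≡⟨ #-↑ (P + t) Z ⟩
      # (λ i → Z (i ↑ˡ s)) + # (λ j → Z ((P + t) ↑ʳ j))
        ≡⟨ cong₂ _+_ (trans (sum-cong-≗ λ i → cong (ι ∘ in?) (splitAt-↑ˡ (P + t) i s)) (#-full (P + t)))
                     (sum-cong-≗ λ j → cong (ι ∘ in?) (splitAt-↑ʳ (P + t) s j)) ⟩
      P + t + # (cross u') ≤⟨ +-mono-≤ (≤-reflexive size) (row≤2 (split P u')) ⟩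
      b + 2 + 2 ≡⟨ +-assoc b 2 2 ⟩
      b + 4 ∎
      where open ≤-Reasoning
    u⊆ : adj hybrid (u' ↑ˡ s) ⊆ Z
    u⊆ w a with split (P + t) w
    ... | left x  = cong in? (splitAt-↑ˡ (P + t) x s)
    ... | right j = trans (cong in? (splitAt-↑ʳ (P + t) s j)) (trans (sym (All.adj-lr u' j)) a)
    v⊆ : adj hybrid ((i ↑ˡ t) ↑ˡ s) ⊆ Z
    v⊆ w a with split (P + t) w
    ... | left x  = cong in? (splitAt-↑ˡ (P + t) x s)
    ... | right j = contradiction (trans (sym (cross-left i j)) (trans (sym (All.adj-lr (i ↑ˡ t) j)) a)) λ ()

module TwoMatchings {t s : ℕ} (α β : Fin t → Fin s) (α≢β : ∀ x → α x ≢ β x) where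
  cross₂ : Fin t → Fin s → Bool
  cross₂ x j = ⁅ α x ⁆ j ∨ ⁅ β x ⁆ j

  row₂ : ∀ x → # (cross₂ x) ≡ 2
  row₂ x = ≤-antisym
    (≤-trans (#-cover {A = cross₂ x} {⁅ α x ⁆} {⁅ β x ⁆} λ j → ∨-true) (≤-reflexive singletons))
    (≤-trans (≤-reflexive (sym singletons)) (#-pack {A = ⁅ α x ⁆} {⁅ β x ⁆} {cross₂ x} (λ j → ∨-introˡ)
        (λ j → ∨-introʳ {⁅ α x ⁆ j})
      λ j p q → α≢β x (trans (sym (⁅⁆-elim p)) (⁅⁆-elim q))))
    where
    singletons : # ⁅ α x ⁆ + # ⁅ β x ⁆ ≡ 2
    singletons = cong₂ _+_ (#-singleton (α x)) (#-singleton (β x))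

  fibre : (f : Fin t → Fin s) → Injective _≡_ _≡_ f → ∀ j → # (λ x → ⁅ f x ⁆ j) ≤ 1
  fibre f inj j = #-unique {A = λ x → ⁅ f x ⁆ j} λ x y p q → inj (trans (sym (⁅⁆-elim p)) (⁅⁆-elim q))

  col₂ : Injective _≡_ _≡_ α → Injective _≡_ _≡_ β → ∀ j → # (λ x → cross₂ x j) ≤ 2
  col₂ α-inj β-inj j = ≤-trans (#-cover {A = λ x → cross₂ x j} {λ x → ⁅ α x ⁆ j} {λ x → ⁅ β x ⁆ j} λ x → ∨-true)
    (+-mono-≤ (fibre α α-inj j) (fibre β β-inj j))

  col₁ : Injective _≡_ _≡_ α → Injective _≡_ _≡_ β → (∀ x y → α x ≢ β y) → ∀ j → # (λ x → cross₂ x j) ≤ 1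
  col₁ α-inj β-inj disj j = #-unique {A = λ x → cross₂ x j} unique
    where
    unique : ∀ x y → cross₂ x j ≡ true → cross₂ y j ≡ true → x ≡ y
    unique x y p q with ∨-true {⁅ α x ⁆ j} p | ∨-true {⁅ α y ⁆ j} q
    ... | inj₁ a | inj₁ c = α-inj (trans (sym (⁅⁆-elim a)) (⁅⁆-elim c))
    ... | inj₂ a | inj₂ c = β-inj (trans (sym (⁅⁆-elim a)) (⁅⁆-elim c))
    ... | inj₁ a | inj₂ c = contradiction (trans (sym (⁅⁆-elim a)) (⁅⁆-elim c)) (disj x y)
    ... | inj₂ a | inj₁ c = contradiction (trans (sym (⁅⁆-elim c)) (⁅⁆-elim a)) (disj y x)

-- Degree sums attained by the constructions

Attains : ℕ → ℕ → ℕ → Set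
Attains b n d = Σ (Graph n) λ G → Good b G × d ≤ totalDegree G

attains-block : ∀ {b n d} → Attains b n d → Attains b (b + 4 + n) (totalDegree (complete (b + 4)) + d)
attains-block {b} (G , good , d≤) = complete (b + 4) ⊎ᵍ G , good-⊎ {G = complete (b + 4)} {G}
    (small⇒good {G = complete (b + 4)} ≤-refl) good ,
  ≤-trans (+-monoʳ-≤ _ d≤) (≤-reflexive (sym (totalDegree-⊎ (complete (b + 4)) G)))

attains-clique : ∀ {b q} → q ≤ b + 4 → Attains b q (totalDegree (complete q))
attains-clique {q = q} h = complete q , small⇒good {G = complete q} h , ≤-refl

attains-regular : ∀ {b n} → b < n → Attains b n (b * n ∸ 1)
attains-regular {b} {n} h with nearRegular n b h
... | G , deg≤ , total = G , bounded⇒good {G = G} deg≤ , m≤n+o⇒m∸n≤o _ 1 total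

rotate : ∀ {m} → Fin (suc m) → Fin (suc m)
rotate {m} zero = fromℕ m
rotate (suc i)  = inject₁ i

rotate-injective : ∀ {m} → Injective _≡_ _≡_ (rotate {m})
rotate-injective {x = zero}  {zero}  e = refl
rotate-injective {x = zero}  {suc j} e = contradiction e fromℕ≢inject₁
rotate-injective {x = suc i} {zero}  e = contradiction (sym e) fromℕ≢inject₁
rotate-injective {x = suc i} {suc j} e = cong suc (inject₁-injective e)

rotate-fixed-free : ∀ {m} (i : Fin (suc (suc m))) → i ≢ rotate i
rotate-fixed-free (suc i) e = inject₁≢suc i (sym e)
  where
  inject₁≢suc : ∀ {m} (i : Fin m) → inject₁ i ≢ suc i
  inject₁≢suc (suc i) e = inject₁≢suc i (fsuc-injective e)

-- The second clique has `b - 1` vertices of degree `b - 2`, each with room for two crossing edges.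
-- The identity and a rotation without fixed points use all this room with `b - 1` core vertices,
-- which leaves `P = 3` of degree `b + 1`. They would add 3 to `b * (2 * b + 1)`; one unit is
-- reserved for the parity of `R`.
attains-double-cross : ∀ k → let b = k + 5 in Attains b (3 + (k + 4) + (k + 4)) (b * (2 * b + 1) + 2)
attains-double-cross k with nearRegular (k + 4) k (≤-trans (m≤m+n (suc k) 3) (≤-reflexive (sym (+-suc k 3))))
... | R , deg≤ , total = hybrid ,
    hybrid-good (eq₁ k) (λ x → ≤-trans (+-monoˡ-≤ 3 (+-monoˡ-≤ 2 (deg≤ x))) (≤-reflexive (eq₂ k)))
      (λ x → ≤-reflexive (row₂ x)) (λ j → ≤-trans (+-monoˡ-≤ (k + 4) (col₂ (λ e → e) ρ-injective j))
          (≤-reflexive (eq₃ k))) ,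
    linear (k * (k + 4) + (k + 4) * (k + 4)) (suc (totalDegree R) + (totalDegree (complete (k + 4)) + (k + 4))) 0
      (+-mono-≤ total (≤-reflexive (sym (totalDegree-complete (k + 4)))))
      (trans (eq k (totalDegree R) (totalDegree (complete (k + 4)))) (cong (_+ (k * (k + 4) + (k + 4) * (k + 4)))
        (sym (trans totalDegree-hybrid (cong₂ (λ x y → x + totalDegree R + 2 * (3 * (k + 4)) + totalDegree
            (complete (k + 4)) + 2 * y)
          {totalDegree (complete 3)} {6} refl (trans (sum-cong-≗ row₂) (sum-const (k + 4) 2)))))))
  where
  ρ : Fin (k + 4) → Fin (k + 4)
  ρ = subst (λ m → Fin m → Fin m) (+-comm 4 k) rotate
  ρ-injective : Injective _≡_ _≡_ ρ
  ρ-injective = substituted (+-comm 4 k)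
    where
    substituted : ∀ {m} (e : 4 + k ≡ m) → Injective _≡_ _≡_ (subst (λ m → Fin m → Fin m) e rotate)
    substituted refl = rotate-injective
  ρ-fixed-free : ∀ i → i ≢ ρ i
  ρ-fixed-free = substituted (+-comm 4 k)
    where
    substituted : ∀ {m} (e : 4 + k ≡ m) i → i ≢ subst (λ m → Fin m → Fin m) e rotate i
    substituted refl = rotate-fixed-free
  open TwoMatchings (λ i → i) ρ ρ-fixed-free
  open Hybrid 3 (k + 4) (k + 4) R cross₂
  eq₁ : ∀ k → 3 + (k + 4) ≡ k + 5 + 2
  eq₁ = solve-∀
  eq₂ : ∀ k → k + 2 + 3 ≡ k + 5
  eq₂ = solve-∀
  eq₃ : ∀ k → 2 + (k + 4) ≡ suc (k + 5)
  eq₃ = solve-∀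
  eq : ∀ k r c → (k + 5) * (2 * (k + 5) + 1) + 2 + (suc r + (c + (k + 4))) + 0
    ≡ 6 + r + 2 * (3 * (k + 4)) + c + 2 * ((k + 4) * 2) + (k * (k + 4) + (k + 4) * (k + 4))
  eq = solve-∀

-- Now the second clique has `b` vertices of degree `b - 1`, with room for one crossing edge each,
-- so the images of `α` and `β` must be disjoint and at most half of `b` core vertices can be
-- served. The `h' + 2` core vertices of degree `b + 1`, less the `h' - h` clique vertices left at
-- `b - 1`, contribute `2 + h`; again one unit is given up to parity.
attains-single-cross : ∀ k h' → k + 4 ≤ h' → let h = k + 4; b = h + h' in
  Attains b (h' + 2 + h + b) (b * (2 * b + 2) + 1 + h)
attains-single-cross k h' h≤h' with nearRegular (k + 4) k (≤-trans (m≤m+n (suc k) 3) (≤-reflexive (sym (+-suc k 3))))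
... | R , deg≤ , total = hybrid ,
    hybrid-good (eq₁ k h') (λ x → ≤-trans (+-monoˡ-≤ (h' + 2) (+-monoˡ-≤ 2 (deg≤ x))) (≤-reflexive (eq₂ k h')))
      (λ x → ≤-reflexive (row₂ x))
      (λ j → +-monoˡ-≤ b (col₁ (λ {x} {y} → ↑ˡ-injective h' x y)
          (λ {x} {y} e → inject≤-injective h≤h' h≤h' x y (↑ʳ-injective h _ _ e)) disjoint j)) ,
    linear (k * h + P * P + b * b)
      (suc (totalDegree R) + (totalDegree (complete P) + P) + (totalDegree (complete b) + b)) 0
      (+-mono-≤ (+-mono-≤ total (≤-reflexive (sym (totalDegree-complete P))))
          (≤-reflexive (sym (totalDegree-complete b))))
      (trans (eq k h' (totalDegree R) (totalDegree (complete P)) (totalDegree (complete b)))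
        (cong (_+ (k * h + P * P + b * b)) (sym (trans totalDegree-hybrid
          (cong (λ y → totalDegree (complete P) + totalDegree R + 2 * (P * h) + totalDegree (complete b) + 2 * y)
            (trans (sum-cong-≗ row₂) (sum-const h 2)))))))
  where
  h = k + 4
  b = h + h'
  P = h' + 2
  α β : Fin h → Fin (h + h')
  α i = i ↑ˡ h'
  β i = h ↑ʳ inject≤ i h≤h'
  disjoint : ∀ x y → α x ≢ β y
  disjoint x y e with trans (sym (splitAt-↑ˡ h x h')) (trans (cong (splitAt h) e) (splitAt-↑ʳ h h' (inject≤ y h≤h')))
  ... | ()
  open TwoMatchings α β (λ x → disjoint x x)
  open Hybrid P h b R cross₂
  eq₁ : ∀ k h' → h' + 2 + (k + 4) ≡ k + 4 + h' + 2
  eq₁ = solve-∀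
  eq₂ : ∀ k h' → k + 2 + (h' + 2) ≡ k + 4 + h'
  eq₂ = solve-∀
  eq : ∀ k h' r c d → (k + 4 + h') * (2 * (k + 4 + h') + 2) + 1 + (k + 4) +
      (suc r + (c + (h' + 2)) + (d + (k + 4 + h'))) + 0
    ≡ c + r + 2 * ((h' + 2) * (k + 4)) + d + 2 * ((k + 4) * 2) +
        (k * (k + 4) + (h' + 2) * (h' + 2) + (k + 4 + h') * (k + 4 + h'))
  eq = solve-∀

-- Comparison with the formula

nC2 : ∀ n → 2 * (n choose 2) + n ≡ n * n
nC2 zero    = refl
nC2 (suc n) = begin
  2 * (suc n choose 2) + suc n       ≡⟨ cong (λ z → 2 * z + suc n) (nCk+nC[k+1]≡[n+1]C[k+1] n 1) ⟨
  2 * (n choose 1 + n choose 2) + suc n   ≡⟨ cong (λ z → 2 * (z + n choose 2) + suc n) (nC1≡n n) ⟩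
  2 * (n + n choose 2) + suc n       ≡⟨ eq₁ n (n choose 2) ⟩
  2 * (n choose 2) + n + (2 * n + 1) ≡⟨ cong (_+ (2 * n + 1)) (nC2 n) ⟩
  n * n + (2 * n + 1)           ≡⟨ eq₂ n ⟩
  suc n * suc n                 ∎
  where
  open ≡-Reasoning
  eq₁ : ∀ n c → 2 * (n + c) + suc n ≡ 2 * c + n + (2 * n + 1)
  eq₁ = solve-∀
  eq₂ : ∀ n → n * n + (2 * n + 1) ≡ suc n * suc n
  eq₂ = solve-∀

totalDegree-complete-C : ∀ n → totalDegree (complete n) ≡ 2 * (n choose 2)
totalDegree-complete-C n = +-cancelʳ-≡ n _ _ (trans (totalDegree-complete n) (sym (nC2 n)))

degSum-totalDegree : ∀ {n} (G : Graph n) → Neighbourhoods.degSum G (λ _ → true) ≡ totalDegree G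
degSum-totalDegree G = sum-cong-≗ λ v → +-identityʳ (degree G v)

-- Reduces the comparison with the formula to `p = 1`, and so to finitely many `q` for each `b`.
exS3b-blocks : ∀ b p q → exS3b b (suc p) q ≡ p * ((b + 4) choose 2) + exS3b b 1 q
exS3b-blocks b p q with case1 b q
... | true = refl
... | false with case2 b q
... | true = refl
... | false with case3 b q
... | true = refl
... | false = eq p ((b + 4) choose 2) (q choose 2)
  where
  eq : ∀ p c d → suc p * c + d ≡ p * c + (1 * c + d)
  eq = solve-∀

-- The + 1 pays for the floor in exS3b; it is harmless since degree sums are even.
Tight : ℕ → ℕ → Set
Tight b q = (b + 3) * (b + 4 + q) ≤ 2 * exS3b b 1 q + 1 + q * (b + 4 ∸ q)
          × (b + 3) * (b + 4 + q) ≤ 2 * exS3b b 1 q + 1 + gap b q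

tight? : ∀ b q → Dec (Tight b q)
tight? b q = (_ ≤? _) ×-dec (_ ≤? _)

-- No threshold of the formula exceeds 34. Below it the claim is evaluated: 30 values of `b`
-- starting at 4, and for each the `b + 4` values of `q`.
tight-small : ∀ {b q} → 3 < b → b < 34 → q ≤ b + 3 → Tight b q
tight-small {b} {q} 3<b b<34 q≤ with m≤n⇒∃[o]m+o≡n 3<b
... | c , refl = subst (λ z → Tight (4 + z) q) c≡
  (subst (Tight (4 + toℕ c')) (toℕ-fromℕ< q<) (table c' (fromℕ< q<)))
  where
  table : ∀ (c : Fin 30) (q : Fin (8 + toℕ c)) → Tight (4 + toℕ c) (toℕ q)
  table = from-yes (all? {30} λ c → all? {8 + toℕ c} λ q → tight? (4 + toℕ c) (toℕ q))
  c< : c < 30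
  c< = s≤s⁻¹ (s≤s⁻¹ (s≤s⁻¹ (s≤s⁻¹ b<34)))
  c' = fromℕ< c<
  c≡ : toℕ c' ≡ c
  c≡ = toℕ-fromℕ< c<
  q< : q < 8 + toℕ c'
  q< = ≤-trans (s≤s q≤) (≤-reflexive (trans (cong (λ z → 5 + z) (+-comm c 3)) (cong (8 +_) (sym c≡))))

case1-elim : ∀ {b q} → 34 ≤ b → case1 b q ≡ true → 4 ≤ q × q + 4 ≤ b
case1-elim {b} {q} 34≤b h with ∨-true {(24 ≤ᵇ b) ∧ (4 ≤ᵇ q) ∧ (q ≤ᵇ b ∸ 4)} h
... | inj₁ h₁ = 4≤q , ≤-trans (+-monoˡ-≤ 4 q≤) (≤-reflexive (m∸n+n≡m (≤-trans (m≤m+n 4 30) 34≤b)))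
  where
  4≤q : 4 ≤ q
  4≤q = ≤ᵇ-true⁻ {4} {q} (proj₁ (∧-true {4 ≤ᵇ q} (proj₂ (∧-true {24 ≤ᵇ b} h₁))))
  q≤ : q ≤ b ∸ 4
  q≤ = ≤ᵇ-true⁻ {q} {b ∸ 4} (proj₂ (∧-true {4 ≤ᵇ q} (proj₂ (∧-true {24 ≤ᵇ b} h₁))))
... | inj₂ h₂ with ∨-true {(16 ≤ᵇ b) ∧ (b ≤ᵇ 23) ∧ (5 ≤ᵇ q) ∧ (q ≤ᵇ b ∸ 4)} h₂
... | inj₁ h₃ = contradiction (≤-trans 34≤b (≤ᵇ-true⁻ {b} {23}
    (proj₁ (∧-true {b ≤ᵇ 23} (proj₂ (∧-true {16 ≤ᵇ b} h₃)))))) (<⇒≱ (m≤m+n 24 10))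
... | inj₂ h₃ = contradiction (≤-trans 34≤b (≤ᵇ-true⁻ {b} {15}
    (proj₁ (∧-true {b ≤ᵇ 15} (proj₂ (∧-true {14 ≤ᵇ b} h₃)))))) (<⇒≱ (m≤m+n 16 18))

case1-intro : ∀ {b q} → 34 ≤ b → 4 ≤ q → q + 4 ≤ b → case1 b q ≡ true
case1-intro {b} {q} 34≤b 4≤q q+4≤b = ∨-introˡ (∧-intro (≤ᵇ-true {24} (≤-trans (m≤m+n 24 10) 34≤b))
  (∧-intro (≤ᵇ-true {4} 4≤q) (≤ᵇ-true {q} {b ∸ 4} (m+n≤o⇒m≤o∸n q q+4≤b))))

case2-elim : ∀ {b q} → case2 b q ≡ true → 22 ≤ b × q + 3 ≡ b
case2-elim {b} {q} h with ∧-true {22 ≤ᵇ b} h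
... | l , r = 22≤b , trans (cong (_+ 3) (≡ᵇ-true⁻ {q} r)) (m∸n+n≡m (≤-trans (s≤s (s≤s (s≤s z≤n))) 22≤b))
  where 22≤b = ≤ᵇ-true⁻ l

case2-intro : ∀ {b q} → 22 ≤ b → q + 3 ≡ b → case2 b q ≡ true
case2-intro {b} {q} h refl = ∧-intro (≤ᵇ-true h) (≡ᵇ-true (sym (m+n∸n≡m q 3)))

case3-elim : ∀ {b q} → case3 b q ≡ true → 34 ≤ b × q + 2 ≡ b
case3-elim {b} {q} h with ∧-true {34 ≤ᵇ b} h
... | l , r = 34≤b , trans (cong (_+ 2) (≡ᵇ-true⁻ {q} r)) (m∸n+n≡m (≤-trans (s≤s (s≤s z≤n)) 34≤b))
  where 34≤b = ≤ᵇ-true⁻ l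

case3-intro : ∀ {b q} → 34 ≤ b → q + 2 ≡ b → case3 b q ≡ true
case3-intro {b} {q} h refl = ∧-intro (≤ᵇ-true h) (≡ᵇ-true (sym (m+n∸n≡m q 2)))

exS3b-case1 : ∀ {b q} → case1 b q ≡ true → exS3b b 1 q ≡ (b * (b + 4 + q)) / 2
exS3b-case1 e rewrite e = refl

exS3b-case2 : ∀ {b q} → case1 b q ≡ false → case2 b q ≡ true → exS3b b 1 q ≡ (b * (2 * b + 1) + 3) / 2
exS3b-case2 e₁ e₂ rewrite e₁ | e₂ = refl

exS3b-case3 : ∀ {b q} → case1 b q ≡ false → case2 b q ≡ false → case3 b q ≡ true →
  exS3b b 1 q ≡ (b * (2 * b + 2) + 2 + b / 2) / 2
exS3b-case3 e₁ e₂ e₃ rewrite e₁ | e₂ | e₃ = refl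

exS3b-otherwise : ∀ {b q} → case1 b q ≡ false → case2 b q ≡ false → case3 b q ≡ false →
  exS3b b 1 q ≡ 1 * ((b + 4) choose 2) + q choose 2
exS3b-otherwise e₁ e₂ e₃ rewrite e₁ | e₂ | e₃ = refl

2*/2 : ∀ x → 2 * (x / 2) ≤ x
2*/2 x = ≤-trans (≤-reflexive (*-comm 2 (x / 2))) (m/n*n≤m x 2)

gap-otherwise : ∀ {b q} → q + 3 ≢ b → q + 2 ≢ b → gap b q ≡ 3 * (b + 4 + q)
gap-otherwise h₃ h₂ rewrite ≡ᵇ-false h₃ | ≡ᵇ-false h₂ = refl

tight-value : ∀ {b q} Y → exS3b b 1 q ≡ Y / 2 →
  (b + 3) * (b + 4 + q) ≤ Y + q * (b + 4 ∸ q) → (b + 3) * (b + 4 + q) ≤ Y + gap b q → Tight b q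
tight-value {b} {q} Y e hc hg = ≤-trans hc (+-monoˡ-≤ _ Y≤) , ≤-trans hg (+-monoˡ-≤ _ Y≤)
  where
  Y≤ : Y ≤ 2 * exS3b b 1 q + 1
  Y≤ = ≤-trans (≤-half+ Y) (≤-reflexive (cong (λ z → 2 * z + 1) (sym e)))

-- In the last case the formula is the edge count of disjoint cliques, so the clique term fits by
-- construction and only the comparison of the two terms is left.
tight-otherwise : ∀ {b q} → case1 b q ≡ false → case2 b q ≡ false → case3 b q ≡ false →
  q ≤ b + 3 → q * (b + 4 ∸ q) ≤ gap b q → Tight b q
tight-otherwise {b} {q} e₁ e₂ e₃ q≤ f≤g = hc , ≤-trans hc (+-monoʳ-≤ _ f≤g)
  where
  z = b + 4 ∸ q
  c = (b + 4) choose 2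
  d = q choose 2
  eq : ∀ b q z c d → (b + 3) * (b + 4 + q) + (2 * c + (b + 4) + (2 * d + q) + q * (q + z)) + 1
    ≡ 2 * (1 * c + d) + 1 + q * z + ((b + 4) * (b + 4) + q * q + q * (b + 4))
  eq = solve-∀
  hc : (b + 3) * (b + 4 + q) ≤ 2 * exS3b b 1 q + 1 + q * z
  hc = subst (λ h → (b + 3) * (b + 4 + q) ≤ 2 * h + 1 + q * z) (sym (exS3b-otherwise {b} {q} e₁ e₂ e₃))
    (linear ((b + 4) * (b + 4) + q * q + q * (b + 4)) (2 * c + (b + 4) + (2 * d + q) + q * (q + z)) 1
      (+-mono-≤ (+-mono-≤ (≤-reflexive (sym (nC2 (b + 4)))) (≤-reflexive (sym (nC2 q))))
          (≤-reflexive (cong (q *_) (sym (complement q≤)))))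
      (eq b q z c d))

module _ {b : ℕ} (34≤b : 34 ≤ b) where
  case1-false : ∀ {q} → ¬ (4 ≤ q × q + 4 ≤ b) → case1 b q ≡ false
  case1-false {q} h = ¬-not λ e → h (case1-elim 34≤b e)

  case2-false : ∀ {q} → q + 3 ≢ b → case2 b q ≡ false
  case2-false {q} h = ¬-not λ e → h (proj₂ (case2-elim {b} {q} e))

  case3-false : ∀ {q} → q + 2 ≢ b → case3 b q ≡ false
  case3-false {q} h = ¬-not λ e → h (proj₂ (case3-elim {b} {q} e))

-- The two sides differ by `t + x * t + 2 * x - 16`. Either `t` alone suffices, or `t` is small and
-- `34 ≤ b` makes `x` large.
tight-middle : ∀ x t → 34 ≤ 4 + x + 4 + t → let q = 4 + x; b = q + 4 + t in
  q * (b + 4 ∸ q) ≥ 3 * (b + 4 + q)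
tight-middle x t h = subst (λ z → 3 * (4 + x + 4 + t + 4 + (4 + x)) ≤ (4 + x) * z) (sym z≡) (cases (19 ≤? t))
  where
  z≡ : 4 + x + 4 + t + 4 ∸ (4 + x) ≡ t + 8
  z≡ = trans (cong (_∸ (4 + x)) (lem (4 + x) t)) (m+n∸m≡n (4 + x) (t + 8))
    where
    lem : ∀ q t → q + 4 + t + 4 ≡ q + (t + 8)
    lem = solve-∀
  cases : Dec (19 ≤ t) → 3 * (4 + x + 4 + t + 4 + (4 + x)) ≤ (4 + x) * (t + 8)
  cases (yes p) = linear 19 t (x * t + 2 * x + 3) p (eq x t)
    where
    eq : ∀ x t → 3 * (4 + x + 4 + t + 4 + (4 + x)) + t + (x * t + 2 * x + 3) ≡ (4 + x) * (t + 8) + 19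
    eq = solve-∀
  cases (no ¬p) = linear (34 + 34 + suc t) (4 + x + 4 + t + (4 + x + 4 + t) + 19) (x * t + 18)
      (+-mono-≤ (+-mono-≤ h h) (≰⇒> ¬p)) (eq x t)
    where
    eq : ∀ x t → 3 * (4 + x + 4 + t + 4 + (4 + x)) + (4 + x + 4 + t + (4 + x + 4 + t) + 19) + (x * t + 18) ≡
        (4 + x) * (t + 8) + (34 + 34 + suc t)
    eq = solve-∀

clique≤gap-top : ∀ {b q} i → i ≤ 4 → suc q ≡ b + i → q ≤ b + 3 → q * (b + 4 ∸ q) ≤ 3 * (b + 4 + q)
clique≤gap-top {b} {q} i i≤ e q≤ = begin
  q * (b + 4 ∸ q)  ≤⟨ *-monoʳ-≤ q (m≤n+o⇒m∸n≤o (b + 4) q (≤-trans (m≤m+n (b + 4) i) (≤-reflexive (lem b q i e)))) ⟩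
  q * 5            ≤⟨ linear (q + q) (b + 3 + (b + 3)) (b + 6) (+-mono-≤ q≤ q≤) (eq b q) ⟩
  3 * (b + 4 + q)  ∎
  where
  open ≤-Reasoning
  lem : ∀ b q i → suc q ≡ b + i → b + 4 + i ≡ q + 5
  lem b q i e = trans (lem₁ b i) (trans (cong (4 +_) (sym e)) (lem₂ q))
    where
    lem₁ : ∀ b i → b + 4 + i ≡ 4 + (b + i)
    lem₁ = solve-∀
    lem₂ : ∀ q → 4 + suc q ≡ q + 5
    lem₂ = solve-∀
  eq : ∀ b q → q * 5 + (b + 3 + (b + 3)) + (b + 6) ≡ 3 * (b + 4 + q) + (q + q)
  eq = solve-∀

tight-large : ∀ {b q} → 34 ≤ b → q ≤ b + 3 → Tight b q
tight-large {b} {q} 34≤b q≤ with position b q q≤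
... | at-top i i≤ e = tight-otherwise {b} {q}
    (case1-false 34≤b λ p → above 2 (proj₂ p)) (case2-false 34≤b λ p → above 1 (≤-reflexive p))
        (case3-false 34≤b λ p → above 0 (≤-reflexive p)) q≤
    (≤-trans (clique≤gap-top i i≤ e q≤) (≤-reflexive
        (sym (gap-otherwise {b} {q} (λ p → above 1 (≤-reflexive p)) (λ p → above 0 (≤-reflexive p))))))
  where
  above : ∀ k → ¬ (q + suc (suc k) ≤ b)
  above k h = <⇒≱ (≤-trans (≤-trans (m≤m+n (suc (suc q)) k)
      (≤-reflexive (sym (trans (+-suc q (suc k)) (cong suc (+-suc q k)))))) h)
    (≤-trans (m≤m+n b i) (≤-reflexive (sym e)))
... | at-b∸2 e = tight-value {b} {q} Y
    (exS3b-case3 {b} {q} (case1-false 34≤b λ p → <⇒≱ (+-monoʳ-< q (m≤m+n 3 1))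
        (≤-trans (proj₂ p) (≤-reflexive (sym e))))
      (case2-false 34≤b λ p → 1+n≢n (trans (sym (+-suc q 2)) (trans p (sym e)))) (case3-intro 34≤b e))
    (begin
      -- The clique term exceeds the deficiency of the hybrid by `b / 2 - 16`.
      (b + 3) * (b + 4 + q)  ≤⟨ linear 17 (b / 2) 1 (half-≤ {17} (≤-trans 34≤b (≤-half+ b))) (eq₁ (b / 2) e) ⟩
      Y + q * 6              ≡⟨ cong (λ z → Y + q * z) z≡ ⟨
      Y + q * (b + 4 ∸ q)    ∎)
    (begin
      (b + 3) * (b + 4 + q)                              ≡⟨ eq₂ e ⟩
      b * (2 * b + 2) + 2 + (6 * b + 4)                  ≤⟨ +-monoʳ-≤ (b * (2 * b + 2) + 2)
          (m≤n+m∸n (6 * b + 4) (b / 2)) ⟩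
      b * (2 * b + 2) + 2 + (b / 2 + (6 * b + 4 ∸ b / 2)) ≡⟨ +-assoc (b * (2 * b + 2) + 2) (b / 2) _ ⟨
      Y + (6 * b + 4 ∸ b / 2)                            ≡⟨ cong (Y +_) (gap-2 e) ⟨
      Y + gap b q                                        ∎)
  where
  open ≤-Reasoning
  Y = b * (2 * b + 2) + 2 + b / 2
  z≡ : b + 4 ∸ q ≡ 6
  z≡ = trans (cong (λ z → z + 4 ∸ q) (sym e)) (trans (cong (_∸ q) (+-assoc q 2 4)) (m+n∸m≡n q 6))
  eq₁ : ∀ h → q + 2 ≡ b → (b + 3) * (b + 4 + q) + h + 1 ≡ b * (2 * b + 2) + 2 + h + q * 6 + 17
  eq₁ h refl = lem q h
    where
    lem : ∀ q h → (q + 2 + 3) * (q + 2 + 4 + q) + h + 1 ≡ (q + 2) * (2 * (q + 2) + 2) + 2 + h + q * 6 + 17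
    lem = solve-∀
  eq₂ : q + 2 ≡ b → (b + 3) * (b + 4 + q) ≡ b * (2 * b + 2) + 2 + (6 * b + 4)
  eq₂ refl = lem q
    where
    lem : ∀ q → (q + 2 + 3) * (q + 2 + 4 + q) ≡ (q + 2) * (2 * (q + 2) + 2) + 2 + (6 * (q + 2) + 4)
    lem = solve-∀
... | at-b∸3 e = tight-value {b} {q} Y
    (exS3b-case2 {b} {q} (case1-false 34≤b λ p → <⇒≱ (+-monoʳ-< q (m≤m+n 4 0))
        (≤-trans (proj₂ p) (≤-reflexive (sym e))))
      (case2-intro (≤-trans (m≤m+n 22 12) 34≤b) e))
    (begin
      -- Here the clique term is ahead by `b - 21`.
      (b + 3) * (b + 4 + q)  ≤⟨ linear 34 b 13 34≤b (eq₁ e) ⟩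
      Y + q * 7              ≡⟨ cong (λ z → Y + q * z) z≡ ⟨
      Y + q * (b + 4 ∸ q)    ∎)
    (≤-reflexive (trans (eq₂ e) (cong (Y +_) (sym (gap-3 e)))))
  where
  open ≤-Reasoning
  Y = b * (2 * b + 1) + 3
  z≡ : b + 4 ∸ q ≡ 7
  z≡ = trans (cong (λ z → z + 4 ∸ q) (sym e)) (trans (cong (_∸ q) (+-assoc q 3 4)) (m+n∸m≡n q 7))
  eq₁ : q + 3 ≡ b → (b + 3) * (b + 4 + q) + b + 13 ≡ b * (2 * b + 1) + 3 + q * 7 + 34
  eq₁ refl = lem q
    where
    lem : ∀ q → (q + 3 + 3) * (q + 3 + 4 + q) + (q + 3) + 13 ≡ (q + 3) * (2 * (q + 3) + 1) + 3 + q * 7 + 34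
    lem = solve-∀
  eq₂ : q + 3 ≡ b → (b + 3) * (b + 4 + q) ≡ b * (2 * b + 1) + 3 + 6 * b
  eq₂ refl = lem q
    where
    lem : ∀ q → (q + 3 + 3) * (q + 3 + 4 + q) ≡ (q + 3) * (2 * (q + 3) + 1) + 3 + 6 * (q + 3)
    lem = solve-∀
... | at-low t e = cases (4 ≤? q)
  where
  below : ∀ k → suc k ≤ 4 → q + k ≢ b
  below k k< p = <⇒≢ (≤-trans (≤-reflexive (sym (+-suc q k)))
      (≤-trans (+-monoʳ-≤ q k<) (≤-trans (m≤m+n (q + 4) t) (≤-reflexive (sym e))))) p
  gap≡ : gap b q ≡ 3 * (b + 4 + q)
  gap≡ = gap-otherwise {b} {q} (below 3 ≤-refl) (below 2 (n≤1+n 3))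
  cases : Dec (4 ≤ q) → Tight b q
  cases (no ¬p) = tight-otherwise {b} {q} (case1-false 34≤b λ p → ¬p (proj₁ p))
      (case2-false 34≤b (below 3 ≤-refl)) (case3-false 34≤b (below 2 (n≤1+n 3))) q≤
    (begin
      q * (b + 4 ∸ q)  ≤⟨ *-mono-≤ (s≤s⁻¹ (≰⇒> ¬p)) (m∸n≤m (b + 4) q) ⟩
      3 * (b + 4)      ≤⟨ *-monoʳ-≤ 3 (m≤m+n (b + 4) q) ⟩
      3 * (b + 4 + q)  ≡⟨ gap≡ ⟨
      gap b q          ∎)
    where open ≤-Reasoning
  cases (yes p) = tight-value {b} {q} (b * (b + 4 + q))
    (exS3b-case1 {b} {q} (case1-intro 34≤b p (≤-trans (m≤m+n (q + 4) t) (≤-reflexive (sym e)))))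
    (≤-trans (≤-reflexive (eq b q)) (+-monoʳ-≤ (b * (b + 4 + q)) (middle (m≤n⇒∃[o]m+o≡n p))))
    (≤-reflexive (trans (eq b q) (cong (b * (b + 4 + q) +_) (sym gap≡))))
    where
    eq : ∀ b q → (b + 3) * (b + 4 + q) ≡ b * (b + 4 + q) + 3 * (b + 4 + q)
    eq = solve-∀
    middle : (∃ λ x → 4 + x ≡ q) → 3 * (b + 4 + q) ≤ q * (b + 4 ∸ q)
    middle (x , refl) = subst (λ c → 3 * (c + 4 + (4 + x)) ≤ (4 + x) * (c + 4 ∸ (4 + x))) (sym e)
      (tight-middle x t (≤-trans 34≤b (≤-reflexive e)))

tight : ∀ {b q} → 3 < b → q ≤ b + 3 → Tight b q
tight {b} 3<b q≤ with 34 ≤? b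
... | yes h = tight-large h q≤
... | no ¬h = tight-small 3<b (≰⇒> ¬h) q≤

-- The Turán number

edgeCount-≤ : ∀ {n b q} p (G : Graph n) → 3 < b → n ≡ suc p * (b + 4) + q → q ≤ b + 3 →
  (G -free) (doubleStar 3 b) → edgeCount G ≤ exS3b b (suc p) q
edgeCount-≤ {n} {b} {q} p G 3<b n≡ q≤ free = half-≤ (from-bound (upper-bound G b (suc p) q 3<b n≡ q≤ free))
  where
  S = Neighbourhoods.degSum G (λ _ → true)
  c = (b + 4) choose 2
  h = exS3b b 1 q
  e = edgeCount G
  S≡ : S ≡ 2 * e
  S≡ = trans (degSum-totalDegree G) (handshake G)
  -- `μ` stands for either term of the minimum. The other `p` blocks cancel, since a copy of K_{b+4}
  -- has deficiency 0.
  finish : ∀ μ → (b + 3) * (b + 4 + q) ≤ 2 * h + 1 + μ → S + μ ≤ (b + 3) * n → 2 * e ≤ 2 * exS3b b (suc p) q + 1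
  finish μ t s = subst (λ z → 2 * e ≤ 2 * z + 1) (sym (exS3b-blocks b p q))
    (linear (2 * e + μ + (b + 3) * (b + 4 + q) + p * ((b + 4) * (b + 4)))
      ((b + 3) * (suc p * (b + 4) + q) + (2 * h + 1 + μ) + p * (2 * c + (b + 4))) 0
      (+-mono-≤ (+-mono-≤ (subst₂ (λ x y → x + μ ≤ (b + 3) * y) S≡ n≡ s) t)
          (≤-reflexive (cong (p *_) (sym (nC2 (b + 4))))))
      (eq e b p q h μ c))
    where
    eq : ∀ e b p q h μ c → 2 * e + ((b + 3) * (suc p * (b + 4) + q) + (2 * h + 1 + μ) + p * (2 * c + (b + 4))) + 0
      ≡ 2 * (p * c + h) + 1 + (2 * e + μ + (b + 3) * (b + 4 + q) + p * ((b + 4) * (b + 4)))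
    eq = solve-∀
  from-bound : Bound b S n q → 2 * e ≤ 2 * exS3b b (suc p) q + 1
  from-bound (by-clique s) = finish _ (proj₁ (tight 3<b q≤)) s
  from-bound (by-gap s)    = finish _ (proj₂ (tight 3<b q≤)) s

attains-blocks : ∀ {b n d} p → Attains b n d → Attains b (p * (b + 4) + n) (p * totalDegree (complete (b + 4)) + d)
attains-blocks zero A = A
attains-blocks {b} {n} {d} (suc p) A = subst₂ (Attains b) (sym (+-assoc (b + 4) (p * (b + 4)) n))
  (sym (+-assoc (totalDegree (complete (b + 4))) (p * totalDegree (complete (b + 4))) d))
      (attains-block (attains-blocks p A))

-- The guaranteed degree sum `d` may be one short of twice the formula; the actual degree sum is
-- even and makes up for it.
AttainsEx : ℕ → ℕ → Set
AttainsEx b q = Σ ℕ λ d → Attains b (b + 4 + q) d × 2 * exS3b b 1 q ≤ d + 1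

attains-rounded : ∀ {b q} Y {d} → exS3b b 1 q ≡ Y / 2 → Y ≤ d + 1 → Attains b (b + 4 + q) d → AttainsEx b q
attains-rounded Y {d} e h A = d , A , ≤-trans (≤-reflexive (cong (2 *_) e)) (≤-trans (2*/2 Y) h)

attains-case2 : ∀ {b q} → 22 ≤ b → q + 3 ≡ b → Attains b (b + 4 + q) (b * (2 * b + 1) + 2)
attains-case2 {b} {q} 22≤b refl with m≤n⇒∃[o]m+o≡n {2} {q} (+-cancelʳ-≤ 3 2 q (≤-trans (m≤m+n 5 17) 22≤b))
... | k , refl = subst₂ (λ b n → Attains b n (b * (2 * b + 1) + 2)) (eq₁ k) (eq₂ k) (attains-double-cross k)
  where
  eq₁ : ∀ k → k + 5 ≡ 2 + k + 3
  eq₁ = solve-∀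
  eq₂ : ∀ k → 3 + (k + 4) + (k + 4) ≡ 2 + k + 3 + 4 + (2 + k)
  eq₂ = solve-∀

attains-case3 : ∀ {b q} → 34 ≤ b → q + 2 ≡ b → Attains b (b + 4 + q) (b * (2 * b + 2) + 1 + b / 2)
attains-case3 {b} {q} 34≤b e with m≤n⇒∃[o]m+o≡n {4} {b / 2}
    (≤-trans (m≤m+n 4 13) (half-≤ {17} (≤-trans 34≤b (≤-half+ b))))
... | k , 4+k≡h = subst (λ n → Attains b n (b * (2 * b + 2) + 1 + b / 2)) size
    (subst₂ (λ b' h → Attains b' (h' + 2 + h + b') (b' * (2 * b' + 2) + 1 + h)) b≡ k+4≡h
        (attains-single-cross k h' h≤h'))
  where
  h' = b ∸ b / 2
  k+4≡h : k + 4 ≡ b / 2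
  k+4≡h = trans (+-comm k 4) 4+k≡h
  b≡ : k + 4 + h' ≡ b
  b≡ = trans (cong (_+ h') k+4≡h) (m+[n∸m]≡n (m/n≤m b 2))
  h≤h' : k + 4 ≤ h'
  h≤h' = m+n≤o⇒m≤o∸n (k + 4) (≤-trans (≤-reflexive
      (trans (cong (_+ b / 2) k+4≡h) (cong (b / 2 +_) (sym (+-identityʳ (b / 2)))))) (2*/2 b))
  size : h' + 2 + b / 2 + b ≡ b + 4 + q
  size = trans (eq₁ h' (b / 2) b) (trans (cong₂ (λ x y → x + y + 2) (m+[n∸m]≡n (m/n≤m b 2)) (sym e)) (eq₂ b q))
    where
    eq₁ : ∀ h' h b → h' + 2 + h + b ≡ h + h' + b + 2
    eq₁ = solve-∀
    eq₂ : ∀ b q → b + (q + 2) + 2 ≡ b + 4 + q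
    eq₂ = solve-∀

attainsEx : ∀ {b q} → q ≤ b + 3 → AttainsEx b q
attainsEx {b} {q} q≤ = branch₁ _ refl
  where
  branch₃ : case1 b q ≡ false → case2 b q ≡ false → ∀ x → case3 b q ≡ x → AttainsEx b q
  branch₃ e₁ e₂ true e₃ = attains-rounded {b} {q} (b * (2 * b + 2) + 2 + b / 2) (exS3b-case3 {b} {q} e₁ e₂ e₃)
    (≤-reflexive (eq (b * (2 * b + 2)) (b / 2))) (attains-case3 (proj₁ (case3-elim {b} {q} e₃))
        (proj₂ (case3-elim {b} {q} e₃)))
    where
    eq : ∀ x h → x + 2 + h ≡ x + 1 + h + 1
    eq = solve-∀
  branch₃ e₁ e₂ false e₃ = _ , attains-block (attains-clique (≤-trans q≤ (+-monoʳ-≤ b (n≤1+n 3)))) ,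
    ≤-trans (≤-reflexive (trans (cong (2 *_) (exS3b-otherwise {b} {q} e₁ e₂ e₃))
        (trans (eq ((b + 4) choose 2) (q choose 2))
      (cong₂ _+_ (sym (totalDegree-complete-C (b + 4))) (sym (totalDegree-complete-C q)))))) (m≤m+n _ 1)
    where
    eq : ∀ c d → 2 * (1 * c + d) ≡ 2 * c + 2 * d
    eq = solve-∀
  branch₂ : case1 b q ≡ false → ∀ x → case2 b q ≡ x → AttainsEx b q
  branch₂ e₁ true e₂ = attains-rounded {b} {q} (b * (2 * b + 1) + 3) (exS3b-case2 {b} {q} e₁ e₂)
    (≤-reflexive (sym (+-assoc (b * (2 * b + 1)) 2 1)))
        (attains-case2 (proj₁ (case2-elim {b} {q} e₂)) (proj₂ (case2-elim {b} {q} e₂)))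
  branch₂ e₁ false e₂ = branch₃ e₁ e₂ _ refl
  branch₁ : ∀ x → case1 b q ≡ x → AttainsEx b q
  branch₁ true e₁ = attains-rounded {b} {q} (b * (b + 4 + q)) (exS3b-case1 {b} {q} e₁)
    (≤-trans (m≤n+m∸n (b * (b + 4 + q)) 1) (≤-reflexive (+-comm 1 _)))
    (attains-regular (≤-trans (≤-trans (≤-reflexive (+-comm 1 b)) (+-monoʳ-≤ b (m≤m+n 1 3))) (m≤m+n (b + 4) q)))
  branch₁ false e₁ = branch₂ e₁ _ refl

theorem1p5 : (n b p q : ℕ) → 3 < b → b + 5 ≤ n → n ≡ p * (b + 4) + q → q ≤ b + 3 →
    IsEx n (doubleStar 3 b) (exS3b b p q)
theorem1p5 n b zero q 3<b b+5≤n n≡ q≤ = contradiction (≤-trans b+5≤n (≤-trans (≤-reflexive n≡) q≤))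
    (<⇒≱ (+-monoʳ-< b (m≤m+n 4 1)))
theorem1p5 n b (suc p) q 3<b b+5≤n n≡ q≤ with attainsEx {b} q≤
... | d , A , exd with subst (λ m → Attains b m _) (sym (trans n≡ (eq b p q))) (attains-blocks p A)
  where
  eq : ∀ b p q → suc p * (b + 4) + q ≡ p * (b + 4) + (b + 4 + q)
  eq = solve-∀
... | G , good , d≤ = (G , free , ≤-antisym (edgeCount-≤ p G 3<b n≡ q≤ free) lower) ,
    λ G' free' → edgeCount-≤ p G' 3<b n≡ q≤ free'
  where
  free : (G -free) (doubleStar 3 b)
  free = good⇒free {G = G} good
  c = (b + 4) choose 2
  lower : exS3b b (suc p) q ≤ edgeCount G
  lower = half-≤ (begin
    2 * exS3b b (suc p) q                              ≡⟨ cong (2 *_) (exS3b-blocks b p q) ⟩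
    2 * (p * c + exS3b b 1 q)                          ≡⟨ eq p c (exS3b b 1 q) ⟩
    p * (2 * c) + 2 * exS3b b 1 q                      ≤⟨ +-monoʳ-≤ (p * (2 * c)) exd ⟩
    p * (2 * c) + (d + 1)                              ≡⟨ cong (λ z → p * z + (d + 1))
        (totalDegree-complete-C (b + 4)) ⟨
    p * totalDegree (complete (b + 4)) + (d + 1)       ≡⟨ +-assoc (p * totalDegree (complete (b + 4))) d 1 ⟨
    p * totalDegree (complete (b + 4)) + d + 1         ≤⟨ +-monoˡ-≤ 1 (≤-trans d≤ (≤-reflexive (handshake G))) ⟩
    2 * edgeCount G + 1                                ∎)
    where
    open ≤-Reasoning
    eq : ∀ p c h → 2 * (p * c + h) ≡ p * (2 * c) + 2 * h
    eq = solve-∀
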